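{- Let $c(n)$ (resp. $d(n)$) be the number of permutations of $[n]$, $n\ge1$, in which every alternating run has length less than $3$ and the last alternating run has length $1$ (resp. $2$); set $c(0)=d(0)=0$. Then, with $Q(x)=\sum_{n\ge0}\bigl(E_{3n}\frac{x^{3n}}{(3n)!}-E_{3n+1}\frac{x^{3n+1}}{(3n+1)!}\bigr)$, \[ \sum_{n\ge0}c(n)\frac{x^n}{n!}=\frac{\sum_{n\ge0}\bigl(E_{3n+1}\frac{x^{3n+1}}{(3n+1)!}-E_{3n+2}\frac{x^{3n+2}}{(3n+2)!}\bigr)}{Q(x)},\qquad \sum_{n\ge0}d(n)\frac{x^n}{n!}=\frac{\sum_{n\ge0}\bigl(E_{3n+2}\frac{x^{3n+2}}{(3n+2)!}-E_{3n+3}\frac{x^{3n+3}}{(3n+3)!}\bigr)}{Q(x)}. \] Moreover these equal, respectively, \[ \frac{2\sqrt3\sinh(\frac12\sqrt3x)}{3\cos(\frac12x)-\sqrt3\sinh(\frac12\sqrt3x)}\quad\text{and}\quad \frac{3\sin(\frac12x)-3\cos(\frac12x)+3\cosh(\frac12\sqrt3x)-\sqrt3\sinh(\frac12\sqrt3x)}{3\cos(\frac12x)-\sqrt3\sinh(\frac12\sqrt3x)}. \]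
   Context: For $\pi\in\mathfrak S_n$, $i\in[n-1]$ is an alternating descent if $i$ odd and $\pi_i>\pi_{i+1}$, or $i$ even and $\pi_i<\pi_{i+1}$. An alternating run is a maximal block of consecutive entries containing no alternating descent; the last alternating run is the one containing $\pi_n$. $E_n$: $\sum E_nx^n/n!=\sec x+\tan x$. -}

module Defs where

open import Algebra.Bundles.Raw using (RawSemiring)
import Algebra.Definitions.RawSemiring as RawSemiringDefinitions
open import Data.Bool.Base using (if_then_else_)
open import Data.Fin.Base as Fin using (Fin; toℕ; fromℕ; inject₁)
import Data.Fin.Properties as Fin
open import Data.Integer.Base as ℤ using (+_)
open import Data.List.Base as List using (List)
open import Data.Nat.Base as ℕ using (ℕ; zero; suc; _∸_; _!)
open import Data.Nat.Divisibility using (_∣_; _∤_; _∣?_)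
import Data.Nat.Properties as ℕ
open import Data.Product.Base using (Σ-syntax; _×_)
open import Data.Rational.Base as ℚ using (ℚ; 0ℚ; 1ℚ; ½)
open import Data.Sum.Base using (_⊎_)
open import Data.Vec.Base as Vec using (Vec; []; _∷_; lookup)
open import Data.Vec.Relation.Unary.AllPairs using (allPairs?)
open import Data.Vec.Relation.Unary.Unique.Propositional using (Unique)
open import Relation.Binary.PropositionalEquality using (_≡_)
open import Relation.Nullary.Decidable
  using (Dec; does; ¬?; _×-dec_; _⊎-dec_; _→-dec_)
open import Relation.Nullary.Negation using (¬_)
open import Relation.Unary using (Decidable)

------------------------------------------------------------------------
-- Permutations of [n], n = suc m, in one-line notation

-- Entries and positions are 0-based: π_{i+1} is `lookup π i` with
-- i : Fin (suc m), and an index i : Fin m stands for the element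
-- suc (toℕ i) of [n-1], comparing the entries at inject₁ i and suc i.

Word : ℕ → Set
Word n = Vec (Fin n) n

module _ {m : ℕ} (π : Word (suc m)) where

  AltDescent : Fin m → Set
  AltDescent i =
      (2 ∤ suc (toℕ i) × lookup π (inject₁ i) Fin.> lookup π (Fin.suc i))
    ⊎ (2 ∣ suc (toℕ i) × lookup π (inject₁ i) Fin.< lookup π (Fin.suc i))

  -- The block of entries at positions a, …, b contains no alternating
  -- descent, i.e. none whose two entries both lie in the block.
  NoAltDescent : Fin (suc m) → Fin (suc m) → Set
  NoAltDescent a b =
    ∀ i → a Fin.≤ inject₁ i → Fin.suc i Fin.≤ b → ¬ AltDescent i

  AltRun : Fin (suc m) → Fin (suc m) → Set
  AltRun a b = a Fin.≤ b × NoAltDescent a b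
    × (∀ a′ b′ → a′ Fin.≤ a → b Fin.≤ b′ → NoAltDescent a′ b′ →
         a′ ≡ a × b′ ≡ b)

  blockLength : Fin (suc m) → Fin (suc m) → ℕ
  blockLength a b = suc (toℕ b ∸ toℕ a)

  AllAltRunsShort : Set
  AllAltRunsShort = ∀ a b → AltRun a b → blockLength a b ℕ.< 3

  -- A run containing the last entry necessarily ends there.
  LastAltRunHasLength : ℕ → Set
  LastAltRunHasLength ℓ =
    Σ[ a ∈ Fin (suc m) ] AltRun a (fromℕ m) × blockLength a (fromℕ m) ≡ ℓ

  altDescent? : Decidable AltDescent
  altDescent? i =
      (¬? (2 ∣? suc (toℕ i)) ×-dec (lookup π (Fin.suc i) Fin.<? lookup π (inject₁ i)))
    ⊎-dec ((2 ∣? suc (toℕ i)) ×-dec (lookup π (inject₁ i) Fin.<? lookup π (Fin.suc i)))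

  noAltDescent? : ∀ a b → Dec (NoAltDescent a b)
  noAltDescent? a b = Fin.all? λ i →
    (a Fin.≤? inject₁ i) →-dec ((Fin.suc i Fin.≤? b) →-dec ¬? (altDescent? i))

  altRun? : ∀ a b → Dec (AltRun a b)
  altRun? a b = (a Fin.≤? b) ×-dec noAltDescent? a b
    ×-dec Fin.all? λ a′ → Fin.all? λ b′ →
      (a′ Fin.≤? a) →-dec ((b Fin.≤? b′) →-dec (noAltDescent? a′ b′
        →-dec ((a′ Fin.≟ a) ×-dec (b′ Fin.≟ b))))

  allAltRunsShort? : Dec AllAltRunsShort
  allAltRunsShort? = Fin.all? λ a → Fin.all? λ b →
    altRun? a b →-dec (blockLength a b ℕ.<? 3)

  lastAltRunHasLength? : ∀ ℓ → Dec (LastAltRunHasLength ℓ)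
  lastAltRunHasLength? ℓ = Fin.any? λ a →
    altRun? a (fromℕ m) ×-dec (blockLength a (fromℕ m) ℕ.≟ ℓ)

words : ∀ n k → List (Vec (Fin n) k)
words n zero    = List.[ [] ]
words n (suc k) = List.cartesianProductWith _∷_ (List.allFin n) (words n k)

-- A word of length n over [n] with pairwise distinct entries is a
-- permutation of [n].
permutations : ∀ n → List (Word n)
permutations n = List.filter unique? (words n n)
  where
  unique? : Decidable (Unique {n = n})
  unique? = allPairs? (λ x y → ¬? (x Fin.≟ y))

countShortRuns : ℕ → ℕ → ℕ
countShortRuns m ℓ = List.length (List.filter
  (λ π → allAltRunsShort? π ×-dec lastAltRunHasLength? π ℓ)
  (permutations (suc m)))

c d : ℕ → ℕ
c zero    = 0
c (suc m) = countShortRuns m 1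
d zero    = 0
d (suc m) = countShortRuns m 2

------------------------------------------------------------------------
-- The field K = ℚ(√3)

infix 5 _+_√3

record K : Set where
  constructor _+_√3
  field
    rat irr : ℚ

fromℚ : ℚ → K
fromℚ p = p + 0ℚ √3

fromℕᴷ : ℕ → K
fromℕᴷ n = fromℚ (+ n ℚ./ 1)

0ᴷ 1ᴷ √3 ½ᴷ : K
0ᴷ = fromℚ 0ℚ
1ᴷ = fromℚ 1ℚ
√3 = 0ℚ + 1ℚ √3
½ᴷ = fromℚ ½

infixl 6 _+ᴷ_
infixl 7 _*ᴷ_

_+ᴷ_ _*ᴷ_ : K → K → K
(a + b √3) +ᴷ (a′ + b′ √3) = (a ℚ.+ a′) + (b ℚ.+ b′) √3
(a + b √3) *ᴷ (a′ + b′ √3) =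
  (a ℚ.* a′ ℚ.+ (+ 3 ℚ./ 1) ℚ.* (b ℚ.* b′)) + (a ℚ.* b′ ℚ.+ b ℚ.* a′) √3

-ᴷ_ : K → K
-ᴷ (a + b √3) = (ℚ.- a) + (ℚ.- b) √3

norm : K → ℚ
norm (a + b √3) = a ℚ.* a ℚ.- (+ 3 ℚ./ 1) ℚ.* (b ℚ.* b)

-- As 3 is not a square in ℚ, an element of K is nonzero if and only if
-- its norm is.
NonZeroᴷ : K → Set
NonZeroᴷ x = ℚ.NonZero (norm x)

recip : (x : K) → .{{NonZeroᴷ x}} → K
recip x@(a + b √3) = (a ℚ.÷ norm x) + (ℚ.- (b ℚ.÷ norm x)) √3

K-rawSemiring : RawSemiring _ _
K-rawSemiring = record
  { Carrier = K ; _≈_ = _≡_ ; _+_ = _+ᴷ_ ; _*_ = _*ᴷ_ ; 0# = 0ᴷ ; 1# = 1ᴷ }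

open RawSemiringDefinitions K-rawSemiring using (sum; _^_)

------------------------------------------------------------------------
-- Formal power series over K, given by their coefficients

Series : Set
Series = ℕ → K

infix  4 _≈_
infixl 6 _+_ _-_
infixl 7 _*_ _/_
infixr 8 _·_

_≈_ : Series → Series → Set
f ≈ g = ∀ n → f n ≡ g n

_+_ _-_ _*_ : Series → Series → Series
(f + g) n = f n +ᴷ g n
(f - g) n = f n +ᴷ (-ᴷ g n)
(f * g) n = sum {suc n} λ i → f (toℕ i) *ᴷ g (n ∸ toℕ i)

_·_ : K → Series → Series
(a · f) n = a *ᴷ f n

1ˢ : Series
1ˢ zero    = 1ᴷ
1ˢ (suc _) = 0ᴷ

module _ (f : Series) .{{_ : NonZeroᴷ (f 0)}} where

  -- The coefficients gₙ, …, g₀ of g = 1/f, in this order, from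
  -- f₀ g₀ = 1 and f₀ gₙ₊₁ = - ∑_{i ≤ n} fᵢ₊₁ gₙ₋ᵢ.
  inverseCoeffs : ∀ n → Vec K (suc n)
  inverseCoeffs zero    = recip (f 0) ∷ []
  inverseCoeffs (suc n) =
    (-ᴷ (recip (f 0) *ᴷ sum λ i → f (suc (toℕ i)) *ᴷ lookup gs i)) ∷ gs
    where gs = inverseCoeffs n

  inverse : Series
  inverse n = Vec.head (inverseCoeffs n)

_/_ : (f g : Series) → .{{NonZeroᴷ (g 0)}} → Series
f / g = f * inverse g

-- f ⟨ a x⟩ is the series f(ax).
infix 9 _⟨_x⟩
_⟨_x⟩ : Series → K → Series
(f ⟨ a x⟩) n = (a ^ n) *ᴷ f n

egf : (ℕ → K) → Series
egf a n = a n *ᴷ fromℚ ((+ 1 ℚ./ (n !)) {{n ℕ.!≢0}})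

-- every3rd r f = ∑_{k ≥ 0} f_{3k+r} x^{3k+r}; here r may exceed 2, so
-- every3rd 3 f, unlike every3rd 0 f, has no constant term.
every3rd : ℕ → Series → Series
every3rd r f n =
  if does ((r ℕ.≤? n) ×-dec (3 ∣? (n ∸ r))) then f n else 0ᴷ

sin cos sinh cosh : Series
sin = egf s
  where
  s : ℕ → K
  s 0             = 0ᴷ
  s 1             = 1ᴷ
  s (suc (suc n)) = -ᴷ s n
cos = egf s
  where
  s : ℕ → K
  s 0             = 1ᴷ
  s 1             = 0ᴷ
  s (suc (suc n)) = -ᴷ s n
sinh = egf s
  where
  s : ℕ → K
  s 0             = 0ᴷ
  s 1             = 1ᴷ
  s (suc (suc n)) = s n
cosh = egf s
  where
  s : ℕ → K
  s 0             = 1ᴷ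
  s 1             = 0ᴷ
  s (suc (suc n)) = s n

sec tan : Series
sec = 1ˢ / cos
tan = sin / cos

E : ℕ → K
E n = fromℕᴷ (n !) *ᴷ (sec + tan) n

Q : Series
Q = every3rd 0 (egf E) - every3rd 1 (egf E)

½√3 : K
½√3 = ½ᴷ *ᴷ √3

egfᴺ : (ℕ → ℕ) → Series
egfᴺ a = egf (λ n → fromℕᴷ (a n))

module Submission where

-- Describe a class of permutations of [n] by the vector of its counts by last
-- entry.  Appending an entry that has to be larger (smaller) than the last one
-- acts on these vectors by summation from the left (right).  The two operators
-- add up to a constant vector, so that words joined without a condition at the
-- joint are counted by a product of exponential generating functions.  Let A
-- count the permutations with short runs, and B_k those in which all runs but
-- the last are short and the last one has length k.  Then
-- A E_k x^k/k! = B_k + B_{k+1} + B_{k+2}, and alternating sums of these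
-- equations telescope to B_1 = A (E_1 x - E_2 x²/2! + E_4 x⁴/4! - …) and
-- B_2 = A (E_2 x²/2! - E_3 x³/3! + E_5 x⁵/5! - …); with A = 1 + B_1 + B_2 this
-- gives A Q = 1.  In the same way, with monotone last blocks, sec + tan counts
-- alternating words.
--
-- The series F = sec + tan satisfies 2F′ = 1 + F².  Hence, for the parts F₀, F₁
-- and F₂ of F with exponents 0, 1 and 2 modulo 3, the series u = F₀ - F₂ and
-- p = F₁ - F₂ solve a Riccati system, and u - p = Q.  The quotients
-- (3 cos (x/2) + √3 sinh (√3x/2)) / N and 2√3 sinh (√3x/2) / N with
-- N = 3 (sin (x/2) + cosh (√3x/2)) solve it too, with the same initial values.

-- Let ω be a primitive cube root of unity. Sorting exponents modulo 3 and using ω² = -1 - ω gives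
-- F(ωx) = u + pω, which is why exactly the differences u and p occur. For G = F(ωx) the equation
-- 2F′ = 1 + F² becomes 2G′ = ω(1 + G²), and the Riccati system consists of its coordinates with
-- respect to 1 and ω. The quotients come from F(ωx) = tan(π/4 + ωx/2) = (cos(x/2) + i sinh(√3x/2))
-- / (sin(x/2) + cosh(√3x/2)), rewritten in the same basis. Since ω does not lie in ℚ(√3), the
-- coordinates are treated as two unknown series, and the quotients are identified with them because
-- the system has only one solution. On the combinatorial side no value sets are chosen explicitly:
-- the binomial coefficients come from the fact that both summation operators commute with degree
-- elevation of polynomials in Bernstein form.

open import Algebra.Bundles using (CommutativeRing; Monoid; Semiring)
open import Data.Bool.Base using (Bool; not)
open import Data.Nat.Base as ℕ using (ℕ; zero; suc; z≤n; s≤s)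

-- Polynomial identities with integer coefficients in a commutative ring

module IntegerCoefficients {c ℓ} (R : CommutativeRing c ℓ) where

  open import Data.Integer.Base as ℤ using (ℤ; +_; -[1+_]; _⊖_)
  import Data.Integer.Properties as ℤ
  open import Data.Maybe.Base using (map)
  open import Relation.Nullary.Decidable using (dec⇒maybe)
  open import Relation.Binary.PropositionalEquality as ≡ using (_≡_)
  open import Algebra.Solver.Ring.AlmostCommutativeRing
    using (fromCommutativeRing; _-Raw-AlmostCommutative⟶_)
  import Algebra.Solver.Ring as RingSolver
  import Algebra.Properties.Ring as RingProperties
  import Algebra.Properties.Semiring.Mult.TCOptimised as Multiplication

  open CommutativeRing R
  open RingProperties ring
  open Multiplication semiring
  open import Relation.Binary.Reasoning.Setoid setoid

  ⟦_⟧ℤ : ℤ → Carrier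
  ⟦ + n ⟧ℤ      = n × 1#
  ⟦ -[1+ n ] ⟧ℤ = - (suc n × 1#)

  ⊖-homo : ∀ m n → ⟦ m ⊖ n ⟧ℤ ≈ m × 1# - n × 1#
  ⊖-homo m zero = sym (trans (+-congˡ -0#≈0#) (+-identityʳ _))
  ⊖-homo zero (suc n) = sym (+-identityˡ _)
  ⊖-homo (suc m) (suc n) = begin
    ⟦ suc m ⊖ suc n ⟧ℤ                ≡⟨ ≡.cong ⟦_⟧ℤ (ℤ.[1+m]⊖[1+n]≡m⊖n m n) ⟩
    ⟦ m ⊖ n ⟧ℤ                        ≈⟨ ⊖-homo m n ⟩
    m × 1# - n × 1#                   ≈⟨ +-congʳ (+-identityˡ _) ⟨
    (0# + m × 1#) - n × 1#            ≈⟨ +-congʳ (+-congʳ (-‿inverseʳ 1#)) ⟨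
    ((1# - 1#) + m × 1#) - n × 1#     ≈⟨ +-congʳ (+-assoc _ _ _) ⟩
    (1# + (- 1# + m × 1#)) - n × 1#   ≈⟨ +-congʳ (+-congˡ (+-comm _ _)) ⟩
    (1# + (m × 1# - 1#)) - n × 1#     ≈⟨ +-congʳ (+-assoc _ _ _) ⟨
    (1# + m × 1# - 1#) - n × 1#       ≈⟨ +-assoc _ _ _ ⟩
    1# + m × 1# + (- 1# - n × 1#)     ≈⟨ +-congˡ (-‿+-comm 1# (n × 1#)) ⟩
    1# + m × 1# - (1# + n × 1#)       ≈⟨ +-cong (1+× m 1#) (-‿cong (1+× n 1#)) ⟨
    suc m × 1# - suc n × 1#           ∎

  +-homo : ∀ i j → ⟦ i ℤ.+ j ⟧ℤ ≈ ⟦ i ⟧ℤ + ⟦ j ⟧ℤ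
  +-homo (+ m)    (+ n)    = ×-homo-+ 1# m n
  +-homo (+ m)    -[1+ n ] = ⊖-homo m (suc n)
  +-homo -[1+ m ] (+ n)    = trans (⊖-homo n (suc m)) (+-comm _ _)
  +-homo -[1+ m ] -[1+ n ] = begin
    - (suc (suc (m ℕ.+ n)) × 1#)     ≡⟨ ≡.cong (λ k → - (suc k × 1#)) (ℕ.+-suc m n) ⟨
    - ((suc m ℕ.+ suc n) × 1#)       ≈⟨ -‿cong (×-homo-+ 1# (suc m) (suc n)) ⟩
    - (suc m × 1# + suc n × 1#)      ≈⟨ -‿+-comm _ _ ⟨
    - (suc m × 1#) - suc n × 1#      ∎
    where import Data.Nat.Properties as ℕ

  -‿homo : ∀ i → ⟦ ℤ.- i ⟧ℤ ≈ - ⟦ i ⟧ℤ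
  -‿homo (+ zero)  = sym -0#≈0#
  -‿homo (+ suc n) = refl
  -‿homo -[1+ n ]  = sym (-‿involutive _)

  +*-homo : ∀ m j → ⟦ + m ℤ.* j ⟧ℤ ≈ m × 1# * ⟦ j ⟧ℤ
  +*-homo m (+ n) = begin
    ⟦ + m ℤ.* + n ⟧ℤ   ≡⟨ ≡.cong ⟦_⟧ℤ (ℤ.pos-* m n) ⟨
    (m ℕ.* n) × 1#     ≈⟨ ×1-homo-* m n ⟩
    m × 1# * n × 1#    ∎
  +*-homo m -[1+ n ] = begin
    ⟦ + m ℤ.* ℤ.- (+ suc n) ⟧ℤ     ≡⟨ ≡.cong ⟦_⟧ℤ (ℤ.neg-distribʳ-* (+ m) (+ suc n)) ⟨
    ⟦ ℤ.- (+ m ℤ.* + suc n) ⟧ℤ     ≈⟨ -‿homo (+ m ℤ.* + suc n) ⟩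
    - ⟦ + m ℤ.* + suc n ⟧ℤ         ≈⟨ -‿cong (+*-homo m (+ suc n)) ⟩
    - (m × 1# * suc n × 1#)        ≈⟨ -‿distribʳ-* _ _ ⟩
    m × 1# * - (suc n × 1#)        ∎

  *-homo : ∀ i j → ⟦ i ℤ.* j ⟧ℤ ≈ ⟦ i ⟧ℤ * ⟦ j ⟧ℤ
  *-homo (+ m)    j = +*-homo m j
  *-homo -[1+ m ] j = begin
    ⟦ ℤ.- (+ suc m) ℤ.* j ⟧ℤ       ≡⟨ ≡.cong ⟦_⟧ℤ (ℤ.neg-distribˡ-* (+ suc m) j) ⟨
    ⟦ ℤ.- (+ suc m ℤ.* j) ⟧ℤ       ≈⟨ -‿homo (+ suc m ℤ.* j) ⟩
    - ⟦ + suc m ℤ.* j ⟧ℤ           ≈⟨ -‿cong (+*-homo (suc m) j) ⟩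
    - (suc m × 1# * ⟦ j ⟧ℤ)        ≈⟨ -‿distribˡ-* _ _ ⟩
    - (suc m × 1#) * ⟦ j ⟧ℤ        ∎

  -- Equality of power series is not decidable, so the solver compares coefficients in ℤ; this
  -- homomorphism carries numerals into an arbitrary commutative ring.
  ℤ⟶R : ℤ.+-*-rawRing -Raw-AlmostCommutative⟶ fromCommutativeRing R
  ℤ⟶R = record
    { ⟦_⟧ = ⟦_⟧ℤ ; +-homo = +-homo ; *-homo = *-homo ; -‿homo = -‿homo
    ; 0-homo = refl ; 1-homo = refl }

  open RingSolver ℤ.+-*-rawRing (fromCommutativeRing R) ℤ⟶R
    (λ i j → map (λ i≡j → reflexive (≡.cong ⟦_⟧ℤ i≡j)) (dec⇒maybe (i ℤ.≟ j)))
    public using (solve; _:=_; _:+_; _:*_; _:-_; :-_; con)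

-- Formal power series: ring structure, derivation and trisection

module PowerSeries {c ℓ} (R : CommutativeRing c ℓ) where

  open import Data.Fin.Base using (Fin; toℕ)
  open import Data.Fin.Patterns using (0F; 1F; 2F)
  open import Data.Nat.Base as ℕ using (ℕ; zero; suc; _∸_; z≤n; s≤s)
  import Data.Nat.Properties as ℕ
  open import Data.Product.Base using (_,_)
  open import Level using (_⊔_)
  open import Relation.Binary.PropositionalEquality as ≡ using (_≡_)
  import Algebra.Definitions.RawSemiring as RawSemiringDefinitions
  open import Data.Integer.Base using (+_)
  open IntegerCoefficients R

  open CommutativeRing R
  open RawSemiringDefinitions (Semiring.rawSemiring semiring) using (sum; _×_)
  open import Relation.Binary.Reasoning.Setoid setoid

  Series : Set c
  Series = ℕ → Carrier

  infix  4 _≈ˢ_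
  infixl 6 _+ˢ_
  infixl 7 _*ˢ_
  infixr 8 _·_

  _≈ˢ_ : Series → Series → Set ℓ
  f ≈ˢ g = ∀ n → f n ≈ g n

  _+ˢ_ _*ˢ_ : Series → Series → Series
  (f +ˢ g) n = f n + g n
  (f *ˢ g) n = sum {suc n} λ i → f (toℕ i) * g (n ∸ toℕ i)

  -ˢ_ tail : Series → Series
  (-ˢ f) n = - f n
  tail f n = f (suc n)

  _·_ : Carrier → Series → Series
  (a · f) n = a * f n

  0ˢ 1ˢ : Series
  0ˢ _       = 0#
  1ˢ zero    = 1#
  1ˢ (suc _) = 0#

  -- The proofs below all rest on (f *ˢ g) (suc n) being, definitionally,
  -- f 0 * g (suc n) + (tail f *ˢ g) n.

  *ˢ-cong-≤ : ∀ n {f f′ g g′} →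
    (∀ i → i ℕ.≤ n → f i ≈ f′ i) → (∀ i → i ℕ.≤ n → g i ≈ g′ i) →
    (f *ˢ g) n ≈ (f′ *ˢ g′) n
  *ˢ-cong-≤ zero    p q = +-congʳ (*-cong (p 0 z≤n) (q 0 z≤n))
  *ˢ-cong-≤ (suc n) p q = +-cong (*-cong (p 0 z≤n) (q (suc n) ℕ.≤-refl))
    (*ˢ-cong-≤ n (λ i i≤n → p (suc i) (s≤s i≤n)) (λ i i≤n → q i (ℕ.m≤n⇒m≤1+n i≤n)))

  *ˢ-cong : ∀ {f f′ g g′} → f ≈ˢ f′ → g ≈ˢ g′ → f *ˢ g ≈ˢ f′ *ˢ g′
  *ˢ-cong p q n = *ˢ-cong-≤ n (λ i _ → p i) (λ i _ → q i)

  *ˢ-distribʳ : ∀ h f g → (f +ˢ g) *ˢ h ≈ˢ f *ˢ h +ˢ g *ˢ h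
  *ˢ-distribʳ h f g zero = solve 3 (λ f g h →
    (f :+ g) :* h :+ con (+ 0) := (f :* h :+ con (+ 0)) :+ (g :* h :+ con (+ 0)))
    refl (f 0) (g 0) (h 0)
  *ˢ-distribʳ h f g (suc n) = begin
    (f 0 + g 0) * h (suc n) + ((tail f +ˢ tail g) *ˢ h) n
      ≈⟨ +-congˡ (*ˢ-distribʳ h (tail f) (tail g) n) ⟩
    (f 0 + g 0) * h (suc n) + ((tail f *ˢ h) n + (tail g *ˢ h) n)
      ≈⟨ solve 5 (λ f g h x y → (f :+ g) :* h :+ (x :+ y) := (f :* h :+ x) :+ (g :* h :+ y))
           refl (f 0) (g 0) (h (suc n)) _ _ ⟩
    (f *ˢ h) (suc n) + (g *ˢ h) (suc n) ∎

  ·-*ˢ-assoc : ∀ a f g → (a · f) *ˢ g ≈ˢ a · (f *ˢ g)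
  ·-*ˢ-assoc a f g zero = solve 3 (λ a f g →
    a :* f :* g :+ con (+ 0) := a :* (f :* g :+ con (+ 0))) refl a (f 0) (g 0)
  ·-*ˢ-assoc a f g (suc n) = begin
    a * f 0 * g (suc n) + ((a · tail f) *ˢ g) n
      ≈⟨ +-congˡ (·-*ˢ-assoc a (tail f) g n) ⟩
    a * f 0 * g (suc n) + a * (tail f *ˢ g) n
      ≈⟨ solve 4 (λ a f g x → a :* f :* g :+ a :* x := a :* (f :* g :+ x))
           refl a (f 0) (g (suc n)) _ ⟩
    a * (f *ˢ g) (suc n) ∎

  *ˢ-assoc : ∀ f g h → (f *ˢ g) *ˢ h ≈ˢ f *ˢ (g *ˢ h)
  *ˢ-assoc f g h zero = solve 3 (λ f g h →
    (f :* g :+ con (+ 0)) :* h :+ con (+ 0) := f :* (g :* h :+ con (+ 0)) :+ con (+ 0))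
    refl (f 0) (g 0) (h 0)
  *ˢ-assoc f g h (suc n) = begin
    (f 0 * g 0 + 0#) * h (suc n) + ((f 0 · tail g +ˢ tail f *ˢ g) *ˢ h) n
      ≈⟨ +-congˡ (*ˢ-distribʳ h (f 0 · tail g) (tail f *ˢ g) n) ⟩
    (f 0 * g 0 + 0#) * h (suc n) + (((f 0 · tail g) *ˢ h) n + ((tail f *ˢ g) *ˢ h) n)
      ≈⟨ +-congˡ (+-cong (·-*ˢ-assoc (f 0) (tail g) h n) (*ˢ-assoc (tail f) g h n)) ⟩
    (f 0 * g 0 + 0#) * h (suc n) + (f 0 * (tail g *ˢ h) n + (tail f *ˢ (g *ˢ h)) n)
      ≈⟨ solve 5 (λ f g h x y → (f :* g :+ con (+ 0)) :* h :+ (f :* x :+ y)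
                              := f :* (g :* h :+ x) :+ y)
           refl (f 0) (g 0) (h (suc n)) _ _ ⟩
    (f *ˢ (g *ˢ h)) (suc n) ∎

  -- The product peels off the first coefficient of its left factor only. Splitting off both end
  -- terms leaves the product of the two tails, hence the induction in steps of two.
  *ˢ-comm : ∀ f g → f *ˢ g ≈ˢ g *ˢ f
  *ˢ-comm f g zero = +-congʳ (*-comm (f 0) (g 0))
  *ˢ-comm f g (suc zero) =
    solve 4 (λ f₀ f₁ g₀ g₁ → f₀ :* g₁ :+ (f₁ :* g₀ :+ con (+ 0))
                           := g₀ :* f₁ :+ (g₁ :* f₀ :+ con (+ 0)))
      refl (f 0) (f 1) (g 0) (g 1)
  *ˢ-comm f g (suc (suc n)) = begin
    f 0 * g (2 ℕ.+ n) + (tail f *ˢ g) (suc n)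
      ≈⟨ +-congˡ (*ˢ-comm (tail f) g (suc n)) ⟩
    f 0 * g (2 ℕ.+ n) + (g 0 * f (2 ℕ.+ n) + (tail g *ˢ tail f) n)
      ≈⟨ +-congˡ (+-congˡ (*ˢ-comm (tail g) (tail f) n)) ⟩
    f 0 * g (2 ℕ.+ n) + (g 0 * f (2 ℕ.+ n) + (tail f *ˢ tail g) n)
      ≈⟨ solve 3 (λ a b x → a :+ (b :+ x) := b :+ (a :+ x)) refl _ _ _ ⟩
    g 0 * f (2 ℕ.+ n) + (f 0 * g (2 ℕ.+ n) + (tail f *ˢ tail g) n)
      ≈⟨ +-congˡ (*ˢ-comm (tail g) f (suc n)) ⟨
    (g *ˢ f) (suc (suc n)) ∎

  *ˢ-zeroˡ : ∀ f → 0ˢ *ˢ f ≈ˢ 0ˢ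
  *ˢ-zeroˡ f zero    = trans (+-identityʳ _) (zeroˡ _)
  *ˢ-zeroˡ f (suc n) = trans (+-cong (zeroˡ _) (*ˢ-zeroˡ f n)) (+-identityʳ _)

  *ˢ-identityˡ : ∀ f → 1ˢ *ˢ f ≈ˢ f
  *ˢ-identityˡ f zero    = trans (+-identityʳ _) (*-identityˡ _)
  *ˢ-identityˡ f (suc n) =
    trans (+-cong (*-identityˡ _) (*ˢ-zeroˡ f n)) (+-identityʳ _)

  *ˢ-identityʳ : ∀ f → f *ˢ 1ˢ ≈ˢ f
  *ˢ-identityʳ f n = trans (*ˢ-comm f 1ˢ n) (*ˢ-identityˡ f n)

  *ˢ-distribˡ : ∀ h f g → h *ˢ (f +ˢ g) ≈ˢ h *ˢ f +ˢ h *ˢ g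
  *ˢ-distribˡ h f g n = begin
    (h *ˢ (f +ˢ g)) n           ≈⟨ *ˢ-comm h (f +ˢ g) n ⟩
    ((f +ˢ g) *ˢ h) n           ≈⟨ *ˢ-distribʳ h f g n ⟩
    (f *ˢ h) n + (g *ˢ h) n     ≈⟨ +-cong (*ˢ-comm f h n) (*ˢ-comm g h n) ⟩
    (h *ˢ f) n + (h *ˢ g) n     ∎

  seriesRing : CommutativeRing c ℓ
  seriesRing = record
    { Carrier = Series ; _≈_ = _≈ˢ_ ; _+_ = _+ˢ_ ; _*_ = _*ˢ_ ; -_ = -ˢ_
    ; 0# = 0ˢ ; 1# = 1ˢ
    ; isCommutativeRing = record
      { isRing = record
        { +-isAbelianGroup = record
          { isGroup = record
            { isMonoid = record
              { isSemigroup = record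
                { isMagma = record
                  { isEquivalence = record
                    { refl  = λ _ → refl
                    ; sym   = λ p n → sym (p n)
                    ; trans = λ p q n → trans (p n) (q n) }
                  ; ∙-cong = λ p q n → +-cong (p n) (q n) }
                ; assoc = λ f g h n → +-assoc _ _ _ }
              ; identity = (λ f n → +-identityˡ _) , (λ f n → +-identityʳ _) }
            ; inverse = (λ f n → -‿inverseˡ _) , (λ f n → -‿inverseʳ _)
            ; ⁻¹-cong = λ p n → -‿cong (p n) }
          ; comm = λ f g n → +-comm _ _ }
        ; *-cong = *ˢ-cong
        ; *-assoc = *ˢ-assoc
        ; *-identity = *ˢ-identityˡ , *ˢ-identityʳ
        ; distrib = *ˢ-distribˡ , *ˢ-distribʳ }
      ; *-comm = *ˢ-comm } }

  ι : ℕ → Carrier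
  ι n = n × 1#

  -- `φ n` is 1/n!. Having these elements amounts to every positive integer being invertible.
  record ReciprocalFactorials : Set (c ⊔ ℓ) where
    field
      φ      : ℕ → Carrier
      φ-zero : φ 0 ≈ 1#
      φ-suc  : ∀ n → φ (suc n) * ι (suc n) ≈ φ n

  -- `θ` is x d/dx and `∂` is d/dx. The Leibniz rule is proved for `θ` first, since `θ` preserves
  -- degrees and so follows the recursion of the product.
  θ ∂ : Series → Series
  θ f n = ι n * f n
  ∂ f   = tail (θ f)

  θ-*ˢ : ∀ f g → θ (f *ˢ g) ≈ˢ θ f *ˢ g +ˢ f *ˢ θ g
  θ-*ˢ f g zero = solve 2 (λ f g → con (+ 0) :* (f :* g :+ con (+ 0))
    := (con (+ 0) :* f :* g :+ con (+ 0)) :+ (f :* (con (+ 0) :* g) :+ con (+ 0)))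
    refl (f 0) (g 0)
  θ-*ˢ f g (suc n) = begin
    (1# + ι n) * (f 0 * g (suc n) + (tail f *ˢ g) n)
      ≈⟨ solve 4 (λ a f g x → (con (+ 1) :+ a) :* (f :* g :+ x)
           := f :* ((con (+ 1) :+ a) :* g) :+ (x :+ a :* x))
           refl (ι n) (f 0) (g (suc n)) _ ⟩
    f 0 * θ g (suc n) + ((tail f *ˢ g) n + θ (tail f *ˢ g) n)
      ≈⟨ +-congˡ (+-congˡ (θ-*ˢ (tail f) g n)) ⟩
    f 0 * θ g (suc n) + ((tail f *ˢ g) n + ((θ (tail f) *ˢ g) n + (tail f *ˢ θ g) n))
      ≈⟨ solve 6 (λ f g′ g x y z → f :* g′ :+ (x :+ (y :+ z))
           := (con (+ 0) :* f :* g :+ (x :+ y)) :+ (f :* g′ :+ z))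
           refl (f 0) (θ g (suc n)) (g (suc n)) _ _ _ ⟩
    (0# * f 0 * g (suc n) + ((tail f *ˢ g) n + (θ (tail f) *ˢ g) n)) + (f *ˢ θ g) (suc n)
      ≈⟨ +-congʳ (+-congˡ (*ˢ-distribʳ g (tail f) (θ (tail f)) n)) ⟨
    (0# * f 0 * g (suc n) + ((tail f +ˢ θ (tail f)) *ˢ g) n) + (f *ˢ θ g) (suc n)
      -- `tail f +ˢ θ (tail f)` is `tail (θ f)`, because the shift raises every weight by one.
      ≈⟨ +-congʳ (+-congˡ (*ˢ-cong {g = g} {g} (λ i → solve 2 (λ f a → f :+ a :* f
           := (con (+ 1) :+ a) :* f) refl (f (suc i)) (ι i)) (λ _ → refl) n)) ⟩
    (θ f *ˢ g) (suc n) + (f *ˢ θ g) (suc n) ∎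

  ∂-*ˢ : ∀ f g → ∂ (f *ˢ g) ≈ˢ ∂ f *ˢ g +ˢ f *ˢ ∂ g
  ∂-*ˢ f g n = begin
    θ (f *ˢ g) (suc n)                          ≈⟨ θ-*ˢ f g (suc n) ⟩
    (θ f *ˢ g) (suc n) + (f *ˢ θ g) (suc n)     ≈⟨ +-cong (lemma f g) (*ˢ-comm f (θ g) (suc n)) ⟩
    (∂ f *ˢ g) n + (θ g *ˢ f) (suc n)           ≈⟨ +-congˡ (lemma g f) ⟩
    (∂ f *ˢ g) n + (∂ g *ˢ f) n                 ≈⟨ +-congˡ (*ˢ-comm (∂ g) f n) ⟩
    (∂ f *ˢ g) n + (f *ˢ ∂ g) n                 ∎
    where
    lemma : ∀ f g → (θ f *ˢ g) (suc n) ≈ (∂ f *ˢ g) n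
    lemma f g = solve 3 (λ f g x → con (+ 0) :* f :* g :+ x := x)
      refl (f 0) (g (suc n)) _

  ∂-cong : ∀ {f g} → f ≈ˢ g → ∂ f ≈ˢ ∂ g
  ∂-cong p n = *-congˡ (p (suc n))

  ∂-+ˢ : ∀ f g → ∂ (f +ˢ g) ≈ˢ ∂ f +ˢ ∂ g
  ∂-+ˢ f g n = distribˡ _ _ _

  ∂-·ˢ : ∀ a f → ∂ (a · f) ≈ˢ a · ∂ f
  ∂-·ˢ a f n = solve 3 (λ a b x → b :* (a :* x) := a :* (b :* x)) refl a (ι (suc n)) (f (suc n))

  prev : Fin 3 → Fin 3
  prev 0F = 2F
  prev 1F = 0F
  prev 2F = 1F

  prev³ : ∀ r → prev (prev (prev r)) ≡ r
  prev³ 0F = ≡.refl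
  prev³ 1F = ≡.refl
  prev³ 2F = ≡.refl

  -- P r f keeps the terms of f whose exponents are r modulo 3.
  P : Fin 3 → Series → Series
  P r  f (suc n) = P (prev r) (tail f) n
  P 0F f zero    = f 0
  P 1F f zero    = 0#
  P 2F f zero    = 0#

  P-cong : ∀ r {f g} → f ≈ˢ g → P r f ≈ˢ P r g
  P-cong 0F p zero    = p 0
  P-cong 1F p zero    = refl
  P-cong 2F p zero    = refl
  P-cong r  p (suc n) = P-cong (prev r) (λ i → p (suc i)) n

  P-+ˢ : ∀ r f g → P r (f +ˢ g) ≈ˢ P r f +ˢ P r g
  P-+ˢ 0F f g zero    = refl
  P-+ˢ 1F f g zero    = sym (+-identityʳ _)
  P-+ˢ 2F f g zero    = sym (+-identityʳ _)
  P-+ˢ r  f g (suc n) = P-+ˢ (prev r) (tail f) (tail g) n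

  -- Trisection only deletes coefficients, so it commutes with every coefficientwise weight: with
  -- scalars, with the weights of `∂`, and in `P-as-weight` with the series itself.
  P-weight : ∀ r (a : Series) f n → P r (λ i → a i * f i) n ≈ a n * P r f n
  P-weight 0F a f zero    = refl
  P-weight 1F a f zero    = sym (zeroʳ _)
  P-weight 2F a f zero    = sym (zeroʳ _)
  P-weight r  a f (suc n) = P-weight (prev r) (tail a) (tail f) n

  P-∂ : ∀ r f → P (prev r) (∂ f) ≈ˢ ∂ (P r f)
  P-∂ r f = P-weight (prev r) (tail ι) (tail f)

  -- Residues of exponents add, so a factor of residue j needs a partner of residue r - j.
  P-*ˢ : ∀ r f g → P r (f *ˢ g) ≈ˢ
    P 0F f *ˢ P r g +ˢ P 1F f *ˢ P (prev r) g +ˢ P 2F f *ˢ P (prev (prev r)) g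
  P-*ˢ 0F f g zero = solve 2 (λ f g → f :* g :+ con (+ 0)
    := f :* g :+ con (+ 0) :+ (con (+ 0) :* con (+ 0) :+ con (+ 0))
       :+ (con (+ 0) :* con (+ 0) :+ con (+ 0))) refl (f 0) (g 0)
  P-*ˢ 1F f g zero = solve 2 (λ f g → con (+ 0)
    := f :* con (+ 0) :+ con (+ 0) :+ (con (+ 0) :* g :+ con (+ 0))
       :+ (con (+ 0) :* con (+ 0) :+ con (+ 0))) refl (f 0) (g 0)
  P-*ˢ 2F f g zero = solve 2 (λ f g → con (+ 0)
    := f :* con (+ 0) :+ con (+ 0) :+ (con (+ 0) :* con (+ 0) :+ con (+ 0))
       :+ (con (+ 0) :* g :+ con (+ 0))) refl (f 0) (g 0)
  P-*ˢ r f g (suc n) = begin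
    P r′ (f 0 · tail g +ˢ tail f *ˢ g) n
      ≈⟨ P-+ˢ r′ (f 0 · tail g) (tail f *ˢ g) n ⟩
    P r′ (f 0 · tail g) n + P r′ (tail f *ˢ g) n
      ≈⟨ +-cong (P-weight r′ (λ _ → f 0) (tail g) n) (P-*ˢ r′ (tail f) g n) ⟩
    f 0 * P r′ (tail g) n + ((P 0F (tail f) *ˢ P r′ g) n
      + (P 1F (tail f) *ˢ P (prev r′) g) n + (P 2F (tail f) *ˢ P (prev (prev r′)) g) n)
      ≡⟨ ≡.cong (λ s → f 0 * P r′ (tail g) n + ((P 0F (tail f) *ˢ P r′ g) n
           + (P 1F (tail f) *ˢ P (prev r′) g) n + (P 2F (tail f) *ˢ P s g) n)) (prev³ r) ⟩
    f 0 * P r′ (tail g) n + ((P 0F (tail f) *ˢ P r′ g) n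
      + (P 1F (tail f) *ˢ P (prev r′) g) n + (P 2F (tail f) *ˢ P r g) n)
      ≈⟨ solve 6 (λ a x y z v w → a :+ (x :+ y :+ z)
          := a :+ z :+ (con (+ 0) :* v :+ x) :+ (con (+ 0) :* w :+ y)) refl _ _ _ _ _ _ ⟩
    (P 0F f *ˢ P r g +ˢ P 1F f *ˢ P r′ g +ˢ P 2F f *ˢ P (prev r′) g) (suc n) ∎
    where r′ = prev r

-- Counting by last entry; words joined without a condition

alt : Bool → ℕ → Bool
alt σ zero    = σ
alt σ (suc i) = not (alt σ i)

module Juxtaposition {c ℓ} (R : CommutativeRing c ℓ)
  (I : PowerSeries.ReciprocalFactorials R) where

  open import Data.Nat.Base using (_!)
  import Data.Nat.Properties as ℕ
  open import Data.Bool.Base using (Bool; true; false; not)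
  open import Data.Integer.Base using (+_)
  open import Relation.Binary.PropositionalEquality as ≡ using (_≡_)
  open IntegerCoefficients R
  open CommutativeRing R
  open PowerSeries R using (ReciprocalFactorials; module ReciprocalFactorials; Series; _≈ˢ_; _+ˢ_; _*ˢ_; _·_; 0ˢ; tail; ι; *ˢ-comm; *ˢ-cong; seriesRing)
  open ReciprocalFactorials I
  open import Relation.Binary.Reasoning.Setoid setoid
  open import Algebra.Properties.Semiring.Mult semiring using (×1-homo-*)

  private module S = CommutativeRing seriesRing

  ι-!-inverse : ∀ n → φ n * ι (n !) ≈ 1#
  ι-!-inverse zero    = trans (*-congʳ φ-zero) (trans (*-identityˡ _) (+-identityʳ _))
  ι-!-inverse (suc n) = begin
    φ (suc n) * ι (suc n ℕ.* n !)       ≈⟨ *-congˡ (×1-homo-* (suc n) (n !)) ⟩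
    φ (suc n) * (ι (suc n) * ι (n !))   ≈⟨ *-assoc _ _ _ ⟨
    φ (suc n) * ι (suc n) * ι (n !)     ≈⟨ *-congʳ (φ-suc n) ⟩
    φ n * ι (n !)                       ≈⟨ ι-!-inverse n ⟩
    1#                                  ∎

  ι⁻¹ : ℕ → Carrier
  ι⁻¹ n = φ (suc n) * ι (n !)

  ι⁻¹-inverse : ∀ n → ι⁻¹ n * ι (suc n) ≈ 1#
  ι⁻¹-inverse n = begin
    φ (suc n) * ι (n !) * ι (suc n)     ≈⟨ solve 3 (λ x y z → x :* y :* z := x :* z :* y) refl _ _ _ ⟩
    φ (suc n) * ι (suc n) * ι (n !)     ≈⟨ *-congʳ (φ-suc n) ⟩
    φ n * ι (n !)                       ≈⟨ ι-!-inverse n ⟩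
    1#                                  ∎

  ι-cancel : ∀ n {x y} → ι (suc n) * x ≈ ι (suc n) * y → x ≈ y
  ι-cancel n {x} {y} p = begin
    x                             ≈⟨ lemma x ⟨
    ι⁻¹ n * (ι (suc n) * x)       ≈⟨ *-congˡ p ⟩
    ι⁻¹ n * (ι (suc n) * y)       ≈⟨ lemma y ⟩
    y                             ∎
    where
    lemma : ∀ x → ι⁻¹ n * (ι (suc n) * x) ≈ x
    lemma x = trans (sym (*-assoc _ _ _)) (trans (*-congʳ (ι⁻¹-inverse n)) (*-identityˡ x))

  -- For a class of permutations of [n], a vector f records in f j, j < n,
  -- how many members have j as their last (0-based) entry; the values of f
  -- beyond n are irrelevant.  Σ f j sums the first j values of f, and
  -- `step` appends an entry that is larger (true) or smaller (false) than
  -- the previous one.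
  Σ : Series → Series
  Σ f zero    = 0#
  Σ f (suc j) = Σ f j + f j

  step : Bool → ℕ → Series → Series
  step true  n f j = Σ f j
  step false n f j = Σ f n - Σ f j

  𝟙 : Series
  𝟙 _ = 1#

  Σ-cong : ∀ {f g} → f ≈ˢ g → Σ f ≈ˢ Σ g
  Σ-cong p zero    = refl
  Σ-cong p (suc j) = +-cong (Σ-cong p j) (p j)

  Σ-+ˢ : ∀ f g → Σ (f +ˢ g) ≈ˢ Σ f +ˢ Σ g
  Σ-+ˢ f g zero    = sym (+-identityʳ _)
  Σ-+ˢ f g (suc j) = trans (+-congʳ (Σ-+ˢ f g j))
    (solve 4 (λ a b x y → a :+ b :+ (x :+ y) := a :+ x :+ (b :+ y)) refl _ _ _ _)

  Σ-· : ∀ a f → Σ (a · f) ≈ˢ a · Σ f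
  Σ-· a f zero    = sym (zeroʳ a)
  Σ-· a f (suc j) = trans (+-congʳ (Σ-· a f j)) (sym (distribˡ _ _ _))

  step-cong : ∀ o n {f g} → f ≈ˢ g → step o n f ≈ˢ step o n g
  step-cong true  n p j = Σ-cong p j
  step-cong false n p j = +-cong (Σ-cong p n) (-‿cong (Σ-cong p j))

  step-+ˢ : ∀ o n f g → step o n (f +ˢ g) ≈ˢ step o n f +ˢ step o n g
  step-+ˢ true  n f g j = Σ-+ˢ f g j
  step-+ˢ false n f g j = trans (+-cong (Σ-+ˢ f g n) (-‿cong (Σ-+ˢ f g j)))
    (solve 4 (λ a b x y → a :+ b :- (x :+ y) := (a :- x) :+ (b :- y)) refl _ _ _ _)

  step-· : ∀ o n a f → step o n (a · f) ≈ˢ a · step o n f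
  step-· true  n a f j = Σ-· a f j
  step-· false n a f j = trans (+-cong (Σ-· a f n) (-‿cong (Σ-· a f j)))
    (solve 3 (λ a x y → a :* x :- a :* y := a :* (x :- y)) refl _ _ _)

  step-+-step : ∀ o n f → step o n f +ˢ step (not o) n f ≈ˢ Σ f n · 𝟙
  step-+-step true  n f j = solve 2 (λ x y → x :+ (y :- x) := y :* con (+ 1)) refl _ _
  step-+-step false n f j = solve 2 (λ x y → y :- x :+ x := y :* con (+ 1)) refl _ _

  -- ε inserts an additional, irrelevant entry in front of the word.  In
  -- terms of the polynomials ∑ f j x^j (1-x)^(n-1-j) / (j! (n-1-j)!), `step`
  -- is integration over [0,x] or [x,1], and ε is degree elevation.
  ε : ℕ → Series → Series
  ε n f zero    = ι n * f 0
  ε n f (suc j) = ι (suc j) * f j + (ι n - ι (suc j)) * f (suc j)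

  ε-cong : ∀ n {f g} → f ≈ˢ g → ε n f ≈ˢ ε n g
  ε-cong n p zero    = *-congˡ (p 0)
  ε-cong n p (suc j) = +-cong (*-congˡ (p j)) (*-congˡ (p (suc j)))

  ε-𝟙 : ∀ n a → ε n (a · 𝟙) ≈ˢ (ι n * a) · 𝟙
  ε-𝟙 n a zero    = sym (*-assoc _ _ _)
  ε-𝟙 n a (suc j) = solve 3 (λ a n j → j :* (a :* con (+ 1)) :+ (n :- j) :* (a :* con (+ 1))
    := n :* a :* con (+ 1)) refl a (ι n) (ι (suc j))

  Σ-ε : ∀ n f → Σ (ε n f) ≈ˢ ε (suc n) (Σ f)
  Σ-ε n f zero       = sym (zeroʳ _)
  Σ-ε n f (suc zero) = solve 2 (λ n f → con (+ 0) :+ n :* f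
    := (con (+ 1) :+ con (+ 0)) :* con (+ 0)
       :+ (con (+ 1) :+ n :- (con (+ 1) :+ con (+ 0))) :* (con (+ 0) :+ f)) refl (ι n) (f 0)
  Σ-ε n f (suc (suc j)) = trans (+-congʳ (Σ-ε n f (suc j)))
    (solve 5 (λ n j s x y →
      j :* s :+ (con (+ 1) :+ n :- j) :* (s :+ x) :+ (j :* x :+ (n :- j) :* y)
      := (con (+ 1) :+ j) :* (s :+ x) :+ (con (+ 1) :+ n :- (con (+ 1) :+ j)) :* (s :+ x :+ y))
      refl (ι n) (ι (suc j)) (Σ f j) (f j) (f (suc j)))

  -- In polynomial terms, `Σ f n` over n! is the integral over [0,1]. As `ε` keeps the polynomial
  -- and raises n by one, the sum is multiplied by n + 1.
  Σ-ε-total : ∀ n f → Σ (ε n f) (suc n) ≈ ι (suc n) * Σ f n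
  Σ-ε-total n f = trans (Σ-ε n f (suc n))
    (solve 3 (λ a x y → a :* x :+ (a :- a) :* y := a :* x) refl _ _ _)

  -- `ε` rewrites the same polynomial in a higher degree, so both sides represent the same integral.
  step-ε : ∀ o n f → step o (suc n) (ε n f) ≈ˢ ε (suc n) (step o n f)
  step-ε true  n f j = Σ-ε n f j
  step-ε false n f j = begin
    Σ (ε n f) (suc n) - Σ (ε n f) j                ≈⟨ +-cong (Σ-ε-total n f) (-‿cong (Σ-ε n f j)) ⟩
    ι (suc n) * Σ f n - ε (suc n) (Σ f) j          ≈⟨ lemma j ⟩
    ε (suc n) (step false n f) j                   ∎
    where
    lemma : ∀ j → ι (suc n) * Σ f n - ε (suc n) (Σ f) j ≈ ε (suc n) (step false n f) j
    lemma zero    = solve 3 (λ a x y → a :* x :- a :* y := a :* (x :- y)) refl _ _ _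
    lemma (suc j) = solve 5 (λ a b t x y → a :* t :- (b :* x :+ (a :- b) :* y)
      := b :* (t :- x) :+ (a :- b) :* (t :- y)) refl _ _ _ _ _

  -- The index m stands for words of length suc m.
  run : ℕ → (ℕ → Bool) → ℕ → Series → Series
  run zero    o m f = f
  run (suc k) o m f = step (o k) (suc (k ℕ.+ m)) (run k o m f)

  run-cong : ∀ k o m {f g} → f ≈ˢ g → run k o m f ≈ˢ run k o m g
  run-cong zero    o m p = p
  run-cong (suc k) o m p = step-cong (o k) _ (run-cong k o m p)

  run-+ˢ : ∀ k o m f g → run k o m (f +ˢ g) ≈ˢ run k o m f +ˢ run k o m g
  run-+ˢ zero    o m f g = S.refl
  run-+ˢ (suc k) o m f g = S.trans {run (suc k) o m (f +ˢ g)} (step-cong (o k) _ (run-+ˢ k o m f g)) (step-+ˢ (o k) _ _ _)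

  run-· : ∀ k o m a f → run k o m (a · f) ≈ˢ a · run k o m f
  run-· zero    o m a f = S.refl
  run-· (suc k) o m a f = S.trans {run (suc k) o m (a · f)} (step-cong (o k) _ (run-· k o m a f)) (step-· (o k) _ _ _)

  run-ε : ∀ k o m f → run k o (suc m) (ε (suc m) f) ≈ˢ ε (suc (k ℕ.+ m)) (run k o m f)
  run-ε zero    o m f = S.refl
  run-ε (suc k) o m f j = begin
    step (o k) (suc (k ℕ.+ suc m)) (run k o (suc m) (ε (suc m) f)) j
      ≡⟨ ≡.cong (λ n → step (o k) (suc n) (run k o (suc m) (ε (suc m) f)) j) (ℕ.+-suc k m) ⟩
    step (o k) (suc (suc (k ℕ.+ m))) (run k o (suc m) (ε (suc m) f)) j
      ≈⟨ step-cong (o k) _ (run-ε k o m f) j ⟩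
    step (o k) (suc (suc (k ℕ.+ m))) (ε (suc (k ℕ.+ m)) (run k o m f)) j
      ≈⟨ step-ε (o k) _ _ j ⟩
    ε (suc (suc (k ℕ.+ m))) (run (suc k) o m f) j ∎

  -- The start `𝟙` treats the m entries in front of the block as an unordered set; `total-factor`
  -- amounts to the statement that the value is the binomial coefficient of k + 1 + m over m, times
  -- `total k o 0`.
  total : ℕ → (ℕ → Bool) → ℕ → Carrier
  total k o m = Σ (run k o m 𝟙) (suc (k ℕ.+ m))

  -- The vector `𝟙` of length m + 1 represents the constant polynomial 1/m!. Hence `ε` only
  -- multiplies it by m + 1, and this scalar passes through all steps of the block.
  total-suc : ∀ k o m → ι (suc m) * total k o (suc m) ≈ ι (suc (suc (k ℕ.+ m))) * total k o m
  total-suc k o m = begin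
    ι (suc m) * Σ (run k o (suc m) 𝟙) (suc (k ℕ.+ suc m))
      ≡⟨ ≡.cong (λ n → ι (suc m) * Σ (run k o (suc m) 𝟙) (suc n)) (ℕ.+-suc k m) ⟩
    ι (suc m) * Σ (run k o (suc m) 𝟙) M
      ≈⟨ Σ-· (ι (suc m)) _ M ⟨
    Σ (ι (suc m) · run k o (suc m) 𝟙) M
      ≈⟨ Σ-cong (run-· k o (suc m) _ 𝟙) M ⟨
    Σ (run k o (suc m) (ι (suc m) · 𝟙)) M
      ≈⟨ Σ-cong (run-cong k o (suc m) ε𝟙) M ⟨
    Σ (run k o (suc m) (ε (suc m) 𝟙)) M
      ≈⟨ Σ-cong (run-ε k o m 𝟙) M ⟩
    Σ (ε (suc (k ℕ.+ m)) (run k o m 𝟙)) M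
      ≈⟨ Σ-ε-total (suc (k ℕ.+ m)) (run k o m 𝟙) ⟩
    ι M * total k o m ∎
    where
    M = suc (suc (k ℕ.+ m))
    ε𝟙 : ε (suc m) 𝟙 ≈ˢ ι (suc m) · 𝟙
    ε𝟙 j = begin
      ε (suc m) 𝟙 j              ≈⟨ ε-cong (suc m) (λ _ → *-identityˡ 1#) j ⟨
      ε (suc m) (1# · 𝟙) j       ≈⟨ ε-𝟙 (suc m) 1# j ⟩
      ι (suc m) * 1# * 1#        ≈⟨ *-identityʳ _ ⟩
      ι (suc m) * 1#             ∎

  -- The multiplication rule of exponential generating functions: by total-suc, the
  -- binomial coefficient arises from inserting m irrelevant entries.
  total-factor : ∀ k o m → φ (suc (k ℕ.+ m)) * total k o m ≈ φ m * (φ (suc (k ℕ.+ 0)) * total k o 0)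
  total-factor k o zero = sym (trans (*-congʳ φ-zero) (*-identityˡ _))
  total-factor k o (suc m) = ι-cancel m (begin
    ι (suc m) * (φ (suc (k ℕ.+ suc m)) * total k o (suc m))
      ≡⟨ ≡.cong (λ n → ι (suc m) * (φ (suc n) * total k o (suc m))) (ℕ.+-suc k m) ⟩
    ι (suc m) * (φ (suc n) * total k o (suc m))
      ≈⟨ solve 3 (λ x y z → x :* (y :* z) := y :* (x :* z)) refl _ _ _ ⟩
    φ (suc n) * (ι (suc m) * total k o (suc m))
      ≈⟨ *-congˡ (total-suc k o m) ⟩
    φ (suc n) * (ι (suc n) * total k o m)
      ≈⟨ *-assoc _ _ _ ⟨
    φ (suc n) * ι (suc n) * total k o m
      ≈⟨ *-congʳ (φ-suc n) ⟩
    φ n * total k o m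
      ≈⟨ total-factor k o m ⟩
    φ m * G
      ≈⟨ *-congʳ (φ-suc m) ⟨
    φ (suc m) * ι (suc m) * G
      ≈⟨ solve 3 (λ x y z → x :* y :* z := y :* (x :* z)) refl _ _ _ ⟩
    ι (suc m) * (φ (suc m) * G) ∎)
    where
    n = suc (k ℕ.+ m)
    G = φ (suc (k ℕ.+ 0)) * total k o 0

  -- h m : words of length suc m with a distinguished last block of length 1;
  -- W m k : words of length suc m with a last block of length suc k, in which
  -- the entry at position suc i (counted from 1) is followed by a q i step.
  module Blocks (q : ℕ → Bool) (h : ℕ → Series) where

    W : ℕ → ℕ → Series
    W m       zero    = h m
    W zero    (suc k) = 0ˢ
    W (suc m) (suc k) = step (q m) (suc m) (W m k)

    w : ℕ → ℕ → Carrier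
    w m k = φ (suc m) * Σ (W m k) (suc m)

    shift : ℕ → ℕ → Bool
    shift n i = q (i ℕ.+ n)

    W-run : ∀ k n i → W (k ℕ.+ n) (k ℕ.+ i) ≈ˢ run k (shift n) n (W n i)
    W-run zero    n i = S.refl
    W-run (suc k) n i = step-cong (q (k ℕ.+ n)) _ (W-run k n i)

    Σ-0ˢ : Σ 0ˢ ≈ˢ 0ˢ
    Σ-0ˢ zero    = refl
    Σ-0ˢ (suc j) = trans (+-identityʳ _) (Σ-0ˢ j)

    step-0ˢ : ∀ o n → step o n 0ˢ ≈ˢ 0ˢ
    step-0ˢ true  n j = Σ-0ˢ j
    step-0ˢ false n j = trans (+-cong (Σ-0ˢ n) (-‿cong (Σ-0ˢ j))) (-‿inverseʳ 0#)

    W-vanishes : ∀ m i → W m (suc (m ℕ.+ i)) ≈ˢ 0ˢ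
    W-vanishes zero    i = S.refl
    W-vanishes (suc m) i = S.trans {W (suc m) (suc (suc m ℕ.+ i))}
      (step-cong (q m) (suc m) (W-vanishes m i)) (step-0ˢ (q m) (suc m))

    w-vanishes : ∀ m i → w m (suc (m ℕ.+ i)) ≈ 0#
    w-vanishes m i = trans (*-congˡ (trans (Σ-cong (W-vanishes m i) (suc m)) (Σ-0ˢ (suc m)))) (zeroʳ _)

    -- `juxtapose` sorts all extensions of an admissible word of length n by one entry: the new
    -- entry is a last block of its own or, with weights α and β, completes a block of length 2 or
    -- 3. By `block`, the blocks of length k + 1, counted and divided by (k + 1)!, give `g k`
    -- wherever they start.
    module Telescope (α β : Carrier) (t g : ℕ → Carrier)
      (juxtapose : ∀ n → t n · 𝟙 ≈ˢ W n 0 +ˢ α · W n 1 +ˢ β · W n 2)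
      (block : ∀ n k → φ (suc (k ℕ.+ 0)) * total k (shift n) 0 ≈ g k)
      where

      A : Series
      A n = φ n * t n

      -- Continue the block of the new entry in `juxtapose` by k more entries. On the left the joint
      -- carries no condition, so `total-factor` makes the count a product; on the right every last
      -- block grows by k.
      A*g : ∀ n k → A n * g k ≈ w (k ℕ.+ n) k + α * w (k ℕ.+ n) (suc k) + β * w (k ℕ.+ n) (suc (suc k))
      A*g n k = begin
        φ n * t n * g k
          ≈⟨ *-congˡ (block n k) ⟨
        φ n * t n * (φ (suc (k ℕ.+ 0)) * total k o 0)
          ≈⟨ solve 3 (λ x y z → x :* y :* z := y :* (x :* z)) refl _ _ _ ⟩
        t n * (φ n * (φ (suc (k ℕ.+ 0)) * total k o 0))
          ≈⟨ *-congˡ (total-factor k o n) ⟨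
        t n * (φ M * total k o n)
          ≈⟨ solve 3 (λ x y z → x :* (y :* z) := y :* (x :* z)) refl _ _ _ ⟩
        φ M * (t n * Σ (run k o n 𝟙) M)
          ≈⟨ *-congˡ (Σ-· (t n) _ M) ⟨
        φ M * Σ (t n · run k o n 𝟙) M
          ≈⟨ *-congˡ (Σ-cong (run-· k o n (t n) 𝟙) M) ⟨
        φ M * Σ (run k o n (t n · 𝟙)) M
          ≈⟨ *-congˡ (Σ-cong (run-cong k o n (juxtapose n)) M) ⟩
        φ M * Σ (run k o n (W n 0 +ˢ α · W n 1 +ˢ β · W n 2)) M
          ≈⟨ *-congˡ (Σ-cong expand M) ⟩
        φ M * Σ (W′ 0 +ˢ α · W′ 1 +ˢ β · W′ 2) M
          ≈⟨ *-congˡ (Σ-+ˢ _ _ M) ⟩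
        φ M * (Σ (W′ 0 +ˢ α · W′ 1) M + Σ (β · W′ 2) M)
          ≈⟨ *-congˡ (+-cong (Σ-+ˢ _ _ M) (Σ-· β _ M)) ⟩
        φ M * (Σ (W′ 0) M + Σ (α · W′ 1) M + β * Σ (W′ 2) M)
          ≈⟨ *-congˡ (+-congʳ (+-congˡ (Σ-· α _ M))) ⟩
        φ M * (Σ (W′ 0) M + α * Σ (W′ 1) M + β * Σ (W′ 2) M)
          ≈⟨ solve 6 (λ p a b x y z → p :* (x :+ a :* y :+ b :* z)
               := p :* x :+ a :* (p :* y) :+ b :* (p :* z)) refl _ _ _ _ _ _ ⟩
        w′ (k ℕ.+ 0) + α * w′ (k ℕ.+ 1) + β * w′ (k ℕ.+ 2)
          ≡⟨ ≡.cong₂ _+_ (≡.cong₂ (λ x y → w′ x + α * w′ y) (ℕ.+-comm k 0) (ℕ.+-comm k 1))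
               (≡.cong (λ x → β * w′ x) (ℕ.+-comm k 2)) ⟩
        w′ k + α * w′ (suc k) + β * w′ (suc (suc k)) ∎
        where
        o = shift n
        M = suc (k ℕ.+ n)
        W′ = λ i → W (k ℕ.+ n) (k ℕ.+ i)
        w′ = w (k ℕ.+ n)
        expand : run k o n (W n 0 +ˢ α · W n 1 +ˢ β · W n 2) ≈ˢ W′ 0 +ˢ α · W′ 1 +ˢ β · W′ 2
        expand j = begin
          run k o n (W n 0 +ˢ α · W n 1 +ˢ β · W n 2) j
            ≈⟨ run-+ˢ k o n _ _ j ⟩
          run k o n (W n 0 +ˢ α · W n 1) j + run k o n (β · W n 2) j
            ≈⟨ +-cong (run-+ˢ k o n _ _ j) (run-· k o n β _ j) ⟩
          run k o n (W n 0) j + run k o n (α · W n 1) j + β * run k o n (W n 2) j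
            ≈⟨ +-congʳ (+-congˡ (run-· k o n α _ j)) ⟩
          run k o n (W n 0) j + α * run k o n (W n 1) j + β * run k o n (W n 2) j
            ≈⟨ +-cong (+-cong (W-run k n 0 j) (*-congˡ (W-run k n 1 j))) (*-congˡ (W-run k n 2 j)) ⟨
          W′ 0 j + α * W′ 1 j + β * W′ 2 j ∎

      module _ (χ : ℕ → Carrier) (χ-rec : ∀ k → χ (suc (suc k)) + α * χ (suc k) + β * χ k ≈ 0#) where

        -- The equations `A*g` for words of length s + N + 1 are weighted by `χ` and added. Each
        -- block length collects three consecutive values of `χ`, which cancel by the recurrence,
        -- except for the two shortest lengths. At the other end the blocks would be longer than the
        -- word. The start s is variable so that the induction can remove the first equation.
        telescope : ∀ s N → ((λ k → χ (k ℕ.+ s) * g (k ℕ.+ s)) *ˢ A) N ≈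
          χ s * w (s ℕ.+ N) s + (χ (suc s) + α * χ s) * w (s ℕ.+ N) (suc s)
        telescope s zero = begin
          χ s * g s * A 0 + 0#
            ≈⟨ solve 3 (λ x y z → x :* y :* z :+ con (+ 0) := x :* (z :* y)) refl _ _ _ ⟩
          χ s * (A 0 * g s)
            ≈⟨ *-congˡ (A*g 0 s) ⟩
          χ s * (w (s ℕ.+ 0) s + α * w (s ℕ.+ 0) (suc s) + β * w (s ℕ.+ 0) (suc (suc s)))
            ≈⟨ *-congˡ (+-cong (+-congˡ (*-congˡ v₁)) (*-congˡ v₂)) ⟩
          χ s * (w (s ℕ.+ 0) s + α * 0# + β * 0#)
            ≈⟨ solve 5 (λ x y a b d → x :* (y :+ a :* con (+ 0) :+ b :* con (+ 0))
                 := x :* y :+ (d :+ a :* x) :* con (+ 0)) refl _ _ _ _ _ ⟩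
          χ s * w (s ℕ.+ 0) s + (χ (suc s) + α * χ s) * 0#
            ≈⟨ +-congˡ (*-congˡ v₁) ⟨
          χ s * w (s ℕ.+ 0) s + (χ (suc s) + α * χ s) * w (s ℕ.+ 0) (suc s) ∎
          where
          v₁ : w (s ℕ.+ 0) (suc s) ≈ 0#
          v₁ = ≡.subst (λ m → w m (suc s) ≈ 0#) (≡.sym (ℕ.+-identityʳ s))
            (≡.subst (λ m → w s (suc m) ≈ 0#) (ℕ.+-identityʳ s) (w-vanishes s 0))
          v₂ : w (s ℕ.+ 0) (suc (suc s)) ≈ 0#
          v₂ = ≡.subst (λ m → w m (suc (suc s)) ≈ 0#) (≡.sym (ℕ.+-identityʳ s))
            (≡.subst (λ m → w s (suc m) ≈ 0#) (ℕ.+-comm s 1) (w-vanishes s 1))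
        telescope s (suc N) = begin
          χ s * g s * A (suc N) + ((λ k → χ (suc k ℕ.+ s) * g (suc k ℕ.+ s)) *ˢ A) N
            ≈⟨ +-cong (solve 3 (λ x y z → x :* y :* z := x :* (z :* y)) refl _ _ _)
                 (*ˢ-cong {g = A} (λ k → reflexive (≡.cong (λ i → χ i * g i) (≡.sym (ℕ.+-suc k s)))) S.refl N) ⟩
          χ s * (A (suc N) * g s) + ((λ k → χ (k ℕ.+ suc s) * g (k ℕ.+ suc s)) *ˢ A) N
            ≈⟨ +-cong (*-congˡ (A*g (suc N) s)) (telescope (suc s) N) ⟩
          χ s * (w (s ℕ.+ suc N) s + α * w (s ℕ.+ suc N) (suc s) + β * w (s ℕ.+ suc N) (suc (suc s)))
            + (χ (suc s) * w (suc s ℕ.+ N) (suc s) + (χ (suc (suc s)) + α * χ (suc s)) * w (suc s ℕ.+ N) (suc (suc s)))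
            ≡⟨ ≡.cong (λ m → χ s * (w (s ℕ.+ suc N) s + α * w (s ℕ.+ suc N) (suc s) + β * w (s ℕ.+ suc N) (suc (suc s)))
                 + (χ (suc s) * w m (suc s) + (χ (suc (suc s)) + α * χ (suc s)) * w m (suc (suc s)))) (≡.sym (ℕ.+-suc s N)) ⟩
          χ s * (w M s + α * w M (suc s) + β * w M (suc (suc s)))
            + (χ (suc s) * w M (suc s) + (χ (suc (suc s)) + α * χ (suc s)) * w M (suc (suc s)))
            ≈⟨ solve 8 (λ a b x y z u v w → x :* (u :+ a :* v :+ b :* w) :+ (y :* v :+ (z :+ a :* y) :* w)
                 := x :* u :+ (y :+ a :* x) :* v :+ (z :+ a :* y :+ b :* x) :* w) refl α β (χ s) (χ (suc s)) (χ (suc (suc s))) _ _ _ ⟩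
          χ s * w M s + (χ (suc s) + α * χ s) * w M (suc s)
            + (χ (suc (suc s)) + α * χ (suc s) + β * χ s) * w M (suc (suc s))
            ≈⟨ +-congˡ (*-congʳ (χ-rec s)) ⟩
          χ s * w M s + (χ (suc s) + α * χ s) * w M (suc s) + 0# * w M (suc (suc s))
            ≈⟨ solve 2 (λ x y → x :+ con (+ 0) :* y := x) refl _ _ ⟩
          χ s * w M s + (χ (suc s) + α * χ s) * w M (suc s) ∎
          where M = s ℕ.+ suc N

        -- The shift by one arises because `g k` belongs to blocks of length k + 1, hence to the
        -- coefficient k + 1 of `B`.
        A*-telescope : ∀ B → B 0 ≈ 0# → (∀ k → B (suc k) ≈ χ k * g k) → ∀ N →
          (A *ˢ B) (suc N) ≈ χ 0 * w N 0 + (χ 1 + α * χ 0) * w N 1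
        A*-telescope B B₀ Bₛ N = begin
          (A *ˢ B) (suc N)
            ≈⟨ *ˢ-comm A B (suc N) ⟩
          B 0 * A (suc N) + (tail B *ˢ A) N
            ≈⟨ +-cong (trans (*-congʳ B₀) (zeroˡ _)) (*ˢ-cong {g = A} B≈ S.refl N) ⟩
          0# + ((λ k → χ (k ℕ.+ 0) * g (k ℕ.+ 0)) *ˢ A) N
            ≈⟨ +-identityˡ _ ⟩
          ((λ k → χ (k ℕ.+ 0) * g (k ℕ.+ 0)) *ˢ A) N
            ≈⟨ telescope 0 N ⟩
          χ 0 * w N 0 + (χ 1 + α * χ 0) * w N 1 ∎
          where
          B≈ : ∀ k → tail B k ≈ χ (k ℕ.+ 0) * g (k ℕ.+ 0)
          B≈ k = trans (Bₛ k) (reflexive (≡.cong (λ i → χ i * g i) (≡.sym (ℕ.+-identityʳ k))))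

-- Alternating words, and words with short runs

module AlternatingRuns {c ℓ} (R : CommutativeRing c ℓ)
  (I : PowerSeries.ReciprocalFactorials R) where

  import Data.Nat.Properties as ℕ
  open import Data.Bool.Base using (Bool; true; false; not)
  open import Data.Bool.Properties using (not-involutive)
  open import Data.Fin.Patterns using (0F; 1F; 2F)
  open import Data.Sum.Base using (_⊎_; inj₁; inj₂)
  open import Data.Integer.Base using (+_)
  open import Relation.Binary.PropositionalEquality as ≡ using (_≡_)
  open IntegerCoefficients R
  open CommutativeRing R
  open PowerSeries R using (ReciprocalFactorials; module ReciprocalFactorials; Series; _≈ˢ_; _+ˢ_; _*ˢ_; -ˢ_; _·_; 0ˢ; 1ˢ; tail; ι; *ˢ-cong; seriesRing; P; P-cong; P-weight)
  open ReciprocalFactorials I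
  open Juxtaposition R I
  open import Relation.Binary.Reasoning.Setoid setoid

  private
    module S = CommutativeRing seriesRing
    module Sₛ = IntegerCoefficients seriesRing

  *ˢ-cancelʳ : ∀ {f g h} h⁻¹ → h⁻¹ *ˢ h ≈ˢ 1ˢ → f *ˢ h ≈ˢ g *ˢ h → f ≈ˢ g
  *ˢ-cancelʳ {f} {g} {h} h⁻¹ inv p =
    S.trans {f} (S.sym {f *ˢ h *ˢ h⁻¹} (lemma f)) (S.trans {f *ˢ h *ˢ h⁻¹} (*ˢ-cong p (S.refl {h⁻¹})) (lemma g))
    where
    lemma : ∀ f → f *ˢ h *ˢ h⁻¹ ≈ˢ f
    lemma f = S.trans {f *ˢ h *ˢ h⁻¹} (S.*-assoc f h h⁻¹)
      (S.trans {f *ˢ (h *ˢ h⁻¹)} (S.*-congˡ {f} (S.trans {h *ˢ h⁻¹} (S.*-comm h h⁻¹) inv)) (S.*-identityʳ f))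

  egfˢ : (ℕ → Carrier) → Series
  egfˢ a n = a n * φ n

  -- With ρ = -1 or ρ = 1 the circular and the hyperbolic functions are treated together.
  geometric : Carrier → Carrier → Carrier → ℕ → Carrier
  geometric ρ a b zero          = a
  geometric ρ a b (suc zero)    = b
  geometric ρ a b (suc (suc n)) = ρ * geometric ρ a b n

  two-step : ∀ ρ (s : ℕ → Carrier) → (∀ n → s (suc (suc n)) ≈ ρ * s n) → ∀ n → s n ≈ geometric ρ (s 0) (s 1) n
  two-step ρ s h zero          = refl
  two-step ρ s h (suc zero)    = refl
  two-step ρ s h (suc (suc n)) = trans (h n) (*-congˡ (two-step ρ s h n))

  egfˢ-circular : ∀ (s : ℕ → Carrier) → (∀ n → s (suc (suc n)) ≈ - s n) → egfˢ s ≈ˢ egfˢ (geometric (- 1#) (s 0) (s 1))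
  egfˢ-circular s h n = *-congʳ (two-step (- 1#) s (λ n → trans (h n) (sym (-1*x≈-x (s n)))) n)
    where open import Algebra.Properties.Ring ring using (-1*x≈-x)

  egfˢ-hyperbolic : ∀ (s : ℕ → Carrier) → (∀ n → s (suc (suc n)) ≈ s n) → egfˢ s ≈ˢ egfˢ (geometric 1# (s 0) (s 1))
  egfˢ-hyperbolic s h n = *-congʳ (two-step 1# s (λ n → trans (h n) (sym (*-identityˡ (s n)))) n)

  sinˢ cosˢ sinhˢ coshˢ : Series
  sinˢ  = egfˢ (geometric (- 1#) 0# 1#)
  cosˢ  = egfˢ (geometric (- 1#) 1# 0#)
  sinhˢ = egfˢ (geometric 1# 0# 1#)
  coshˢ = egfˢ (geometric 1# 1# 0#)

  chain : (ℕ → Bool) → ℕ → Series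
  chain o zero    = 𝟙
  chain o (suc k) = step (o k) (suc k) (chain o k)

  run≡chain : ∀ k o → run k o 0 𝟙 ≡ chain o k
  run≡chain zero    o = ≡.refl
  run≡chain (suc k) o = ≡.cong₂ (λ n f → step (o k) (suc n) f) (ℕ.+-identityʳ k) (run≡chain k o)

  φ-chain : (ℕ → Bool) → ℕ → Carrier
  φ-chain o k = φ (suc k) * Σ (chain o k) (suc k)

  φ-total≡φ-chain : ∀ k o → φ (suc (k ℕ.+ 0)) * total k o 0 ≡ φ-chain o k
  φ-total≡φ-chain k o =
    ≡.cong₂ (λ n f → φ (suc n) * Σ f (suc n)) (ℕ.+-identityʳ k) (run≡chain k o)

  chain-cong : ∀ {o o′} → (∀ i → o i ≡ o′ i) → ∀ k → chain o k ≡ chain o′ k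
  chain-cong p zero    = ≡.refl
  chain-cong p (suc k) = ≡.cong₂ (λ b f → step b (suc k) f) (p k) (chain-cong p k)

  -- The last entry of an increasing word is its maximum, so the vector is concentrated at k.
  increasing-low : ∀ k {j} → j ℕ.≤ k → Σ (chain (λ _ → true) k) j ≈ 0#
  increasing-low k       z≤n           = refl
  increasing-low (suc k) (s≤s {j} j≤k) =
    trans (+-cong (increasing-low (suc k) (ℕ.m≤n⇒m≤1+n j≤k)) (increasing-low k j≤k)) (+-identityʳ _)

  -- The last entry of a decreasing word is its minimum, so the vector is concentrated at 0 and
  -- every nonempty partial sum is already 1.
  decreasing-partial : ∀ k {j} → j ℕ.≤ k → Σ (chain (λ _ → false) k) (suc j) ≈ 1#
  decreasing-partial zero    z≤n = +-identityˡ _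
  decreasing-partial (suc k) z≤n = trans (+-congˡ (+-congʳ (decreasing-partial k ℕ.≤-refl)))
    (solve 0 (con (+ 0) :+ (con (+ 1) :- con (+ 0)) := con (+ 1)) refl)
  decreasing-partial (suc k) (s≤s {j} j≤k) = trans
    (+-cong (decreasing-partial (suc k) (ℕ.m≤n⇒m≤1+n j≤k))
      (+-cong (decreasing-partial k ℕ.≤-refl) (-‿cong (decreasing-partial k j≤k))))
    (solve 0 (con (+ 1) :+ (con (+ 1) :- con (+ 1)) := con (+ 1)) refl)

  monotone-total : ∀ σ k → Σ (chain (λ _ → σ) k) (suc k) ≈ 1#
  monotone-total true  zero    = +-identityˡ _
  monotone-total true  (suc k) =
    trans (+-cong (increasing-low (suc k) ℕ.≤-refl) (monotone-total true k)) (+-identityˡ _)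
  monotone-total false k       = decreasing-partial k ℕ.≤-refl

  module Alternating (σ : Bool) where

    even : ℕ → Carrier
    even zero          = 1#
    even (suc zero)    = 0#
    even (suc (suc n)) = even n

    even+even : ∀ n → even (suc n) + even n ≈ 1#
    even+even zero    = +-identityˡ _
    even+even (suc n) = trans (+-comm _ _) (even+even n)

    even⇒alt : ∀ n → even n ≡ 0# ⊎ alt σ n ≡ σ
    even⇒alt zero          = inj₂ ≡.refl
    even⇒alt (suc zero)    = inj₁ ≡.refl
    even⇒alt (suc (suc n)) with even⇒alt n
    ... | inj₁ p = inj₁ p
    ... | inj₂ p = inj₂ (≡.trans (not-involutive _) p)

    -- Where `even n` vanishes both sides are zero; elsewhere n is even and the step at n of the
    -- alternating pattern is σ.
    even-cong : ∀ n {x y : Bool → Carrier} →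
      (alt σ n ≡ σ → x σ ≈ y σ) → even n * x σ ≈ even n * y σ
    even-cong n p with even⇒alt n
    ... | inj₁ q = trans (*-congʳ (reflexive q)) (trans (zeroˡ _) (sym (trans (*-congʳ (reflexive q)) (zeroˡ _))))
    ... | inj₂ q = *-congˡ (p q)

    f : ℕ → Series
    f = chain (alt σ)

    -- An odd alternating word followed by a monotone block: in a σ-monotone
    -- block of length ≥ 3 the first two entries may also be regarded as part
    -- of the alternating prefix.
    open Blocks (λ _ → σ) (λ m → even m · f m)

    t : ℕ → Carrier
    t zero    = 1#
    t (suc m) = even (suc m) * Σ (f m) (suc m)

    -- An even alternating word ends with a σ step. The next entry either continues the alternation,
    -- which gives an odd alternating word, or repeats σ; then the last three entries form a
    -- monotone block on an odd prefix. Blocks of length 2 do not arise, hence α = 0 and β = 1.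
    juxtapose : ∀ n → t n · 𝟙 ≈ˢ W n 0 +ˢ 0# · W n 1 +ˢ 1# · W n 2
    juxtapose zero j = solve 0 (con (+ 1) :* con (+ 1) :=
      con (+ 1) :* con (+ 1) :+ con (+ 0) :* con (+ 0) :+ con (+ 1) :* con (+ 0)) refl
    juxtapose (suc zero) j = begin
      0# * Σ 𝟙 1 * 1#
        ≈⟨ solve 3 (λ x y z → con (+ 0) :* x :* con (+ 1)
             := con (+ 0) :* z :+ con (+ 0) :* y :+ con (+ 1) :* con (+ 0)) refl _ _ _ ⟩
      0# * f 1 j + 0# * W 1 1 j + 1# * 0#
        ≈⟨ +-congˡ (*-congˡ (step-0ˢ σ 1 j)) ⟨
      0# * f 1 j + 0# * W 1 1 j + 1# * step σ 1 0ˢ j ∎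
    juxtapose (suc (suc m)) j = begin
      even m * Σ (f (suc m)) M * 1#
        ≈⟨ *-assoc _ _ _ ⟩
      even m * (Σ (f (suc m)) M * 1#)
        ≈⟨ even-cong m {λ τ → Σ (f (suc m)) M * 1#} {λ τ → f M j + step τ M (step τ (suc m) (f m)) j} glue ⟩
      even m * (f M j + step σ M (step σ (suc m) (f m)) j)
        ≈⟨ distribˡ _ _ _ ⟩
      even m * f M j + even m * step σ M (step σ (suc m) (f m)) j
        ≈⟨ +-congˡ (step-· σ M (even m) _ j) ⟨
      even m * f M j + step σ M (even m · step σ (suc m) (f m)) j
        ≈⟨ +-congˡ (step-cong σ M (step-· σ (suc m) (even m) (f m)) j) ⟨
      even m * f M j + W M 2 j
        ≈⟨ solve 3 (λ x y z → x :+ z := x :+ con (+ 0) :* y :+ con (+ 1) :* z) refl _ _ _ ⟩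
      even m * f M j + 0# * W M 1 j + 1# * W M 2 j ∎
      where
      M = suc (suc m)
      glue : alt σ m ≡ σ → Σ (f (suc m)) M * 1# ≈ f M j + step σ M (step σ (suc m) (f m)) j
      glue p = begin
        Σ (f (suc m)) M * 1#
          ≈⟨ step-+-step σ M (f (suc m)) j ⟨
        step σ M (f (suc m)) j + step (not σ) M (f (suc m)) j
          ≈⟨ +-comm _ _ ⟩
        step (not σ) M (f (suc m)) j + step σ M (f (suc m)) j
          ≡⟨ ≡.cong₂ _+_ (≡.cong (λ τ → step (not τ) M (f (suc m)) j) (≡.sym p))
               (≡.cong (λ τ → step σ M (step τ (suc m) (f m)) j) p) ⟩
        f M j + step σ M (step σ (suc m) (f m)) j ∎

    block : ∀ n k → φ (suc (k ℕ.+ 0)) * total k (shift n) 0 ≈ φ (suc k)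
    block n k = trans (reflexive (φ-total≡φ-chain k (λ _ → σ)))
      (trans (*-congˡ (monotone-total σ k)) (*-identityʳ _))

    open Telescope 0# 1# t (λ k → φ (suc k)) juxtapose block public using (A; A*-telescope)

    y : Series
    y zero    = 1#
    y (suc k) = φ-chain (alt σ) k

    w₀ : ∀ n → w n 0 ≈ even n * y (suc n)
    w₀ n = trans (*-congˡ (Σ-· (even n) (f n) (suc n)))
      (solve 3 (λ x y z → x :* (y :* z) := y :* (x :* z)) refl _ _ _)

    -- After an odd alternating word the σ step is the alternating one, so a last block of length 2
    -- merely completes an alternating word of even length.
    w₁ : ∀ n → w n 1 ≈ even (suc n) * y (suc n)
    w₁ zero = trans (*-congˡ (Σ-0ˢ 1)) (trans (zeroʳ _) (sym (zeroˡ _)))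
    w₁ (suc n) = begin
      φ N * Σ (step σ (suc n) (even n · f n)) N
        ≈⟨ *-congˡ (Σ-cong (step-· σ (suc n) (even n) (f n)) N) ⟩
      φ N * Σ (even n · step σ (suc n) (f n)) N
        ≈⟨ *-congˡ (Σ-· (even n) _ N) ⟩
      φ N * (even n * Σ (step σ (suc n) (f n)) N)
        ≈⟨ *-congˡ (even-cong n {λ τ → Σ (step τ (suc n) (f n)) N} {λ _ → Σ (f (suc n)) N}
             (λ p → reflexive (≡.cong (λ τ → Σ (step τ (suc n) (f n)) N) (≡.sym p)))) ⟩
      φ N * (even n * Σ (f (suc n)) N)
        ≈⟨ solve 3 (λ x y z → x :* (y :* z) := y :* (x :* z)) refl _ _ _ ⟩
      even n * y N ∎
      where N = suc (suc n)

    -- The recurrence is now χ(k+2) = -χ(k). The solution 1, 0, -1, 0, ... turns the coefficients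
    -- 1/(k+1)! into sin and leaves `w n 0`, the odd alternating words.
    A*sin : ∀ n → (A *ˢ sinˢ) (suc n) ≈ even n * y (suc n)
    A*sin n = begin
      (A *ˢ sinˢ) (suc n)
        ≈⟨ A*-telescope (λ k → geometric (- 1#) 0# 1# (suc k))
             (λ k → solve 2 (λ x y → :- con (+ 1) :* x :+ con (+ 0) :* y :+ con (+ 1) :* x := con (+ 0)) refl _ _)
             sinˢ (zeroˡ _) (λ k → refl) n ⟩
      1# * w n 0 + (- 1# * 0# + 0# * 1#) * w n 1
        ≈⟨ solve 2 (λ x y → con (+ 1) :* x :+ (:- con (+ 1) :* con (+ 0) :+ con (+ 0) :* con (+ 1)) :* y := x) refl _ _ ⟩
      w n 0
        ≈⟨ w₀ n ⟩
      even n * y (suc n) ∎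

    -- The solution 0, 1, 0, -1, ... gives 1 - cos and leaves `w n 1`, the even alternating words.
    -- These are counted by `A` itself, so that `A` is the secant.
    A*[1-cos] : ∀ n → (A *ˢ (1ˢ +ˢ -ˢ cosˢ)) (suc n) ≈ A (suc n)
    A*[1-cos] n = begin
      (A *ˢ (1ˢ +ˢ -ˢ cosˢ)) (suc n)
        ≈⟨ A*-telescope (λ k → - geometric (- 1#) 1# 0# (suc k))
             (λ k → solve 2 (λ x y → :- (:- con (+ 1) :* x) :+ con (+ 0) :* y :+ con (+ 1) :* (:- x) := con (+ 0)) refl _ _)
             (1ˢ +ˢ -ˢ cosˢ)
             (trans (+-congˡ (-‿cong (trans (*-identityˡ _) φ-zero))) (-‿inverseʳ 1#))
             (λ k → solve 2 (λ x y → con (+ 0) :- x :* y := :- x :* y) refl _ _) n ⟩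
      - 0# * w n 0 + (- (- 1# * 1#) + 0# * - 0#) * w n 1
        ≈⟨ solve 2 (λ x y → :- con (+ 0) :* x :+ (:- (:- con (+ 1) :* con (+ 1)) :+ con (+ 0) :* (:- con (+ 0))) :* y := y) refl _ _ ⟩
      w n 1
        ≈⟨ w₁ n ⟩
      even (suc n) * (φ (suc n) * Σ (f n) (suc n))
        ≈⟨ solve 3 (λ x y z → x :* (y :* z) := y :* (x :* z)) refl _ _ _ ⟩
      A (suc n) ∎

    A*cos≈1 : A *ˢ cosˢ ≈ˢ 1ˢ
    A*cos≈1 = S.trans {A *ˢ cosˢ}
      (Sₛ.solve 2 (λ a c → a Sₛ.:* c Sₛ.:= a Sₛ.:- a Sₛ.:* (Sₛ.con (+ 1) Sₛ.:- c)) (λ _ → refl) A cosˢ)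
      λ { zero    → trans (+-cong (trans (*-identityʳ _) φ-zero)
                      (-‿cong (trans (+-identityʳ _) (trans (*-congˡ
                        (trans (+-congˡ (-‿cong (trans (*-identityˡ _) φ-zero))) (-‿inverseʳ 1#)))
                        (zeroʳ _)))))
                    (trans (+-congˡ -0#≈0#) (+-identityʳ _))
        ; (suc n) → trans (+-congˡ (-‿cong (A*[1-cos] n))) (-‿inverseʳ _) }
      where open import Algebra.Properties.Ring ring using (-0#≈0#)

    y≈A+A*sin : y ≈ˢ A +ˢ A *ˢ sinˢ
    y≈A+A*sin zero = sym (trans (+-cong (trans (*-identityʳ _) φ-zero)
      (trans (+-identityʳ _) (trans (*-congˡ (zeroˡ _)) (zeroʳ _)))) (+-identityʳ _))
    y≈A+A*sin (suc n) = begin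
      y (suc n)
        ≈⟨ *-identityˡ _ ⟨
      1# * y (suc n)
        ≈⟨ *-congʳ (even+even n) ⟨
      (even (suc n) + even n) * y (suc n)
        ≈⟨ distribʳ _ _ _ ⟩
      even (suc n) * y (suc n) + even n * y (suc n)
        ≈⟨ +-cong (solve 3 (λ x y z → x :* (y :* z) := y :* (x :* z)) refl _ _ _) (sym (A*sin n)) ⟩
      A (suc n) + (A *ˢ sinˢ) (suc n) ∎

    y*cos : y *ˢ cosˢ ≈ˢ 1ˢ +ˢ sinˢ
    y*cos = S.trans {y *ˢ cosˢ} (*ˢ-cong {g = cosˢ} y≈A+A*sin S.refl)
      (S.trans {(A +ˢ A *ˢ sinˢ) *ˢ cosˢ}
        (Sₛ.solve 3 (λ a c s → (a Sₛ.:+ a Sₛ.:* s) Sₛ.:* c Sₛ.:= a Sₛ.:* c Sₛ.:+ a Sₛ.:* c Sₛ.:* s) (λ _ → refl) A cosˢ sinˢ)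
        (S.trans {A *ˢ cosˢ +ˢ A *ˢ cosˢ *ˢ sinˢ}
          (S.+-cong {A *ˢ cosˢ} A*cos≈1 (*ˢ-cong {g = sinˢ} A*cos≈1 S.refl))
          (S.+-congˡ {1ˢ} (S.*-identityˡ sinˢ))))

  module ShortRuns (F : Series) (F*cos : F *ˢ cosˢ ≈ˢ 1ˢ +ˢ sinˢ) where

    -- For either first direction the series satisfies the same linear equation, whose coefficient
    -- `cosˢ` is invertible; so `F` counts both kinds of alternating words.
    F≈y : ∀ σ → Alternating.y σ ≈ˢ F
    F≈y σ = *ˢ-cancelʳ {h = cosˢ} A A*cos≈1
      (S.trans {y *ˢ cosˢ} y*cos (S.sym {F *ˢ cosˢ} F*cos))
      where open Alternating σ using (A; A*cos≈1; y; y*cos)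

    q : ℕ → Bool
    q = alt true

    alt-+ : ∀ n i → q (i ℕ.+ n) ≡ alt (q n) i
    alt-+ n zero    = ≡.refl
    alt-+ n (suc i) = ≡.cong not (alt-+ n i)

    -- At position m + 1 the direction `q m` is the one that is no alternating descent. It lengthens
    -- the last run, while the opposite direction starts a new one. `cv` and `dv` belong to last
    -- runs of length 1 and 2.
    cv dv : ℕ → Series
    cv zero    = 𝟙
    cv (suc m) = step (not (q m)) (suc m) (cv m +ˢ dv m)
    dv zero    = 0ˢ
    dv (suc m) = step (q m) (suc m) (cv m)

    open Blocks q cv

    W₁ : ∀ n → W n 1 ≡ dv n
    W₁ zero    = ≡.refl
    W₁ (suc n) = ≡.refl

    t : ℕ → Carrier
    t zero    = 1#
    t (suc m) = Σ (cv m +ˢ dv m) (suc m)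

    -- A new entry in the direction opposite to `q m` starts a run; one in the direction `q m`
    -- extends a last run of length 1 to 2, or of length 2 to 3. So α = β = 1, and `W (suc m) 2`
    -- collects the words whose last run alone is too long.
    juxtapose : ∀ n → t n · 𝟙 ≈ˢ W n 0 +ˢ 1# · W n 1 +ˢ 1# · W n 2
    juxtapose zero j = solve 0 (con (+ 1) :* con (+ 1) :=
      con (+ 1) :+ con (+ 1) :* con (+ 0) :+ con (+ 1) :* con (+ 0)) refl
    juxtapose (suc m) j = begin
      Σ (cv m +ˢ dv m) (suc m) * 1#
        ≈⟨ step-+-step (q m) (suc m) (cv m +ˢ dv m) j ⟨
      step (q m) (suc m) (cv m +ˢ dv m) j + cv (suc m) j
        ≈⟨ +-congʳ (step-+ˢ (q m) (suc m) (cv m) (dv m) j) ⟩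
      dv (suc m) j + step (q m) (suc m) (dv m) j + cv (suc m) j
        ≡⟨ ≡.cong (λ v → dv (suc m) j + step (q m) (suc m) v j + cv (suc m) j) (W₁ m) ⟨
      dv (suc m) j + W (suc m) 2 j + cv (suc m) j
        ≈⟨ solve 3 (λ x y z → x :+ y :+ z := z :+ con (+ 1) :* x :+ con (+ 1) :* y) refl _ _ _ ⟩
      cv (suc m) j + 1# * dv (suc m) j + 1# * W (suc m) 2 j ∎

    -- Inside a run the directions alternate, starting with `q n`. Both starting directions give the
    -- same count by `F≈y`, so the parity of n has no influence.
    block : ∀ n k → φ (suc (k ℕ.+ 0)) * total k (shift n) 0 ≈ tail F k
    block n k = begin
      φ (suc (k ℕ.+ 0)) * total k (shift n) 0
        ≡⟨ φ-total≡φ-chain k (shift n) ⟩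
      φ-chain (shift n) k
        ≡⟨ ≡.cong (λ v → φ (suc k) * Σ v (suc k)) (chain-cong (alt-+ n) k) ⟩
      φ-chain (alt (q n)) k
        ≈⟨ F≈y (q n) (suc k) ⟩
      F (suc k) ∎

    open Telescope 1# 1# t (tail F) juxtapose block public using (A; A*-telescope)

    C D : Series
    C zero    = 0#
    C (suc m) = φ (suc m) * Σ (cv m) (suc m)
    D zero    = 0#
    D (suc m) = φ (suc m) * Σ (dv m) (suc m)

    A≈1+C+D : A ≈ˢ 1ˢ +ˢ C +ˢ D
    A≈1+C+D zero    = trans (*-identityʳ _) (trans φ-zero (sym (trans (+-identityʳ _) (+-identityʳ _))))
    A≈1+C+D (suc m) = trans (*-congˡ (Σ-+ˢ (cv m) (dv m) (suc m)))
      (solve 3 (λ a x y → a :* (x :+ y) := con (+ 0) :+ a :* x :+ a :* y) refl _ _ _)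

    -- `P r 𝟙` is the periodic 0-1 sequence of residue r; in this form a trisection fits the
    -- products `χ k * g k` of the telescope.
    P-as-weight : ∀ r f n → P r f n ≈ P r 𝟙 n * f n
    P-as-weight r f n = trans (P-cong r (λ i → sym (*-identityʳ (f i))) n)
      (trans (P-weight r f 𝟙 n) (*-comm _ _))

    F₀≈1 : F 0 ≈ 1#
    F₀≈1 = sym (F≈y true 0)

    -- For α = β = 1 the solutions `χ` have period 3 and sum zero over a period. The solution 1, -1,
    -- 0, ... satisfies χ(1) + χ(0) = 0, so only last runs of length 1 survive.
    A*[P₁-P₂] : A *ˢ (P 1F F +ˢ -ˢ P 2F F) ≈ˢ C
    A*[P₁-P₂] zero = solve 1 (λ x → x :* (con (+ 0) :- con (+ 0)) :+ con (+ 0) := con (+ 0)) refl _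
    A*[P₁-P₂] (suc n) = begin
      (A *ˢ (P 1F F +ˢ -ˢ P 2F F)) (suc n)
        ≈⟨ A*-telescope (λ k → P 0F 𝟙 k - P 1F 𝟙 k)
             (λ k → solve 3 (λ x y z → (y :- z) :+ con (+ 1) :* (z :- x) :+ con (+ 1) :* (x :- y) := con (+ 0))
                refl (P 0F 𝟙 k) (P 1F 𝟙 k) (P 2F 𝟙 k))
             (P 1F F +ˢ -ˢ P 2F F) (-‿inverseʳ 0#)
             (λ k → trans (+-cong (P-as-weight 0F (tail F) k) (-‿cong (P-as-weight 1F (tail F) k)))
                (solve 3 (λ x y f → x :* f :- y :* f := (x :- y) :* f) refl _ _ _)) n ⟩
      (1# - 0#) * w n 0 + ((0# - 1#) + 1# * (1# - 0#)) * w n 1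
        ≈⟨ solve 2 (λ x y → (con (+ 1) :- con (+ 0)) :* x
             :+ ((con (+ 0) :- con (+ 1)) :+ con (+ 1) :* (con (+ 1) :- con (+ 0))) :* y := x) refl _ _ ⟩
      C (suc n) ∎

    -- The solution 0, 1, -1, ... has χ(0) = 0, so only last runs of length 2 survive. Subtracting
    -- `1ˢ` from `P 0F F` makes that part start at exponent 3.
    A*[P₂-P₃] : A *ˢ (P 2F F +ˢ -ˢ (P 0F F +ˢ -ˢ 1ˢ)) ≈ˢ D
    A*[P₂-P₃] zero = trans (+-congʳ (*-congˡ (+-congˡ (-‿cong (+-congʳ F₀≈1)))))
      (solve 1 (λ x → x :* (con (+ 0) :- (con (+ 1) :- con (+ 1))) :+ con (+ 0) := con (+ 0)) refl _)
    A*[P₂-P₃] (suc n) = begin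
      (A *ˢ (P 2F F +ˢ -ˢ (P 0F F +ˢ -ˢ 1ˢ))) (suc n)
        ≈⟨ A*-telescope (λ k → P 1F 𝟙 k - P 2F 𝟙 k)
             (λ k → solve 3 (λ x y z → (z :- x) :+ con (+ 1) :* (x :- y) :+ con (+ 1) :* (y :- z) := con (+ 0))
                refl (P 0F 𝟙 k) (P 1F 𝟙 k) (P 2F 𝟙 k))
             (P 2F F +ˢ -ˢ (P 0F F +ˢ -ˢ 1ˢ))
             (trans (+-congˡ (-‿cong (+-congʳ F₀≈1)))
                (solve 0 (con (+ 0) :- (con (+ 1) :- con (+ 1)) := con (+ 0)) refl))
             (λ k → trans (+-cong (P-as-weight 1F (tail F) k)
                  (-‿cong (+-congʳ (P-as-weight 2F (tail F) k))))
                (solve 3 (λ x y f → x :* f :- (y :* f :- con (+ 0)) := (x :- y) :* f) refl _ _ _)) n ⟩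
      (0# - 0#) * w n 0 + ((1# - 0#) + 1# * (0# - 0#)) * w n 1
        ≈⟨ solve 2 (λ x y → (con (+ 0) :- con (+ 0)) :* x
             :+ ((con (+ 1) :- con (+ 0)) :+ con (+ 1) :* (con (+ 0) :- con (+ 0))) :* y := y) refl _ _ ⟩
      φ (suc n) * Σ (W n 1) (suc n)
        ≡⟨ ≡.cong (λ v → φ (suc n) * Σ v (suc n)) (W₁ n) ⟩
      D (suc n) ∎

    A*[P₀-P₁] : A *ˢ (P 0F F +ˢ -ˢ P 1F F) ≈ˢ 1ˢ
    A*[P₀-P₁] = S.trans {A *ˢ (P 0F F +ˢ -ˢ P 1F F)}
      (Sₛ.solve 4 (λ a x y z → a Sₛ.:* (x Sₛ.:- y)
          Sₛ.:= a Sₛ.:- a Sₛ.:* (y Sₛ.:- z) Sₛ.:- a Sₛ.:* (z Sₛ.:- (x Sₛ.:- Sₛ.con (+ 1))))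
        (λ _ → refl) A (P 0F F) (P 1F F) (P 2F F))
      (S.trans {A +ˢ -ˢ (A *ˢ (P 1F F +ˢ -ˢ P 2F F)) +ˢ -ˢ (A *ˢ (P 2F F +ˢ -ˢ (P 0F F +ˢ -ˢ 1ˢ)))}
        (λ n → +-cong (+-cong (A≈1+C+D n) (-‿cong (A*[P₁-P₂] n))) (-‿cong (A*[P₂-P₃] n)))
        (Sₛ.solve 2 (λ c d → Sₛ.con (+ 1) Sₛ.:+ c Sₛ.:+ d Sₛ.:- c Sₛ.:- d Sₛ.:= Sₛ.con (+ 1)) (λ _ → refl) C D))

-- The differential equation of sec + tan and the Riccati system of its trisection

module RiccatiSystem {κ ℓ} (R : CommutativeRing κ ℓ)
  (I : PowerSeries.ReciprocalFactorials R) where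

  import Data.Nat.Properties as ℕ
  open import Data.Fin.Patterns using (0F; 1F; 2F)
  open import Data.Bool.Base using (true)
  open import Data.Product.Base using (_×_; _,_; proj₁; proj₂)
  open import Data.Integer.Base using (+_)
  open import Relation.Binary.PropositionalEquality as ≡ using (_≡_)
  open CommutativeRing R
  open PowerSeries R
  open ReciprocalFactorials I
  open Juxtaposition R I
  open AlternatingRuns R I
  open import Algebra.Definitions.RawSemiring (Semiring.rawSemiring semiring) using (_^_)

  private
    module S = CommutativeRing seriesRing
    module Rₛ = IntegerCoefficients R
  open IntegerCoefficients seriesRing
  open import Relation.Binary.Reasoning.Setoid S.setoid

  const : Carrier → Series
  const a = a · 1ˢ

  ·-const : ∀ a f → a · f ≈ˢ const a *ˢ f
  ·-const a f n = sym (trans (·-*ˢ-assoc a 1ˢ f n) (*-congˡ (*ˢ-identityˡ f n)))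

  const-* : ∀ a b → const a *ˢ const b ≈ˢ const (a * b)
  const-* a b n = trans (sym (·-const a (const b) n)) (sym (*-assoc a b _))

  ∂-const-* : ∀ a f → ∂ (const a *ˢ f) ≈ˢ const a *ˢ ∂ f
  ∂-const-* a f = begin
    ∂ (const a *ˢ f)  ≈⟨ ∂-cong (S.sym {a · f} (·-const a f)) ⟩
    ∂ (a · f)         ≈⟨ ∂-·ˢ a f ⟩
    a · ∂ f           ≈⟨ ·-const a (∂ f) ⟩
    const a *ˢ ∂ f    ∎

  ∂-neg : ∀ f → ∂ (-ˢ f) ≈ˢ -ˢ ∂ f
  ∂-neg f n = Rₛ.solve 2 (λ a x → a Rₛ.:* (Rₛ.:- x) Rₛ.:= Rₛ.:- (a Rₛ.:* x)) refl (ι (suc n)) _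

  ∂-1ˢ : ∂ 1ˢ ≈ˢ 0ˢ
  ∂-1ˢ n = zeroʳ _

  ∂≈0⇒constant : ∀ {f a} → ∂ f ≈ˢ 0ˢ → f 0 ≈ a → f ≈ˢ const a
  ∂≈0⇒constant p q zero    = trans q (sym (*-identityʳ _))
  ∂≈0⇒constant p q (suc n) = trans (ι-cancel n (trans (p n) (sym (zeroʳ _)))) (sym (zeroʳ _))

  -- The derivative of c² - ρs² vanishes. The values ρ = -1 and ρ = 1 give cos² + sin² = 1 and cosh²
  -- - sinh² = 1.
  pythagoras : ∀ ρ a (s c : Series) →
    ∂ s +ˢ ∂ s ≈ˢ const a *ˢ c → ∂ c +ˢ ∂ c ≈ˢ const ρ *ˢ (const a *ˢ s) →
    s 0 ≈ 0# → c 0 ≈ 1# → c *ˢ c +ˢ -ˢ (const ρ *ˢ (s *ˢ s)) ≈ˢ 1ˢ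
  pythagoras ρ a s c ∂s ∂c s₀ c₀ = S.trans {f} (∂≈0⇒constant ∂f f₀) (λ n → *-identityˡ _)
    where
    f = c *ˢ c +ˢ -ˢ (const ρ *ˢ (s *ˢ s))
    f₀ : f 0 ≈ 1#
    f₀ = trans (+-cong (+-congʳ (*-cong c₀ c₀)) (-‿cong (+-congʳ (*-congˡ (+-congʳ (*-cong s₀ s₀))))))
      (Rₛ.solve 1 (λ x → (Rₛ.con (+ 1) Rₛ.:* Rₛ.con (+ 1) Rₛ.:+ Rₛ.con (+ 0))
        Rₛ.:- (x Rₛ.:* (Rₛ.con (+ 0) Rₛ.:* Rₛ.con (+ 0) Rₛ.:+ Rₛ.con (+ 0)) Rₛ.:+ Rₛ.con (+ 0))
        Rₛ.:= Rₛ.con (+ 1)) refl _)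
    ∂f : ∂ f ≈ˢ 0ˢ
    ∂f = begin
      ∂ f
        ≈⟨ ∂-+ˢ (c *ˢ c) (-ˢ (const ρ *ˢ (s *ˢ s))) ⟩
      ∂ (c *ˢ c) +ˢ ∂ (-ˢ (const ρ *ˢ (s *ˢ s)))
        ≈⟨ S.+-cong {∂ (c *ˢ c)} (∂-*ˢ c c) (S.trans {∂ (-ˢ (const ρ *ˢ (s *ˢ s)))} (∂-neg (const ρ *ˢ (s *ˢ s)))
             (S.-‿cong (S.trans {∂ (const ρ *ˢ (s *ˢ s))} (∂-const-* ρ (s *ˢ s)) (S.*-congˡ {const ρ} (∂-*ˢ s s))))) ⟩
      (∂ c *ˢ c +ˢ c *ˢ ∂ c) +ˢ -ˢ (const ρ *ˢ (∂ s *ˢ s +ˢ s *ˢ ∂ s))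
        ≈⟨ solve 5 (λ r s c s′ c′ → (c′ :* c :+ c :* c′) :- r :* (s′ :* s :+ s :* s′)
             := c :* (c′ :+ c′) :- r :* s :* (s′ :+ s′)) (λ _ → refl) (const ρ) s c (∂ s) (∂ c) ⟩
      c *ˢ (∂ c +ˢ ∂ c) +ˢ -ˢ (const ρ *ˢ s *ˢ (∂ s +ˢ ∂ s))
        ≈⟨ S.+-cong {c *ˢ (∂ c +ˢ ∂ c)} (S.*-congˡ {c} ∂c) (S.-‿cong (S.*-congˡ {const ρ *ˢ s} ∂s)) ⟩
      c *ˢ (const ρ *ˢ (const a *ˢ s)) +ˢ -ˢ (const ρ *ˢ s *ˢ (const a *ˢ c))
        ≈⟨ solve 4 (λ r a s c → c :* (r :* (a :* s)) :- r :* s :* (a :* c) := con (+ 0))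
             (λ _ → refl) (const ρ) (const a) s c ⟩
      0ˢ ∎

  ∂-egfˢ : ∀ a → ∂ (egfˢ a) ≈ˢ egfˢ (tail a)
  ∂-egfˢ a n = trans (Rₛ.solve 3 (λ i a f → i Rₛ.:* (a Rₛ.:* f) Rₛ.:= a Rₛ.:* (f Rₛ.:* i)) refl _ _ _)
    (*-congˡ (φ-suc n))

  geometric-01 : ∀ ρ n → geometric ρ 0# 1# (suc n) ≈ geometric ρ 1# 0# n
  geometric-01 ρ zero          = refl
  geometric-01 ρ (suc zero)    = zeroʳ ρ
  geometric-01 ρ (suc (suc n)) = *-congˡ (geometric-01 ρ n)

  geometric-10 : ∀ ρ n → geometric ρ 1# 0# (suc n) ≈ ρ * geometric ρ 0# 1# n
  geometric-10 ρ zero          = sym (zeroʳ ρ)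
  geometric-10 ρ (suc zero)    = refl
  geometric-10 ρ (suc (suc n)) = *-congˡ (geometric-10 ρ n)

  ∂-01 : ∀ ρ → ∂ (egfˢ (geometric ρ 0# 1#)) ≈ˢ egfˢ (geometric ρ 1# 0#)
  ∂-01 ρ n = trans (∂-egfˢ (geometric ρ 0# 1#) n) (*-congʳ (geometric-01 ρ n))

  ∂-10 : ∀ ρ → ∂ (egfˢ (geometric ρ 1# 0#)) ≈ˢ const ρ *ˢ egfˢ (geometric ρ 0# 1#)
  ∂-10 ρ n = trans (∂-egfˢ (geometric ρ 1# 0#) n)
    (trans (*-congʳ (geometric-10 ρ n)) (trans (*-assoc _ _ _) (·-const ρ (egfˢ (geometric ρ 0# 1#)) n)))

  infix 9 _⟨_x⟩ˢ
  _⟨_x⟩ˢ : Series → Carrier → Series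
  (f ⟨ a x⟩ˢ) n = (a ^ n) * f n

  ⟨x⟩-cong : ∀ {f g} a → f ≈ˢ g → f ⟨ a x⟩ˢ ≈ˢ g ⟨ a x⟩ˢ
  ⟨x⟩-cong a p n = *-congˡ (p n)

  ⟨x⟩-const-* : ∀ b f a → (const b *ˢ f) ⟨ a x⟩ˢ ≈ˢ const b *ˢ f ⟨ a x⟩ˢ
  ⟨x⟩-const-* b f a n = trans (*-congˡ (sym (·-const b f n)))
    (trans (Rₛ.solve 3 (λ x y z → x Rₛ.:* (y Rₛ.:* z) Rₛ.:= y Rₛ.:* (x Rₛ.:* z)) refl _ _ _)
      (·-const b (f ⟨ a x⟩ˢ) n))

  ∂-⟨x⟩ : ∀ f a → ∂ (f ⟨ a x⟩ˢ) ≈ˢ const a *ˢ (∂ f) ⟨ a x⟩ˢ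
  ∂-⟨x⟩ f a n = trans
    (Rₛ.solve 4 (λ i a p f → i Rₛ.:* (a Rₛ.:* p Rₛ.:* f) Rₛ.:= a Rₛ.:* (p Rₛ.:* (i Rₛ.:* f))) refl _ _ _ _)
    (·-const a ((∂ f) ⟨ a x⟩ˢ) n)

  -- The derivative rules are doubled because the angles in the theorem are halved.
  module _ (ρ a b : Carrier) (a+a : a + a ≈ b) where

    private
      s c : Series
      s = egfˢ (geometric ρ 0# 1#) ⟨ a x⟩ˢ
      c = egfˢ (geometric ρ 1# 0#) ⟨ a x⟩ˢ

      const-double : ∀ f → const a *ˢ f +ˢ const a *ˢ f ≈ˢ const b *ˢ f
      const-double f n = trans (+-cong (sym (·-const a f n)) (sym (·-const a f n)))
        (trans (sym (distribʳ _ _ _)) (trans (*-congʳ a+a) (·-const b f n)))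

    2∂-01 : ∂ s +ˢ ∂ s ≈ˢ const b *ˢ c
    2∂-01 = begin
      ∂ s +ˢ ∂ s
        ≈⟨ S.+-cong {∂ s} ∂s ∂s ⟩
      const a *ˢ c +ˢ const a *ˢ c
        ≈⟨ const-double c ⟩
      const b *ˢ c ∎
      where
      ∂s : ∂ s ≈ˢ const a *ˢ c
      ∂s = S.trans {∂ s} (∂-⟨x⟩ (egfˢ (geometric ρ 0# 1#)) a) (S.*-congˡ {const a} (⟨x⟩-cong a (∂-01 ρ)))

    2∂-10 : ∂ c +ˢ ∂ c ≈ˢ const ρ *ˢ (const b *ˢ s)
    2∂-10 = begin
      ∂ c +ˢ ∂ c
        ≈⟨ S.+-cong {∂ c} ∂c ∂c ⟩
      const a *ˢ (const ρ *ˢ s) +ˢ const a *ˢ (const ρ *ˢ s)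
        ≈⟨ solve 3 (λ a r s → a :* (r :* s) :+ a :* (r :* s) := r :* (a :* s :+ a :* s))
             (λ _ → refl) (const a) (const ρ) s ⟩
      const ρ *ˢ (const a *ˢ s +ˢ const a *ˢ s)
        ≈⟨ S.*-congˡ {const ρ} (const-double s) ⟩
      const ρ *ˢ (const b *ˢ s) ∎
      where
      ∂c : ∂ c ≈ˢ const a *ˢ (const ρ *ˢ s)
      ∂c = begin
        ∂ c
          ≈⟨ ∂-⟨x⟩ (egfˢ (geometric ρ 1# 0#)) a ⟩
        const a *ˢ (∂ (egfˢ (geometric ρ 1# 0#))) ⟨ a x⟩ˢ
          ≈⟨ S.*-congˡ {const a} (⟨x⟩-cong a (∂-10 ρ)) ⟩
        const a *ˢ (const ρ *ˢ egfˢ (geometric ρ 0# 1#)) ⟨ a x⟩ˢ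
          ≈⟨ S.*-congˡ {const a} (⟨x⟩-const-* ρ (egfˢ (geometric ρ 0# 1#)) a) ⟩
        const a *ˢ (const ρ *ˢ s) ∎

    pythagoras-⟨x⟩ : c *ˢ c +ˢ -ˢ (const ρ *ˢ (s *ˢ s)) ≈ˢ 1ˢ
    pythagoras-⟨x⟩ = pythagoras ρ b s c 2∂-01 2∂-10
      (trans (*-congˡ (zeroˡ _)) (zeroʳ _))
      (trans (*-identityˡ _) (trans (*-identityˡ _) φ-zero))

  -- These are the two coordinates of 2G′ = ω(1 + G²) for G = u + pω with ω² = -1 - ω, and of G(0) =
  -- 1.
  record Riccati (u p : Series) : Set ℓ where
    field
      2∂u : ∂ u +ˢ ∂ u ≈ˢ p *ˢ p +ˢ -ˢ (p *ˢ u +ˢ p *ˢ u)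
      2∂p : ∂ p +ˢ ∂ p ≈ˢ 1ˢ +ˢ u *ˢ u +ˢ -ˢ (u *ˢ p +ˢ u *ˢ p)
      u₀  : u 0 ≈ 1#
      p₀  : p 0 ≈ 0#

  -- Coefficient i of the right-hand sides involves only coefficients up to i, and it determines
  -- coefficient i + 1 of u and p after division by 2(i + 1).
  Riccati-unique : ∀ {u p v q} → Riccati u p → Riccati v q → u ≈ˢ v × p ≈ˢ q
  Riccati-unique {u} {p} {v} {q} x y =
    (λ n → proj₁ (upto n n ℕ.≤-refl)) , (λ n → proj₂ (upto n n ℕ.≤-refl))
    where
    module X = Riccati x
    module Y = Riccati y
    ∂-cancel : ∀ {f g : Series} n {a b} → (∂ f +ˢ ∂ f) n ≈ a → (∂ g +ˢ ∂ g) n ≈ b → a ≈ b →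
      f (suc n) ≈ g (suc n)
    ∂-cancel n p q r = ι-cancel n (ι-cancel 1 (trans (twice _) (trans p (trans r (trans (sym q) (sym (twice _)))))))
      where
      twice : ∀ x → (1# + (1# + 0#)) * x ≈ x + x
      twice = Rₛ.solve 1 (λ x → (Rₛ.con (+ 1) Rₛ.:+ (Rₛ.con (+ 1) Rₛ.:+ Rₛ.con (+ 0))) Rₛ.:* x Rₛ.:= x Rₛ.:+ x) refl
    -- The bound n carries a strong induction: it decreases structurally while all j up to i remain
    -- available.
    upto : ∀ n i → i ℕ.≤ n → u i ≈ v i × p i ≈ q i
    upto n zero _ = trans X.u₀ (sym Y.u₀) , trans X.p₀ (sym Y.p₀)
    upto (suc n) (suc i) (s≤s i≤n) =
      ∂-cancel {u} {v} i (X.2∂u i) (Y.2∂u i)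
        (+-cong (*ˢ-cong-≤ i pq pq) (-‿cong (+-cong (*ˢ-cong-≤ i pq uv) (*ˢ-cong-≤ i pq uv)))) ,
      ∂-cancel {p} {q} i (X.2∂p i) (Y.2∂p i)
        (+-cong (+-congˡ (*ˢ-cong-≤ i uv uv)) (-‿cong (+-cong (*ˢ-cong-≤ i uv pq) (*ˢ-cong-≤ i uv pq))))
      where
      uv : ∀ j → j ℕ.≤ i → u j ≈ v j
      uv j j≤i = proj₁ (upto n j (ℕ.≤-trans j≤i i≤n))
      pq : ∀ j → j ℕ.≤ i → p j ≈ q j
      pq j j≤i = proj₂ (upto n j (ℕ.≤-trans j≤i i≤n))

  -- The quotient rule with denominators cleared; it is the product rule for f n = m, multiplied by
  -- n.
  ∂-quotient : ∀ {f m n} → f *ˢ n ≈ˢ m → ∂ f *ˢ (n *ˢ n) ≈ˢ ∂ m *ˢ n +ˢ -ˢ (m *ˢ ∂ n)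
  ∂-quotient {f} {m} {n} p = begin
    ∂ f *ˢ (n *ˢ n)
      ≈⟨ solve 4 (λ f f′ n n′ → f′ :* (n :* n) := (f′ :* n :+ f :* n′) :* n :- f :* n :* n′)
           (λ _ → refl) f (∂ f) n (∂ n) ⟩
    (∂ f *ˢ n +ˢ f *ˢ ∂ n) *ˢ n +ˢ -ˢ (f *ˢ n *ˢ ∂ n)
      ≈⟨ S.+-cong {(∂ f *ˢ n +ˢ f *ˢ ∂ n) *ˢ n}
           (*ˢ-cong {g = n} (S.trans {∂ f *ˢ n +ˢ f *ˢ ∂ n} (S.sym {∂ (f *ˢ n)} (∂-*ˢ f n)) (∂-cong p)) S.refl)
           (S.-‿cong (*ˢ-cong {g = ∂ n} p S.refl)) ⟩
    ∂ m *ˢ n +ˢ -ˢ (m *ˢ ∂ n) ∎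

  *ˢ-cancel-square : ∀ {f g} n n⁻¹ → n⁻¹ *ˢ n ≈ˢ 1ˢ → f *ˢ (n *ˢ n) ≈ˢ g *ˢ (n *ˢ n) → f ≈ˢ g
  *ˢ-cancel-square {f} {g} n n⁻¹ inv p = *ˢ-cancelʳ (n⁻¹ *ˢ n⁻¹) (begin
    n⁻¹ *ˢ n⁻¹ *ˢ (n *ˢ n)
      ≈⟨ solve 2 (λ n m → m :* m :* (n :* n) := m :* n :* (m :* n)) (λ _ → refl) n n⁻¹ ⟩
    n⁻¹ *ˢ n *ˢ (n⁻¹ *ˢ n)
      ≈⟨ S.*-cong inv inv ⟩
    1ˢ *ˢ 1ˢ
      ≈⟨ S.*-identityˡ 1ˢ ⟩
    1ˢ ∎) p

  P-1ˢ : ∀ r → P r 1ˢ ≈ˢ const (P r 1ˢ 0)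
  P-1ˢ r zero    = sym (*-identityʳ _)
  P-1ˢ r (suc n) = trans (vanish (prev r) n) (sym (zeroʳ _))
    where
    vanish : ∀ r → P r 0ˢ ≈ˢ 0ˢ
    vanish 0F zero    = refl
    vanish 1F zero    = refl
    vanish 2F zero    = refl
    vanish r  (suc n) = vanish (prev r) n

  module Trisection (F : Series) (F*cos : F *ˢ cosˢ ≈ˢ 1ˢ +ˢ sinˢ) where

    private
      F₀ = P 0F F
      F₁ = P 1F F
      F₂ = P 2F F

    -- The quotient rule is applied to F cos = 1 + sin; the factor cos² can be cancelled because
    -- `Alternating.A` inverts `cosˢ`.
    2∂F : ∂ F +ˢ ∂ F ≈ˢ 1ˢ +ˢ F *ˢ F
    2∂F = *ˢ-cancel-square cosˢ (Alternating.A true) (Alternating.A*cos≈1 true) (begin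
      (∂ F +ˢ ∂ F) *ˢ (cosˢ *ˢ cosˢ)
        ≈⟨ S.distribʳ (cosˢ *ˢ cosˢ) (∂ F) (∂ F) ⟩
      ∂ F *ˢ (cosˢ *ˢ cosˢ) +ˢ ∂ F *ˢ (cosˢ *ˢ cosˢ)
        ≈⟨ S.+-cong {∂ F *ˢ (cosˢ *ˢ cosˢ)} quot quot ⟩
      cosˢ *ˢ cosˢ +ˢ (1ˢ +ˢ sinˢ) *ˢ sinˢ +ˢ (cosˢ *ˢ cosˢ +ˢ (1ˢ +ˢ sinˢ) *ˢ sinˢ)
        -- Splitting off cos² + sin² - 1, which is zero, leaves cos² + (1 + sin)², that is (1 + F²)
        -- cos².
        ≈⟨ solve 2 (λ s c → c :* c :+ (con (+ 1) :+ s) :* s :+ (c :* c :+ (con (+ 1) :+ s) :* s)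
             := c :* c :+ (con (+ 1) :+ s) :* (con (+ 1) :+ s) :+ (c :* c :+ s :* s :- con (+ 1)))
             (λ _ → refl) sinˢ cosˢ ⟩
      cosˢ *ˢ cosˢ +ˢ (1ˢ +ˢ sinˢ) *ˢ (1ˢ +ˢ sinˢ) +ˢ (cosˢ *ˢ cosˢ +ˢ sinˢ *ˢ sinˢ +ˢ -ˢ 1ˢ)
        ≈⟨ S.+-congˡ {cosˢ *ˢ cosˢ +ˢ (1ˢ +ˢ sinˢ) *ˢ (1ˢ +ˢ sinˢ)}
             (S.trans {cosˢ *ˢ cosˢ +ˢ sinˢ *ˢ sinˢ +ˢ -ˢ 1ˢ} (S.+-congʳ { -ˢ 1ˢ} cos²+sin²) (S.-‿inverseʳ 1ˢ)) ⟩
      cosˢ *ˢ cosˢ +ˢ (1ˢ +ˢ sinˢ) *ˢ (1ˢ +ˢ sinˢ) +ˢ 0ˢ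
        ≈⟨ S.+-congʳ {0ˢ} (S.+-congˡ {cosˢ *ˢ cosˢ} (S.*-cong (S.sym {F *ˢ cosˢ} F*cos) (S.sym {F *ˢ cosˢ} F*cos))) ⟩
      cosˢ *ˢ cosˢ +ˢ F *ˢ cosˢ *ˢ (F *ˢ cosˢ) +ˢ 0ˢ
        ≈⟨ solve 2 (λ f c → c :* c :+ f :* c :* (f :* c) :+ con (+ 0)
             := (con (+ 1) :+ f :* f) :* (c :* c)) (λ _ → refl) F cosˢ ⟩
      (1ˢ +ˢ F *ˢ F) *ˢ (cosˢ *ˢ cosˢ) ∎)
      where
      const-[-1] : ∀ f → const (- 1#) *ˢ f ≈ˢ -ˢ f
      const-[-1] f n = trans (sym (·-const (- 1#) f n))
        (Rₛ.solve 1 (λ x → (Rₛ.:- Rₛ.con (+ 1)) Rₛ.:* x Rₛ.:= Rₛ.:- x) refl (f n))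
      ∂cos : ∂ cosˢ ≈ˢ -ˢ sinˢ
      ∂cos = S.trans {∂ cosˢ} (∂-10 (- 1#)) (const-[-1] sinˢ)
      cos²+sin² : cosˢ *ˢ cosˢ +ˢ sinˢ *ˢ sinˢ ≈ˢ 1ˢ
      cos²+sin² = begin
        cosˢ *ˢ cosˢ +ˢ sinˢ *ˢ sinˢ
          ≈⟨ S.+-congˡ {cosˢ *ˢ cosˢ} (S.trans {const (- 1#) *ˢ -ˢ (sinˢ *ˢ sinˢ)} (const-[-1] _)
               (λ n → -‿involutive _)) ⟨
        cosˢ *ˢ cosˢ +ˢ const (- 1#) *ˢ -ˢ (sinˢ *ˢ sinˢ)
          ≈⟨ solve 3 (λ r s c → c :* c :+ r :* (:- (s :* s)) := c :* c :- r :* (s :* s))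
               (λ _ → refl) (const (- 1#)) sinˢ cosˢ ⟩
        cosˢ *ˢ cosˢ +ˢ -ˢ (const (- 1#) *ˢ (sinˢ *ˢ sinˢ))
          ≈⟨ pythagoras (- 1#) (1# + 1#) sinˢ cosˢ
               (S.trans {∂ sinˢ +ˢ ∂ sinˢ} (S.+-cong {∂ sinˢ} (∂-01 (- 1#)) (∂-01 (- 1#))) two)
               (S.trans {∂ cosˢ +ˢ ∂ cosˢ} (S.+-cong {∂ cosˢ} (∂-10 (- 1#)) (∂-10 (- 1#)))
                 (S.trans {const (- 1#) *ˢ sinˢ +ˢ const (- 1#) *ˢ sinˢ} (S.sym {const (- 1#) *ˢ (sinˢ +ˢ sinˢ)} (S.distribˡ (const (- 1#)) sinˢ sinˢ))
                    (S.*-congˡ {const (- 1#)} two)))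
               (zeroˡ _) (trans (*-identityˡ _) φ-zero) ⟩
        1ˢ ∎
        where
        open import Algebra.Properties.Ring ring using (-‿involutive)
        two : ∀ {f} → f +ˢ f ≈ˢ const (1# + 1#) *ˢ f
        two {f} n = trans (Rₛ.solve 1 (λ x → x Rₛ.:+ x Rₛ.:= (Rₛ.con (+ 1) Rₛ.:+ Rₛ.con (+ 1)) Rₛ.:* x) refl (f n))
          (·-const (1# + 1#) f n)
      quot : ∂ F *ˢ (cosˢ *ˢ cosˢ) ≈ˢ cosˢ *ˢ cosˢ +ˢ (1ˢ +ˢ sinˢ) *ˢ sinˢ
      quot = begin
        ∂ F *ˢ (cosˢ *ˢ cosˢ)
          ≈⟨ ∂-quotient {F} F*cos ⟩
        ∂ (1ˢ +ˢ sinˢ) *ˢ cosˢ +ˢ -ˢ ((1ˢ +ˢ sinˢ) *ˢ ∂ cosˢ)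
          ≈⟨ S.+-cong {∂ (1ˢ +ˢ sinˢ) *ˢ cosˢ} (*ˢ-cong {g = cosˢ} ∂num S.refl) (S.-‿cong (S.*-congˡ {1ˢ +ˢ sinˢ} ∂cos)) ⟩
        cosˢ *ˢ cosˢ +ˢ -ˢ ((1ˢ +ˢ sinˢ) *ˢ -ˢ sinˢ)
          ≈⟨ solve 2 (λ s c → c :* c :- (con (+ 1) :+ s) :* (:- s) := c :* c :+ (con (+ 1) :+ s) :* s)
               (λ _ → refl) sinˢ cosˢ ⟩
        cosˢ *ˢ cosˢ +ˢ (1ˢ +ˢ sinˢ) *ˢ sinˢ ∎
        where
        ∂num : ∂ (1ˢ +ˢ sinˢ) ≈ˢ cosˢ
        ∂num n = trans (∂-+ˢ 1ˢ sinˢ n) (trans (+-cong (∂-1ˢ n) (∂-01 (- 1#) n)) (+-identityˡ _))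

    -- `∂` lowers exponents by one, so the derivative of the part of residue r is the part of
    -- residue `prev r` in 1 + F². The constant 1 contributes for r = 1 only.
    2∂P : ∀ r → ∂ (P r F) +ˢ ∂ (P r F) ≈ˢ P (prev r) 1ˢ
      +ˢ (F₀ *ˢ P (prev r) F +ˢ F₁ *ˢ P (prev (prev r)) F +ˢ F₂ *ˢ P (prev (prev (prev r))) F)
    2∂P r = begin
      ∂ (P r F) +ˢ ∂ (P r F)
        ≈⟨ S.+-cong {P (prev r) (∂ F)} (P-∂ r F) (P-∂ r F) ⟨
      P (prev r) (∂ F) +ˢ P (prev r) (∂ F)
        ≈⟨ P-+ˢ (prev r) (∂ F) (∂ F) ⟨
      P (prev r) (∂ F +ˢ ∂ F)
        ≈⟨ P-cong (prev r) 2∂F ⟩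
      P (prev r) (1ˢ +ˢ F *ˢ F)
        ≈⟨ P-+ˢ (prev r) 1ˢ (F *ˢ F) ⟩
      P (prev r) 1ˢ +ˢ P (prev r) (F *ˢ F)
        ≈⟨ S.+-congˡ {P (prev r) 1ˢ} (P-*ˢ (prev r) F F) ⟩
      P (prev r) 1ˢ +ˢ (F₀ *ˢ P (prev r) F +ˢ F₁ *ˢ P (prev (prev r)) F +ˢ F₂ *ˢ P (prev (prev (prev r))) F) ∎

    ∂-difference : ∀ f g {a b} → ∂ f +ˢ ∂ f ≈ˢ a → ∂ g +ˢ ∂ g ≈ˢ b →
      ∂ (f +ˢ -ˢ g) +ˢ ∂ (f +ˢ -ˢ g) ≈ˢ a +ˢ -ˢ b
    ∂-difference f g {a} {b} p q = begin
      ∂ (f +ˢ -ˢ g) +ˢ ∂ (f +ˢ -ˢ g)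
        ≈⟨ S.+-cong {∂ (f +ˢ -ˢ g)} ∂- ∂- ⟩
      ∂ f +ˢ -ˢ ∂ g +ˢ (∂ f +ˢ -ˢ ∂ g)
        ≈⟨ solve 2 (λ f g → f :- g :+ (f :- g) := f :+ f :- (g :+ g)) (λ _ → refl) (∂ f) (∂ g) ⟩
      ∂ f +ˢ ∂ f +ˢ -ˢ (∂ g +ˢ ∂ g)
        ≈⟨ S.+-cong {∂ f +ˢ ∂ f} p (S.-‿cong q) ⟩
      a +ˢ -ˢ b ∎
      where
      ∂- : ∂ (f +ˢ -ˢ g) ≈ˢ ∂ f +ˢ -ˢ ∂ g
      ∂- n = trans (∂-+ˢ f (-ˢ g) n) (+-congˡ (∂-neg g n))

    F-Riccati : F 0 ≈ 1# → Riccati (F₀ +ˢ -ˢ F₂) (F₁ +ˢ -ˢ F₂)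
    F-Riccati F₀≈1 = record
      { 2∂u = begin
          ∂ (F₀ +ˢ -ˢ F₂) +ˢ ∂ (F₀ +ˢ -ˢ F₂)
            ≈⟨ ∂-difference F₀ F₂ (2∂P 0F) (2∂P 2F) ⟩
          P 2F 1ˢ +ˢ (F₀ *ˢ F₂ +ˢ F₁ *ˢ F₁ +ˢ F₂ *ˢ F₀)
            +ˢ -ˢ (P 1F 1ˢ +ˢ (F₀ *ˢ F₁ +ˢ F₁ *ˢ F₀ +ˢ F₂ *ˢ F₂))
            ≈⟨ S.+-cong {P 2F 1ˢ +ˢ (F₀ *ˢ F₂ +ˢ F₁ *ˢ F₁ +ˢ F₂ *ˢ F₀)}
                 (S.+-congʳ {F₀ *ˢ F₂ +ˢ F₁ *ˢ F₁ +ˢ F₂ *ˢ F₀} (S.trans {P 2F 1ˢ} (P-1ˢ 2F) (λ n → zeroˡ _)))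
                 (S.-‿cong (S.+-congʳ {F₀ *ˢ F₁ +ˢ F₁ *ˢ F₀ +ˢ F₂ *ˢ F₂} (S.trans {P 1F 1ˢ} (P-1ˢ 1F) (λ n → zeroˡ _)))) ⟩
          0ˢ +ˢ (F₀ *ˢ F₂ +ˢ F₁ *ˢ F₁ +ˢ F₂ *ˢ F₀)
            +ˢ -ˢ (0ˢ +ˢ (F₀ *ˢ F₁ +ˢ F₁ *ˢ F₀ +ˢ F₂ *ˢ F₂))
            ≈⟨ solve 3 (λ x y z → con (+ 0) :+ (x :* z :+ y :* y :+ z :* x)
                   :- (con (+ 0) :+ (x :* y :+ y :* x :+ z :* z))
                 := (y :- z) :* (y :- z) :- ((y :- z) :* (x :- z) :+ (y :- z) :* (x :- z)))
                 (λ _ → refl) F₀ F₁ F₂ ⟩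
          (F₁ +ˢ -ˢ F₂) *ˢ (F₁ +ˢ -ˢ F₂)
            +ˢ -ˢ ((F₁ +ˢ -ˢ F₂) *ˢ (F₀ +ˢ -ˢ F₂) +ˢ (F₁ +ˢ -ˢ F₂) *ˢ (F₀ +ˢ -ˢ F₂)) ∎
      ; 2∂p = begin
          ∂ (F₁ +ˢ -ˢ F₂) +ˢ ∂ (F₁ +ˢ -ˢ F₂)
            ≈⟨ ∂-difference F₁ F₂ (2∂P 1F) (2∂P 2F) ⟩
          P 0F 1ˢ +ˢ (F₀ *ˢ F₀ +ˢ F₁ *ˢ F₂ +ˢ F₂ *ˢ F₁)
            +ˢ -ˢ (P 1F 1ˢ +ˢ (F₀ *ˢ F₁ +ˢ F₁ *ˢ F₀ +ˢ F₂ *ˢ F₂))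
            ≈⟨ S.+-cong {P 0F 1ˢ +ˢ (F₀ *ˢ F₀ +ˢ F₁ *ˢ F₂ +ˢ F₂ *ˢ F₁)}
                 (S.+-congʳ {F₀ *ˢ F₀ +ˢ F₁ *ˢ F₂ +ˢ F₂ *ˢ F₁} (S.trans {P 0F 1ˢ} (P-1ˢ 0F) (λ n → *-identityˡ _)))
                 (S.-‿cong (S.+-congʳ {F₀ *ˢ F₁ +ˢ F₁ *ˢ F₀ +ˢ F₂ *ˢ F₂} (S.trans {P 1F 1ˢ} (P-1ˢ 1F) (λ n → zeroˡ _)))) ⟩
          1ˢ +ˢ (F₀ *ˢ F₀ +ˢ F₁ *ˢ F₂ +ˢ F₂ *ˢ F₁)
            +ˢ -ˢ (0ˢ +ˢ (F₀ *ˢ F₁ +ˢ F₁ *ˢ F₀ +ˢ F₂ *ˢ F₂))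
            ≈⟨ solve 3 (λ x y z → con (+ 1) :+ (x :* x :+ y :* z :+ z :* y)
                   :- (con (+ 0) :+ (x :* y :+ y :* x :+ z :* z))
                 := con (+ 1) :+ (x :- z) :* (x :- z) :- ((x :- z) :* (y :- z) :+ (x :- z) :* (y :- z)))
                 (λ _ → refl) F₀ F₁ F₂ ⟩
          1ˢ +ˢ (F₀ +ˢ -ˢ F₂) *ˢ (F₀ +ˢ -ˢ F₂)
            +ˢ -ˢ ((F₀ +ˢ -ˢ F₂) *ˢ (F₁ +ˢ -ˢ F₂) +ˢ (F₀ +ˢ -ˢ F₂) *ˢ (F₁ +ˢ -ˢ F₂)) ∎
      ; u₀ = trans (+-cong F₀≈1 -0#≈0#) (+-identityʳ _)
      ; p₀ = -‿inverseʳ 0#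
      }
      where open import Algebra.Properties.Ring ring using (-0#≈0#)

-- Closed forms by trigonometric and hyperbolic functions

module ClosedForms {κ ℓ} (R : CommutativeRing κ ℓ)
  (I : PowerSeries.ReciprocalFactorials R) where

  open import Data.Fin.Patterns using (0F; 1F; 2F)
  open import Data.Product.Base using (_×_; proj₁; proj₂)
  open import Data.Integer.Base using (+_)
  open CommutativeRing R
  open PowerSeries R
  open ReciprocalFactorials I
  open AlternatingRuns R I
  open RiccatiSystem R I

  private
    module S = CommutativeRing seriesRing
    module Rₛ = IntegerCoefficients R
  open IntegerCoefficients seriesRing
  open import Relation.Binary.Reasoning.Setoid S.setoid

  -- The bracketing agrees definitionally with the value of the solver's numerals `con (+ 2)` and
  -- `con (+ 3)`.
  2ˢ 3ˢ : Series
  2ˢ = 1ˢ +ˢ 1ˢ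
  3ˢ = 1ˢ +ˢ 1ˢ +ˢ 1ˢ

  2∂-quotient : ∀ {f m n} → f *ˢ n ≈ˢ m →
    (∂ f +ˢ ∂ f) *ˢ (n *ˢ n) ≈ˢ (∂ m +ˢ ∂ m) *ˢ n +ˢ -ˢ (m *ˢ (∂ n +ˢ ∂ n))
  2∂-quotient {f} {m} {n} p = begin
    (∂ f +ˢ ∂ f) *ˢ (n *ˢ n)
      ≈⟨ S.distribʳ (n *ˢ n) (∂ f) (∂ f) ⟩
    ∂ f *ˢ (n *ˢ n) +ˢ ∂ f *ˢ (n *ˢ n)
      ≈⟨ S.+-cong {∂ f *ˢ (n *ˢ n)} (∂-quotient {f} p) (∂-quotient {f} p) ⟩
    ∂ m *ˢ n +ˢ -ˢ (m *ˢ ∂ n) +ˢ (∂ m *ˢ n +ˢ -ˢ (m *ˢ ∂ n))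
      ≈⟨ solve 4 (λ m m′ n n′ → m′ :* n :- m :* n′ :+ (m′ :* n :- m :* n′)
           := (m′ :+ m′) :* n :- m :* (n′ :+ n′)) (λ _ → refl) m (∂ m) n (∂ n) ⟩
    (∂ m +ˢ ∂ m) *ˢ n +ˢ -ˢ (m *ˢ (∂ n +ˢ ∂ n)) ∎

  module ClosedForm
    (F : Series) (F*cos : F *ˢ cosˢ ≈ˢ 1ˢ +ˢ sinˢ)
    (√3 ½ : Carrier) (√3*√3 : √3 * √3 ≈ 1# + 1# + 1#) (½+½ : ½ + ½ ≈ 1#) where

    s c sh ch N : Series
    s  = sinˢ ⟨ ½ x⟩ˢ
    c  = cosˢ ⟨ ½ x⟩ˢ
    sh = sinhˢ ⟨ ½ * √3 x⟩ˢ
    ch = coshˢ ⟨ ½ * √3 x⟩ˢ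
    N  = 3ˢ *ˢ (s +ˢ ch)

    open ShortRuns F F*cos
    open Trisection F F*cos

    r : Series
    r = const √3

    private
      ½√3+½√3 : ½ * √3 + ½ * √3 ≈ √3
      ½√3+½√3 = trans (sym (distribʳ _ _ _)) (trans (*-congʳ ½+½) (*-identityˡ _))

      const-1 : ∀ f → const 1# *ˢ f ≈ˢ f
      const-1 f n = trans (sym (·-const 1# f n)) (*-identityˡ _)

      const-[-1] : ∀ f → const (- 1#) *ˢ f ≈ˢ -ˢ f
      const-[-1] f n = trans (sym (·-const (- 1#) f n))
        (Rₛ.solve 1 (λ x → (Rₛ.:- Rₛ.con (+ 1)) Rₛ.:* x Rₛ.:= Rₛ.:- x) refl (f n))

      2∂s : ∂ s +ˢ ∂ s ≈ˢ c
      2∂s = S.trans {∂ s +ˢ ∂ s} (2∂-01 (- 1#) ½ 1# ½+½) (const-1 c)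

      2∂c : ∂ c +ˢ ∂ c ≈ˢ -ˢ s
      2∂c = S.trans {∂ c +ˢ ∂ c} (2∂-10 (- 1#) ½ 1# ½+½)
        (S.trans {const (- 1#) *ˢ (const 1# *ˢ s)} (const-[-1] (const 1# *ˢ s)) (S.-‿cong (const-1 s)))

      2∂sh : ∂ sh +ˢ ∂ sh ≈ˢ r *ˢ ch
      2∂sh = 2∂-01 1# (½ * √3) √3 ½√3+½√3

      2∂ch : ∂ ch +ˢ ∂ ch ≈ˢ r *ˢ sh
      2∂ch = S.trans {∂ ch +ˢ ∂ ch} (2∂-10 1# (½ * √3) √3 ½√3+½√3) (const-1 (r *ˢ sh))

      e₁ : c *ˢ c +ˢ s *ˢ s +ˢ -ˢ 1ˢ ≈ˢ 0ˢ
      e₁ = begin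
        c *ˢ c +ˢ s *ˢ s +ˢ -ˢ 1ˢ
          ≈⟨ solve 2 (λ s c → c :* c :+ s :* s :- con (+ 1) := c :* c :- (:- (s :* s)) :- con (+ 1))
               (λ _ → refl) s c ⟩
        c *ˢ c +ˢ -ˢ (-ˢ (s *ˢ s)) +ˢ -ˢ 1ˢ
          ≈⟨ S.+-congʳ { -ˢ 1ˢ} (S.+-congˡ {c *ˢ c} (S.-‿cong (const-[-1] (s *ˢ s)))) ⟨
        c *ˢ c +ˢ -ˢ (const (- 1#) *ˢ (s *ˢ s)) +ˢ -ˢ 1ˢ
          ≈⟨ S.+-congʳ { -ˢ 1ˢ} (pythagoras-⟨x⟩ (- 1#) ½ 1# ½+½) ⟩
        1ˢ +ˢ -ˢ 1ˢ
          ≈⟨ S.-‿inverseʳ 1ˢ ⟩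
        0ˢ ∎

      e₂ : ch *ˢ ch +ˢ -ˢ (sh *ˢ sh) +ˢ -ˢ 1ˢ ≈ˢ 0ˢ
      e₂ = begin
        ch *ˢ ch +ˢ -ˢ (sh *ˢ sh) +ˢ -ˢ 1ˢ
          ≈⟨ S.+-congʳ { -ˢ 1ˢ} (S.+-congˡ {ch *ˢ ch} (S.-‿cong (const-1 (sh *ˢ sh)))) ⟨
        ch *ˢ ch +ˢ -ˢ (const 1# *ˢ (sh *ˢ sh)) +ˢ -ˢ 1ˢ
          ≈⟨ S.+-congʳ { -ˢ 1ˢ} (pythagoras-⟨x⟩ 1# (½ * √3) √3 ½√3+½√3) ⟩
        1ˢ +ˢ -ˢ 1ˢ
          ≈⟨ S.-‿inverseʳ 1ˢ ⟩
        0ˢ ∎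

      e₃ : r *ˢ r +ˢ -ˢ 3ˢ ≈ˢ 0ˢ
      e₃ = begin
        r *ˢ r +ˢ -ˢ 3ˢ
          ≈⟨ S.+-congʳ { -ˢ 3ˢ} (const-* √3 √3) ⟩
        const (√3 * √3) +ˢ -ˢ 3ˢ
          ≈⟨ (λ n → trans (+-congʳ (*-congʳ √3*√3)) (Rₛ.solve 1 (λ x →
               (Rₛ.con (+ 1) Rₛ.:+ Rₛ.con (+ 1) Rₛ.:+ Rₛ.con (+ 1)) Rₛ.:* x Rₛ.:- (x Rₛ.:+ x Rₛ.:+ x)
               Rₛ.:= Rₛ.con (+ 0)) refl (1ˢ n))) ⟩
        0ˢ ∎

      -- The two Riccati equations hold only modulo `e₁`, `e₂` and `e₃`. This is the combination of
      -- these relations with multipliers -9, 9 and z; once it is added, each equation is a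
      -- polynomial identity in free variables s, c, sh, ch, r. Only z differs between the two
      -- equations.
      remainder : Series → Series
      remainder z = -ˢ (3ˢ *ˢ 3ˢ) *ˢ (c *ˢ c +ˢ s *ˢ s +ˢ -ˢ 1ˢ)
        +ˢ 3ˢ *ˢ 3ˢ *ˢ (ch *ˢ ch +ˢ -ˢ (sh *ˢ sh) +ˢ -ˢ 1ˢ)
        +ˢ z *ˢ (r *ˢ r +ˢ -ˢ 3ˢ)

      +remainder : ∀ f z → f +ˢ remainder z ≈ˢ f
      +remainder f z = begin
        f +ˢ remainder z
          ≈⟨ S.+-congˡ {f} (S.+-cong { -ˢ (3ˢ *ˢ 3ˢ) *ˢ _ +ˢ 3ˢ *ˢ 3ˢ *ˢ _}
               (S.+-cong { -ˢ (3ˢ *ˢ 3ˢ) *ˢ (c *ˢ c +ˢ s *ˢ s +ˢ -ˢ 1ˢ)}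
                 (S.*-congˡ { -ˢ (3ˢ *ˢ 3ˢ)} e₁) (S.*-congˡ {3ˢ *ˢ 3ˢ} e₂))
               (S.*-congˡ {z} e₃)) ⟩
        f +ˢ (-ˢ (3ˢ *ˢ 3ˢ) *ˢ 0ˢ +ˢ 3ˢ *ˢ 3ˢ *ˢ 0ˢ +ˢ z *ˢ 0ˢ)
          ≈⟨ solve 4 (λ f x y z → f :+ (x :* con (+ 0) :+ y :* con (+ 0) :+ z :* con (+ 0)) := f)
               (λ _ → refl) f (-ˢ (3ˢ *ˢ 3ˢ)) (3ˢ *ˢ 3ˢ) z ⟩
        f ∎

    module Quotients (N⁻¹ : Series) (N⁻¹*N : N⁻¹ *ˢ N ≈ˢ 1ˢ) where

      -- For ω = (-1 + i√3)/2 these satisfy U + ωV = 3 (cos(x/2) + i sinh(√3x/2)), the numerator of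
      -- F(ωx) over the denominator `N`.
      U V û p̂ : Series
      U = 3ˢ *ˢ c +ˢ r *ˢ sh
      V = 2ˢ *ˢ (r *ˢ sh)
      û = U *ˢ N⁻¹
      p̂ = V *ˢ N⁻¹

      private
        *N⁻¹*N : ∀ f → f *ˢ N⁻¹ *ˢ N ≈ˢ f
        *N⁻¹*N f = S.trans {f *ˢ N⁻¹ *ˢ N} (S.*-assoc f N⁻¹ N)
          (S.trans {f *ˢ (N⁻¹ *ˢ N)} (S.*-congˡ {f} N⁻¹*N) (S.*-identityʳ f))

        N₀ : (s +ˢ ch) 0 ≈ 1#
        N₀ = trans (+-cong (trans (*-congˡ (zeroˡ _)) (zeroʳ _))
          (trans (*-identityˡ _) (trans (*-identityˡ _) φ-zero))) (+-identityˡ _)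

        c₀ : c 0 ≈ 1#
        c₀ = trans (*-identityˡ _) (trans (*-identityˡ _) φ-zero)

        sh₀ : sh 0 ≈ 0#
        sh₀ = trans (*-congˡ (zeroˡ _)) (zeroʳ _)

        2∂-linear : ∀ a {f f′} → ∂ f +ˢ ∂ f ≈ˢ f′ → ∂ (const a *ˢ f) +ˢ ∂ (const a *ˢ f) ≈ˢ const a *ˢ f′
        2∂-linear a {f} {f′} p = begin
          ∂ (const a *ˢ f) +ˢ ∂ (const a *ˢ f)
            ≈⟨ S.+-cong {∂ (const a *ˢ f)} (∂-const-* a f) (∂-const-* a f) ⟩
          const a *ˢ ∂ f +ˢ const a *ˢ ∂ f
            ≈⟨ S.distribˡ (const a) (∂ f) (∂ f) ⟨
          const a *ˢ (∂ f +ˢ ∂ f)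
            ≈⟨ S.*-congˡ {const a} p ⟩
          const a *ˢ f′ ∎

        2∂-sum : ∀ {f f′ g g′} → ∂ f +ˢ ∂ f ≈ˢ f′ → ∂ g +ˢ ∂ g ≈ˢ g′ →
          ∂ (f +ˢ g) +ˢ ∂ (f +ˢ g) ≈ˢ f′ +ˢ g′
        2∂-sum {f} {f′} {g} {g′} p q = begin
          ∂ (f +ˢ g) +ˢ ∂ (f +ˢ g)
            ≈⟨ S.+-cong {∂ (f +ˢ g)} (∂-+ˢ f g) (∂-+ˢ f g) ⟩
          ∂ f +ˢ ∂ g +ˢ (∂ f +ˢ ∂ g)
            ≈⟨ solve 2 (λ f g → f :+ g :+ (f :+ g) := f :+ f :+ (g :+ g)) (λ _ → refl) (∂ f) (∂ g) ⟩
          ∂ f +ˢ ∂ f +ˢ (∂ g +ˢ ∂ g)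
            ≈⟨ S.+-cong {∂ f +ˢ ∂ f} p q ⟩
          f′ +ˢ g′ ∎

        double : ∀ f → f +ˢ f ≈ˢ 2ˢ *ˢ f
        double f = solve 1 (λ f → f :+ f := con (+ 2) :* f) (λ _ → refl) f

        triple : ∀ f → f +ˢ f +ˢ f ≈ˢ 3ˢ *ˢ f
        triple f = solve 1 (λ f → f :+ f :+ f := con (+ 3) :* f) (λ _ → refl) f

        2∂-3 : ∀ {f f′} → ∂ f +ˢ ∂ f ≈ˢ f′ → ∂ (3ˢ *ˢ f) +ˢ ∂ (3ˢ *ˢ f) ≈ˢ 3ˢ *ˢ f′
        2∂-3 {f} {f′} p = begin
          ∂ (3ˢ *ˢ f) +ˢ ∂ (3ˢ *ˢ f)
            ≈⟨ S.+-cong {∂ (f +ˢ f +ˢ f)} (∂-cong (triple f)) (∂-cong (triple f)) ⟨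
          ∂ (f +ˢ f +ˢ f) +ˢ ∂ (f +ˢ f +ˢ f)
            ≈⟨ 2∂-sum {f +ˢ f} {f′ +ˢ f′} {f} (2∂-sum {f} {f′} {f} p p) p ⟩
          f′ +ˢ f′ +ˢ f′
            ≈⟨ triple f′ ⟩
          3ˢ *ˢ f′ ∎

        2∂N : ∂ N +ˢ ∂ N ≈ˢ 3ˢ *ˢ (c +ˢ r *ˢ sh)
        2∂N = 2∂-3 {s +ˢ ch} (2∂-sum {s} {c} {ch} 2∂s 2∂ch)

        2∂U : ∂ U +ˢ ∂ U ≈ˢ 3ˢ *ˢ -ˢ s +ˢ r *ˢ (r *ˢ ch)
        2∂U = 2∂-sum {3ˢ *ˢ c} {3ˢ *ˢ -ˢ s} {r *ˢ sh} (2∂-3 {c} 2∂c) (2∂-linear √3 {sh} 2∂sh)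

        2∂V : ∂ V +ˢ ∂ V ≈ˢ 2ˢ *ˢ (r *ˢ (r *ˢ ch))
        2∂V = begin
          ∂ V +ˢ ∂ V
            ≈⟨ S.+-cong {∂ (r *ˢ sh +ˢ r *ˢ sh)} (∂-cong (double (r *ˢ sh))) (∂-cong (double (r *ˢ sh))) ⟨
          ∂ (r *ˢ sh +ˢ r *ˢ sh) +ˢ ∂ (r *ˢ sh +ˢ r *ˢ sh)
            ≈⟨ 2∂-sum {r *ˢ sh} {r *ˢ (r *ˢ ch)} {r *ˢ sh} (2∂-linear √3 {sh} 2∂sh) (2∂-linear √3 {sh} 2∂sh) ⟩
          r *ˢ (r *ˢ ch) +ˢ r *ˢ (r *ˢ ch)
            ≈⟨ double (r *ˢ (r *ˢ ch)) ⟩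
          2ˢ *ˢ (r *ˢ (r *ˢ ch)) ∎

        -- As `N` is invertible, a differential equation for m/N may be checked after multiplication
        -- by N², where only polynomials in s, c, sh, ch and r remain.
        clear-denominators : ∀ {f m a b} → f *ˢ N ≈ˢ m → ∂ m +ˢ ∂ m ≈ˢ a →
          a *ˢ N +ˢ -ˢ (m *ˢ (3ˢ *ˢ (c +ˢ r *ˢ sh))) ≈ˢ b *ˢ (N *ˢ N) → ∂ f +ˢ ∂ f ≈ˢ b
        clear-denominators {f} {m} {a} {b} p q w = *ˢ-cancel-square N N⁻¹ N⁻¹*N (begin
          (∂ f +ˢ ∂ f) *ˢ (N *ˢ N)
            ≈⟨ 2∂-quotient {f} p ⟩
          (∂ m +ˢ ∂ m) *ˢ N +ˢ -ˢ (m *ˢ (∂ N +ˢ ∂ N))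
            ≈⟨ S.+-cong {(∂ m +ˢ ∂ m) *ˢ N} (*ˢ-cong {g = N} q S.refl) (S.-‿cong (S.*-congˡ {m} 2∂N)) ⟩
          a *ˢ N +ˢ -ˢ (m *ˢ (3ˢ *ˢ (c +ˢ r *ˢ sh)))
            ≈⟨ w ⟩
          b *ˢ (N *ˢ N) ∎)

      closed-Riccati : Riccati û p̂
      closed-Riccati = record
        { 2∂u = clear-denominators {û} {U} (*N⁻¹*N U) 2∂U (begin
            (3ˢ *ˢ -ˢ s +ˢ r *ˢ (r *ˢ ch)) *ˢ N +ˢ -ˢ (U *ˢ (3ˢ *ˢ (c +ˢ r *ˢ sh)))
              ≈⟨ solve 5 (λ s c sh ch r →
                   let n = con (+ 3) :* (s :+ ch)
                       u = con (+ 3) :* c :+ r :* sh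
                       v = con (+ 2) :* (r :* sh)
                   in (con (+ 3) :* (:- s) :+ r :* (r :* ch)) :* n :- u :* (con (+ 3) :* (c :+ r :* sh))
                     := (v :* v :- (v :* u :+ v :* u))
                        :+ ((:- (con (+ 3) :* con (+ 3))) :* (c :* c :+ s :* s :- con (+ 1))
                            :+ con (+ 3) :* con (+ 3) :* (ch :* ch :- sh :* sh :- con (+ 1))
                            :+ (con (+ 3) :* (s :* ch :+ ch :* ch :- sh :* sh)) :* (r :* r :- con (+ 3))))
                   (λ _ → refl) s c sh ch r ⟩
            (V *ˢ V +ˢ -ˢ (V *ˢ U +ˢ V *ˢ U)) +ˢ remainder (3ˢ *ˢ (s *ˢ ch +ˢ ch *ˢ ch +ˢ -ˢ (sh *ˢ sh)))
              ≈⟨ +remainder (V *ˢ V +ˢ -ˢ (V *ˢ U +ˢ V *ˢ U)) (3ˢ *ˢ (s *ˢ ch +ˢ ch *ˢ ch +ˢ -ˢ (sh *ˢ sh))) ⟩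
            V *ˢ V +ˢ -ˢ (V *ˢ U +ˢ V *ˢ U)
              ≈⟨ S.+-cong {p̂ *ˢ N *ˢ (p̂ *ˢ N)} (S.*-cong v v) (S.-‿cong (S.+-cong {p̂ *ˢ N *ˢ (û *ˢ N)} (S.*-cong v u) (S.*-cong v u))) ⟨
            p̂ *ˢ N *ˢ (p̂ *ˢ N) +ˢ -ˢ (p̂ *ˢ N *ˢ (û *ˢ N) +ˢ p̂ *ˢ N *ˢ (û *ˢ N))
              ≈⟨ solve 3 (λ u p n → p :* n :* (p :* n) :- (p :* n :* (u :* n) :+ p :* n :* (u :* n))
                   := (p :* p :- (p :* u :+ p :* u)) :* (n :* n)) (λ _ → refl) û p̂ N ⟩
            (p̂ *ˢ p̂ +ˢ -ˢ (p̂ *ˢ û +ˢ p̂ *ˢ û)) *ˢ (N *ˢ N) ∎)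
        ; 2∂p = clear-denominators {p̂} {V} (*N⁻¹*N V) 2∂V (begin
            2ˢ *ˢ (r *ˢ (r *ˢ ch)) *ˢ N +ˢ -ˢ (V *ˢ (3ˢ *ˢ (c +ˢ r *ˢ sh)))
              ≈⟨ solve 5 (λ s c sh ch r →
                   let n = con (+ 3) :* (s :+ ch)
                       u = con (+ 3) :* c :+ r :* sh
                       v = con (+ 2) :* (r :* sh)
                   in con (+ 2) :* (r :* (r :* ch)) :* n :- v :* (con (+ 3) :* (c :+ r :* sh))
                     := (n :* n :+ u :* u :- (u :* v :+ u :* v))
                        :+ ((:- (con (+ 3) :* con (+ 3))) :* (c :* c :+ s :* s :- con (+ 1))
                            :+ con (+ 3) :* con (+ 3) :* (ch :* ch :- sh :* sh :- con (+ 1))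
                            :+ (con (+ 2) :* con (+ 3) :* (s :* ch :+ ch :* ch) :- con (+ 3) :* (sh :* sh)) :* (r :* r :- con (+ 3))))
                   (λ _ → refl) s c sh ch r ⟩
            (N *ˢ N +ˢ U *ˢ U +ˢ -ˢ (U *ˢ V +ˢ U *ˢ V)) +ˢ remainder (2ˢ *ˢ 3ˢ *ˢ (s *ˢ ch +ˢ ch *ˢ ch) +ˢ -ˢ (3ˢ *ˢ (sh *ˢ sh)))
              ≈⟨ +remainder (N *ˢ N +ˢ U *ˢ U +ˢ -ˢ (U *ˢ V +ˢ U *ˢ V)) (2ˢ *ˢ 3ˢ *ˢ (s *ˢ ch +ˢ ch *ˢ ch) +ˢ -ˢ (3ˢ *ˢ (sh *ˢ sh))) ⟩
            N *ˢ N +ˢ U *ˢ U +ˢ -ˢ (U *ˢ V +ˢ U *ˢ V)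
              ≈⟨ S.+-cong {N *ˢ N +ˢ û *ˢ N *ˢ (û *ˢ N)} (S.+-congˡ {N *ˢ N} (S.*-cong u u))
                   (S.-‿cong (S.+-cong {û *ˢ N *ˢ (p̂ *ˢ N)} (S.*-cong u v) (S.*-cong u v))) ⟨
            N *ˢ N +ˢ û *ˢ N *ˢ (û *ˢ N) +ˢ -ˢ (û *ˢ N *ˢ (p̂ *ˢ N) +ˢ û *ˢ N *ˢ (p̂ *ˢ N))
              ≈⟨ solve 3 (λ u p n → n :* n :+ u :* n :* (u :* n) :- (u :* n :* (p :* n) :+ u :* n :* (p :* n))
                   := (con (+ 1) :+ u :* u :- (u :* p :+ u :* p)) :* (n :* n)) (λ _ → refl) û p̂ N ⟩
            (1ˢ +ˢ û *ˢ û +ˢ -ˢ (û *ˢ p̂ +ˢ û *ˢ p̂)) *ˢ (N *ˢ N) ∎)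
        ; u₀ = trans (+-identityʳ _) (trans (*-congʳ U₀) (trans (*-comm _ _) (trans (sym (+-identityʳ _)) (N⁻¹*N 0))))
        ; p₀ = trans (+-identityʳ _) (trans (*-congʳ V₀) (zeroˡ _))
        }
        where
        u : û *ˢ N ≈ˢ U
        u = *N⁻¹*N U
        v : p̂ *ˢ N ≈ˢ V
        v = *N⁻¹*N V
        V₀ : V 0 ≈ 0#
        V₀ = trans (+-identityʳ _) (trans (*-congˡ (trans (+-identityʳ _) (trans (*-congˡ sh₀) (zeroʳ _)))) (zeroʳ _))
        U₀ : U 0 ≈ N 0
        U₀ = trans (+-cong (+-congʳ (*-congˡ c₀)) (trans (+-identityʳ _) (trans (*-congˡ sh₀) (zeroʳ _))))
          (trans (+-identityʳ _) (+-congʳ (*-congˡ (sym N₀))))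

      private
        u p Den : Series
        u = P 0F F +ˢ -ˢ P 2F F
        p = P 1F F +ˢ -ˢ P 2F F
        Den = 3ˢ *ˢ c +ˢ -ˢ (r *ˢ sh)

        agree : u ≈ˢ û × p ≈ˢ p̂
        agree = Riccati-unique (F-Riccati F₀≈1) closed-Riccati

        u*N : u *ˢ N ≈ˢ U
        u*N = S.trans {u *ˢ N} (*ˢ-cong {g = N} (proj₁ agree) S.refl) (*N⁻¹*N U)

        p*N : p *ˢ N ≈ˢ V
        p*N = S.trans {p *ˢ N} (*ˢ-cong {g = N} (proj₂ agree) S.refl) (*N⁻¹*N V)

        -- The denominator in the theorem is U - V = (u - p) N, and u - p is Q because the part of
        -- residue 2 cancels.
        Den≈ : Den ≈ˢ (P 0F F +ˢ -ˢ P 1F F) *ˢ N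
        Den≈ = begin
          Den
            ≈⟨ solve 3 (λ c sh r → con (+ 3) :* c :- r :* sh
                 := (con (+ 3) :* c :+ r :* sh) :- con (+ 2) :* (r :* sh)) (λ _ → refl) c sh r ⟩
          U +ˢ -ˢ V
            ≈⟨ S.+-cong {u *ˢ N} u*N (S.-‿cong p*N) ⟨
          u *ˢ N +ˢ -ˢ (p *ˢ N)
            ≈⟨ solve 4 (λ x y z n → (x :- z) :* n :- (y :- z) :* n := (x :- y) :* n)
                 (λ _ → refl) (P 0F F) (P 1F F) (P 2F F) N ⟩
          (P 0F F +ˢ -ˢ P 1F F) *ˢ N ∎

        -- `Den` is Q N and A Q = 1, so only f N is left of A f Q N.
        A*f*Den : ∀ {f g h} → A *ˢ f ≈ˢ g → f *ˢ N ≈ˢ h → g *ˢ Den ≈ˢ h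
        A*f*Den {f} {g} {h} a b = begin
          g *ˢ Den
            ≈⟨ *ˢ-cong (S.sym {A *ˢ f} a) Den≈ ⟩
          A *ˢ f *ˢ ((P 0F F +ˢ -ˢ P 1F F) *ˢ N)
            ≈⟨ solve 4 (λ a f q n → a :* f :* (q :* n) := a :* q :* (f :* n))
                 (λ _ → refl) A f (P 0F F +ˢ -ˢ P 1F F) N ⟩
          A *ˢ (P 0F F +ˢ -ˢ P 1F F) *ˢ (f *ˢ N)
            ≈⟨ S.*-cong A*[P₀-P₁] b ⟩
          1ˢ *ˢ h
            ≈⟨ S.*-identityˡ h ⟩
          h ∎

      C*Den : C *ˢ Den ≈ˢ V
      C*Den = A*f*Den {p} A*[P₁-P₂] p*N

      D*Den : D *ˢ Den ≈ˢ 3ˢ *ˢ s +ˢ -ˢ (3ˢ *ˢ c) +ˢ 3ˢ *ˢ ch +ˢ -ˢ (r *ˢ sh)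
      D*Den = A*f*Den {P 2F F +ˢ -ˢ (P 0F F +ˢ -ˢ 1ˢ)} A*[P₂-P₃] (begin
        (P 2F F +ˢ -ˢ (P 0F F +ˢ -ˢ 1ˢ)) *ˢ N
          -- The factor in front of `N` is 1 - u, whence the numerator N - U.
          ≈⟨ solve 3 (λ x z n → (z :- (x :- con (+ 1))) :* n := n :- (x :- z) :* n)
               (λ _ → refl) (P 0F F) (P 2F F) N ⟩
        N +ˢ -ˢ (u *ˢ N)
          ≈⟨ S.+-congˡ {N} (S.-‿cong u*N) ⟩
        N +ˢ -ˢ U
          ≈⟨ solve 5 (λ s c sh ch r → con (+ 3) :* (s :+ ch) :- (con (+ 3) :* c :+ r :* sh)
               := con (+ 3) :* s :- con (+ 3) :* c :+ con (+ 3) :* ch :- r :* sh) (λ _ → refl) s c sh ch r ⟩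
        3ˢ *ˢ s +ˢ -ˢ (3ˢ *ˢ c) +ˢ 3ˢ *ˢ ch +ˢ -ˢ (r *ˢ sh) ∎)

-- Maximal runs described by a Boolean recursion

module RunLengths where

  open import Defs using (Word; AltDescent; NoAltDescent; AltRun; AllAltRunsShort; LastAltRunHasLength)
  open import Data.Bool.Base using (Bool; true; false; not; _∧_; _∨_)
  open import Data.Bool.Properties using (∧-zeroʳ; ∨-zeroʳ; ¬-not)
  open import Data.Empty using (⊥; ⊥-elim)
  open import Data.Fin.Base as Fin using (Fin; toℕ; fromℕ; fromℕ<; inject₁)
  import Data.Fin.Properties as Fin
  open import Data.Nat.Base as ℕ using (ℕ; zero; suc; _+_; _∸_; _≤_; _<_; z≤n; s≤s)
  import Data.Nat.Properties as ℕ
  open import Data.Product.Base using (∃-syntax; _×_; _,_; proj₁; proj₂)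
  open import Data.Sum.Base using (inj₁; inj₂)
  open import Data.Vec.Base using (Vec)
  open import Function.Bundles using (_⇔_; mk⇔)
  open import Relation.Binary.PropositionalEquality
  open import Relation.Nullary.Negation using (contradiction)

  true≢false : ∀ {x} → x ≡ true → x ≡ false → ⊥
  true≢false refl ()

  module _ (δ : ℕ → Bool) where

    -- An automaton reading the descent sequence `δ`. Its states are a last run of length 1 or 2,
    -- and a run reaching length 3 leaves both states for good. A single entry is a run of length 1.
    last1 last2 : ℕ → Bool
    last1 zero    = true
    last1 (suc m) = (last1 m ∨ last2 m) ∧ δ m
    last2 zero    = false
    last2 (suc m) = last1 m ∧ not (δ m)

    -- At m = 0 there is no last step: the universal form makes `Last1` hold there, the existential
    -- form makes `Last2` fail.
    Short Last1 Last2 : ℕ → Set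
    Short m = ∀ i → suc i < m → δ i ≡ false → δ (suc i) ≡ true
    Last1 m = ∀ i → suc i ≡ m → δ i ≡ true
    Last2 m = ∃[ i ] suc i ≡ m × δ i ≡ false

    private
      ∧-intro : ∀ {x y} → x ≡ true → y ≡ true → x ∧ y ≡ true
      ∧-intro refl refl = refl

      ∧-elim : ∀ x {y} → x ∧ y ≡ true → x ≡ true × y ≡ true
      ∧-elim true p = refl , p

    Short-pred : ∀ {m} → Short (suc m) → Short m
    Short-pred s i i<m = s i (ℕ.m<n⇒m<1+n i<m)

    last1-sound : ∀ m → last1 m ≡ true → Short m × Last1 m
    last2-sound : ∀ m → last2 m ≡ true → Short m × Last2 m
    short-sound : ∀ m → last1 m ∨ last2 m ≡ true → Short m
    short-sound m p with last1 m in eq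
    ... | true  = proj₁ (last1-sound m eq)
    ... | false = proj₁ (last2-sound m p)
    last1-sound zero    p = (λ _ ()) , λ _ ()
    last1-sound (suc m) p with ∧-elim (last1 m ∨ last2 m) p
    ... | s , d = short , λ { i refl → d }
      where
      short : Short (suc m)
      short i (s≤s i<m) e with ℕ.m≤n⇒m<n∨m≡n i<m
      ... | inj₁ lt   = short-sound m s i lt e
      ... | inj₂ refl = d
    last2-sound (suc m) p with ∧-elim (last1 m) p
    ... | s , d = short , m , refl , not-true d
      where
      not-true : ∀ {x} → not x ≡ true → x ≡ false
      not-true {false} _ = refl
      short : Short (suc m)
      short i (s≤s i<m) e with ℕ.m≤n⇒m<n∨m≡n i<m
      ... | inj₁ lt   = proj₁ (last1-sound m s) i lt e
      ... | inj₂ refl = ⊥-elim (true≢false (proj₂ (last1-sound m s) i refl) e)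

    last1-complete : ∀ m → Short m → Last1 m → last1 m ≡ true
    last2-complete : ∀ m → Short m → Last2 m → last2 m ≡ true
    short-complete : ∀ m → Short m → last1 m ∨ last2 m ≡ true
    short-complete zero    s = refl
    short-complete (suc m) s with δ m in eq
    ... | true  = cong₂ _∨_ (∧-intro (short-complete m (Short-pred s)) refl) refl
    ... | false = trans (cong (((last1 m ∨ last2 m) ∧ false) ∨_)
        (∧-intro (last1-complete m (Short-pred s) last) refl)) (∨-zeroʳ _)
      where
      last : Last1 m
      last i refl = ¬-not λ e → true≢false (s i ℕ.≤-refl e) eq
    last1-complete zero    s l = refl
    last1-complete (suc m) s l = ∧-intro (short-complete m (Short-pred s)) (l m refl)
    last2-complete (suc m) s (m , refl , e) =
      ∧-intro (last1-complete m (Short-pred s) last) (cong not e)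
      where
      last : Last1 m
      last i refl = ¬-not λ e′ → true≢false (s i ℕ.≤-refl e′) e

    last1-last2-disjoint : ∀ m → last1 m ∧ last2 m ≡ false
    last1-last2-disjoint zero    = refl
    last1-last2-disjoint (suc m) with δ m
    ... | true  = trans (cong (((last1 m ∨ last2 m) ∧ true) ∧_) (∧-zeroʳ (last1 m))) (∧-zeroʳ _)
    ... | false = cong (_∧ (last1 m ∧ true)) (∧-zeroʳ (last1 m ∨ last2 m))

  module _ {δ δ′ : ℕ → Bool} where

    last1-cong : ∀ m → (∀ i → i < m → δ i ≡ δ′ i) → last1 δ m ≡ last1 δ′ m
    last2-cong : ∀ m → (∀ i → i < m → δ i ≡ δ′ i) → last2 δ m ≡ last2 δ′ m
    last1-cong zero    p = refl
    last1-cong (suc m) p = cong₂ _∧_ (cong₂ _∨_ (last1-cong m q) (last2-cong m q)) (p m ℕ.≤-refl)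
      where q = λ i i<m → p i (ℕ.m<n⇒m<1+n i<m)
    last2-cong zero    p = refl
    last2-cong (suc m) p = cong₂ _∧_ (last1-cong m (λ i i<m → p i (ℕ.m<n⇒m<1+n i<m))) (cong not (p m ℕ.≤-refl))

  module _ (δ : ℕ → Bool) where

    extend-left : ∀ a → ∃[ l ] l ≤ a × (∀ i → l ≤ i → i < a → δ i ≡ false)
      × (∀ k → suc k ≡ l → δ k ≡ true)
    extend-left zero = 0 , z≤n , (λ _ _ ()) , λ _ ()
    extend-left (suc a) with δ a in eq
    ... | true = suc a , ℕ.≤-refl , (λ i a<i i<1+a → contradiction i<1+a (ℕ.≤⇒≯ a<i)) , λ { _ refl → eq }
    ... | false with extend-left a
    ...   | l , l≤a , no , max = l , ℕ.m≤n⇒m≤1+n l≤a , no′ , max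
      where
      no′ : ∀ i → l ≤ i → i < suc a → δ i ≡ false
      no′ i l≤i (s≤s i≤a) with ℕ.m≤n⇒m<n∨m≡n i≤a
      ... | inj₁ i<a  = no i l≤i i<a
      ... | inj₂ refl = eq

    -- The recursion is on the number k of steps left, so that k + b is the fixed end of the word.
    extend-right : ∀ k b → ∃[ r ] b ≤ r × r ≤ k + b × (∀ i → b ≤ i → i < r → δ i ≡ false)
      × (r < k + b → δ r ≡ true)
    extend-right zero b = b , ℕ.≤-refl , ℕ.≤-refl ,
      (λ i b≤i i<b → contradiction i<b (ℕ.≤⇒≯ b≤i)) , λ b<b → contradiction b<b (ℕ.<-irrefl refl)
    extend-right (suc k) b with δ b in eq
    ... | true  = b , ℕ.≤-refl , ℕ.m≤n+m b (suc k) ,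
      (λ i b≤i i<b → contradiction i<b (ℕ.≤⇒≯ b≤i)) , λ _ → eq
    ... | false with extend-right k (suc b)
    ...   | r , b<r , r≤ , no , max = r , ℕ.<⇒≤ b<r , subst (r ≤_) (ℕ.+-suc k b) r≤ , no′ ,
            λ r< → max (subst (r <_) (sym (ℕ.+-suc k b)) r<)
      where
      no′ : ∀ i → b ≤ i → i < r → δ i ≡ false
      no′ i b≤i i<r with ℕ.m≤n⇒m<n∨m≡n b≤i
      ... | inj₁ b<i  = no i b<i i<r
      ... | inj₂ refl = eq

  module _ {m : ℕ} (π : Word (suc m)) (δ : ℕ → Bool)
    (descent⇒δ : ∀ i → AltDescent π i → δ (toℕ i) ≡ true)
    (δ⇒descent : ∀ i → δ (toℕ i) ≡ true → AltDescent π i) where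

    No : ℕ → ℕ → Set
    No a b = ∀ i → a ≤ i → i < b → δ i ≡ false

    private
      toℕ≤m : (b : Fin (suc m)) → toℕ b ≤ m
      toℕ≤m b = ℕ.≤-pred (Fin.toℕ<n b)

    No⇒NoAltDescent : ∀ a b → No (toℕ a) (toℕ b) → NoAltDescent π a b
    No⇒NoAltDescent a b no i a≤i i<b d = true≢false (descent⇒δ i d)
      (no (toℕ i) (subst (toℕ a ≤_) (Fin.toℕ-inject₁ i) a≤i) i<b)

    NoAltDescent⇒No : ∀ a b → NoAltDescent π a b → No (toℕ a) (toℕ b)
    NoAltDescent⇒No a b no i a≤i i<b = subst (λ k → δ k ≡ false) toℕ-j
      (¬-not λ e → no j (subst (toℕ a ≤_) (sym (trans (Fin.toℕ-inject₁ j) toℕ-j)) a≤i)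
        (subst (λ k → suc k ≤ toℕ b) (sym toℕ-j) i<b) (δ⇒descent j e))
      where
      i<m = ℕ.<-≤-trans i<b (toℕ≤m b)
      j = fromℕ< i<m
      toℕ-j : toℕ j ≡ i
      toℕ-j = Fin.toℕ-fromℕ< i<m

    -- A wider block would contain the step into a or the step out of b, and each of these is an
    -- alternating descent or does not exist.
    altRun : ∀ a b → a Fin.≤ b → No (toℕ a) (toℕ b) →
      (∀ k → suc k ≡ toℕ a → δ k ≡ true) → (toℕ b < m → δ (toℕ b) ≡ true) → AltRun π a b
    altRun a b a≤b no maxˡ maxʳ = a≤b , No⇒NoAltDescent a b no , max
      where
      max : ∀ a′ b′ → a′ Fin.≤ a → b Fin.≤ b′ → NoAltDescent π a′ b′ → a′ ≡ a × b′ ≡ b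
      max a′ b′ a′≤a b≤b′ no′ = Fin.toℕ-injective eqˡ , Fin.toℕ-injective eqʳ
        where
        no″ = NoAltDescent⇒No a′ b′ no′
        eqˡ : toℕ a′ ≡ toℕ a
        eqˡ with ℕ.m≤n⇒m<n∨m≡n a′≤a
        ... | inj₂ e = e
        ... | inj₁ a′<a = ⊥-elim (left (toℕ a) refl)
          where
          left : ∀ k → k ≡ toℕ a → ⊥
          left zero    e = ℕ.n≮0 (subst (toℕ a′ <_) (sym e) a′<a)
          left (suc k) e = true≢false (maxˡ k e) (no″ k (ℕ.≤-pred (subst (toℕ a′ <_) (sym e) a′<a))
            (ℕ.≤-trans (ℕ.≤-reflexive e) (ℕ.≤-trans a≤b b≤b′)))
        eqʳ : toℕ b′ ≡ toℕ b
        eqʳ with ℕ.m≤n⇒m<n∨m≡n b≤b′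
        ... | inj₂ e = sym e
        ... | inj₁ b<b′ = ⊥-elim (true≢false (maxʳ (ℕ.<-≤-trans b<b′ (toℕ≤m b′)))
          (no″ (toℕ b) (ℕ.≤-trans a′≤a a≤b) b<b′))

    -- Two consecutive steps without alternating descent extend to a maximal block, which has at
    -- least three entries.
    AllShort⇒Short : AllAltRunsShort π → Short δ m
    AllShort⇒Short all i i+1<m e = ¬-not λ e′ → helper e′
      where
      helper : δ (suc i) ≡ false → ⊥
      helper e′ with extend-left δ i | extend-right δ (m ∸ suc (suc i)) (suc (suc i))
      ... | l , l≤i , noˡ , maxˡ | r , i+2≤r , r≤ , noʳ , maxʳ =
        ℕ.<⇒≱ (all a b (altRun a b a≤b no maxˡ′ maxʳ′)) (s≤s long)
        where
        r≤m : r ≤ m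
        r≤m = subst (r ≤_) (ℕ.m∸n+n≡m i+1<m) r≤
        l≤r : l ≤ r
        l≤r = ℕ.≤-trans l≤i (ℕ.≤-trans (ℕ.m≤n+m i 2) i+2≤r)
        a b : Fin (suc m)
        a = fromℕ< (s≤s (ℕ.≤-trans l≤r r≤m))
        b = fromℕ< (s≤s r≤m)
        toℕ-a : toℕ a ≡ l
        toℕ-a = Fin.toℕ-fromℕ< _
        toℕ-b : toℕ b ≡ r
        toℕ-b = Fin.toℕ-fromℕ< _
        a≤b : a Fin.≤ b
        a≤b = subst₂ _≤_ (sym toℕ-a) (sym toℕ-b) l≤r
        no : No (toℕ a) (toℕ b)
        no j a≤j j<b with ℕ.<-≤-connex j i
        ... | inj₁ j<i = noˡ j (subst (_≤ j) toℕ-a a≤j) j<i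
        ... | inj₂ i≤j with ℕ.m≤n⇒m<n∨m≡n i≤j
        ...   | inj₂ refl = e
        ...   | inj₁ i<j with ℕ.m≤n⇒m<n∨m≡n i<j
        ...     | inj₂ refl = e′
        ...     | inj₁ i+1<j = noʳ j i+1<j (subst (j <_) toℕ-b j<b)
        maxˡ′ : ∀ k → suc k ≡ toℕ a → δ k ≡ true
        maxˡ′ k e = maxˡ k (trans e toℕ-a)
        maxʳ′ : toℕ b < m → δ (toℕ b) ≡ true
        maxʳ′ b<m = subst (λ k → δ k ≡ true) (sym toℕ-b)
          (maxʳ (subst₂ _<_ toℕ-b (sym (ℕ.m∸n+n≡m i+1<m)) b<m))
        long : 2 ≤ toℕ b ∸ toℕ a
        long = subst₂ (λ x y → 2 ≤ x ∸ y) (sym toℕ-b) (sym toℕ-a)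
          (ℕ.≤-trans (ℕ.≤-reflexive (sym (ℕ.m+n∸n≡m 2 i))) (ℕ.∸-mono i+2≤r l≤i))

    Short⇒AllShort : Short δ m → AllAltRunsShort π
    Short⇒AllShort s a b (a≤b , no , _) = s≤s (ℕ.≰⇒> λ long →
      let 2+a≤b = subst (2 + toℕ a ≤_) (ℕ.m∸n+n≡m a≤b) (ℕ.+-monoˡ-≤ (toℕ a) long)
          no′ = NoAltDescent⇒No a b no
      in true≢false
           (s (toℕ a) (ℕ.<-≤-trans 2+a≤b (toℕ≤m b)) (no′ (toℕ a) ℕ.≤-refl (ℕ.<⇒≤ 2+a≤b)))
           (no′ (suc (toℕ a)) (ℕ.n≤1+n _) 2+a≤b))

    private
      lastRun : ∀ a → No (toℕ a) m → (∀ k → suc k ≡ toℕ a → δ k ≡ true) → AltRun π a (fromℕ m)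
      lastRun a no max = altRun a (fromℕ m) (Fin.≤fromℕ a)
        (subst (No (toℕ a)) (sym (Fin.toℕ-fromℕ m)) no) max
        (λ m<m → contradiction (subst (_< m) (Fin.toℕ-fromℕ m) m<m) (ℕ.<-irrefl refl))

    -- If the last step were no alternating descent, the last two entries would form a wider block
    -- and contradict maximality.
    LastLength1⇒Last1 : LastAltRunHasLength π 1 → Last1 δ m
    LastLength1⇒Last1 (a , (a≤m , no , max) , len) i refl = ¬-not λ e → helper e
      where
      j : Fin (suc m)
      j = inject₁ (fromℕ i)
      toℕ-j : toℕ j ≡ i
      toℕ-j = trans (Fin.toℕ-inject₁ (fromℕ i)) (Fin.toℕ-fromℕ i)
      m≤a : m ≤ toℕ a
      m≤a = ℕ.m∸n≡0⇒m≤n (subst (λ k → k ∸ toℕ a ≡ 0) (Fin.toℕ-fromℕ m) (ℕ.suc-injective len))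
      helper : δ i ≡ false → ⊥
      helper e with max j (fromℕ m) (subst (_≤ toℕ a) (sym toℕ-j) (ℕ.≤-trans (ℕ.n≤1+n i) m≤a)) ℕ.≤-refl
        (No⇒NoAltDescent j (fromℕ m) λ k j≤k k<m → subst (λ k → δ k ≡ false)
          (ℕ.≤-antisym (subst (_≤ k) toℕ-j j≤k) (ℕ.≤-pred (subst (k <_) (Fin.toℕ-fromℕ m) k<m))) e)
      ... | j≡a , _ = ℕ.<⇒≱ (ℕ.≤-reflexive (cong suc (trans (sym (cong toℕ j≡a)) toℕ-j))) m≤a

    Last1⇒LastLength1 : Last1 δ m → LastAltRunHasLength π 1
    Last1⇒LastLength1 l = fromℕ m ,
      lastRun (fromℕ m) (λ i m≤i i<m → contradiction i<m (ℕ.≤⇒≯ (subst (_≤ i) (Fin.toℕ-fromℕ m) m≤i)))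
        (λ k e → l k (trans e (Fin.toℕ-fromℕ m))) ,
      cong suc (ℕ.n∸n≡0 (toℕ (fromℕ m)))

    LastLength2⇒Last2 : LastAltRunHasLength π 2 → Last2 δ m
    LastLength2⇒Last2 (a , (a≤m , no , max) , len) = toℕ a , sym m≡1+a ,
      NoAltDescent⇒No a (fromℕ m) no (toℕ a) ℕ.≤-refl
        (ℕ.≤-reflexive (sym (trans (Fin.toℕ-fromℕ m) m≡1+a)))
      where
      m≡1+a : m ≡ suc (toℕ a)
      m≡1+a = trans (sym (Fin.toℕ-fromℕ m)) (trans (sym (ℕ.m∸n+n≡m a≤m))
        (cong (_+ toℕ a) (ℕ.suc-injective len)))

    -- `Short` supplies the maximality on the left: the step before a step without alternating
    -- descent must be one.
    Last2⇒LastLength2 : Short δ m → Last2 δ m → LastAltRunHasLength π 2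
    Last2⇒LastLength2 s (i , refl , e) = j ,
      lastRun j (λ k j≤k k<m → subst (λ k → δ k ≡ false)
          (ℕ.≤-antisym (subst (_≤ k) toℕ-j j≤k) (ℕ.≤-pred k<m)) e)
        (λ k e′ → ¬-not λ e″ → true≢false
          (s k (subst (_< suc i) (sym (trans e′ toℕ-j)) ℕ.≤-refl) e″)
          (subst (λ k → δ k ≡ false) (sym (trans e′ toℕ-j)) e)) ,
      trans (cong₂ (λ x y → suc (x ∸ y)) (Fin.toℕ-fromℕ (suc i)) toℕ-j)
        (cong suc (ℕ.m+n∸n≡m 1 i))
      where
      j : Fin (suc m)
      j = inject₁ (fromℕ i)
      toℕ-j : toℕ j ≡ i
      toℕ-j = trans (Fin.toℕ-inject₁ (fromℕ i)) (Fin.toℕ-fromℕ i)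

    last1-⇔ : (AllAltRunsShort π × LastAltRunHasLength π 1) ⇔ (last1 δ m ≡ true)
    last1-⇔ = mk⇔
      (λ (s , l) → last1-complete δ m (AllShort⇒Short s) (LastLength1⇒Last1 l))
      (λ p → let s , l = last1-sound δ m p in Short⇒AllShort s , Last1⇒LastLength1 l)

    last2-⇔ : (AllAltRunsShort π × LastAltRunHasLength π 2) ⇔ (last2 δ m ≡ true)
    last2-⇔ = mk⇔
      (λ (s , l) → last2-complete δ m (AllShort⇒Short s) (LastLength2⇒Last2 l))
      (λ p → let s , l = last2-sound δ m p in Short⇒AllShort s , Last2⇒LastLength2 s l)

-- Permutations counted by their last entry

module LastEntryCounts where

  open import Defs using (Word; AltDescent; AllAltRunsShort; allAltRunsShort?; LastAltRunHasLength; lastAltRunHasLength?; words; permutations; countShortRuns)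
  open import Data.Bool.Base using (Bool; true; false; not; _∧_; _∨_)
  open import Data.Bool.Properties using (∧-assoc; ∧-comm; not-involutive; T-≡)
  open import Data.Fin.Base as Fin using (Fin; zero; suc; toℕ; inject₁; punchIn)
  import Data.Fin.Properties as Fin
  open import Data.List.Base as List using (List)
  import Data.List.Properties as List
  import Data.Nat.ListAction as ListAction
  import Data.Nat.ListAction.Properties as ListAction
  open import Data.Nat.Base as ℕ using (ℕ; zero; suc; _+_; _*_; _≤_; _<_; s≤s; _<ᵇ_)
  import Data.Nat.Properties as ℕ
  open import Data.Nat.Divisibility using (_∣_; _∤_; _∣?_; ∣m+n∣m⇒∣n; ∣m∣n⇒∣m+n; ∣-refl; ∣1⇒≡1)
  open import Data.Product.Base using (_×_; _,_)
  open import Data.Sum.Base using (inj₁; inj₂)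
  open import Data.Vec.Base as Vec using (Vec; []; _∷_; _∷ʳ_; lookup; map)
  import Data.Vec.Relation.Unary.AllPairs as AllPairs
  import Data.Vec.Relation.Unary.All as All
  open import Function.Base using (_∘_; id)
  open import Function.Bundles using (_⇔_; Equivalence)
  open import Relation.Binary.PropositionalEquality
  open import Relation.Nullary.Decidable using (Dec; does; yes; no; ¬?; _×-dec_; dec-true; dec-false)
  open import Relation.Nullary.Negation using (contradiction)
  open import Relation.Unary using (Pred; Decidable)
  open import Level using (0ℓ)
  open RunLengths

  open import Algebra.Properties.CommutativeMonoid.Sum ℕ.+-0-commutativeMonoid
    using (sum; sum-cong-≗; ∑-comm; ∑-distrib-+; sum-remove; sum-replicate-zero)
  open ≡-Reasoning

  indicator : Bool → ℕ
  indicator true  = 1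
  indicator false = 0

  indicator-∧ : ∀ x y → indicator (x ∧ y) ≡ indicator x * indicator y
  indicator-∧ true  y = sym (ℕ.+-identityʳ _)
  indicator-∧ false y = refl

  indicator-∨ : ∀ x y → x ∧ y ≡ false → indicator (x ∨ y) ≡ indicator x + indicator y
  indicator-∨ true  false _ = refl
  indicator-∨ false y     _ = refl

  sumW : ∀ n k → (Vec (Fin n) k → ℕ) → ℕ
  sumW n zero    F = F []
  sumW n (suc k) F = sum λ x → sumW n k (F ∘ (x ∷_))

  sumW-cong : ∀ n k {F G : Vec (Fin n) k → ℕ} → (∀ w → F w ≡ G w) → sumW n k F ≡ sumW n k G
  sumW-cong n zero    p = p []
  sumW-cong n (suc k) p = sum-cong-≗ λ x → sumW-cong n k (p ∘ (x ∷_))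

  sumW-+ : ∀ n k (F G : Vec (Fin n) k → ℕ) → sumW n k (λ w → F w + G w) ≡ sumW n k F + sumW n k G
  sumW-+ n zero    F G = refl
  sumW-+ n (suc k) F G = trans (sum-cong-≗ λ x → sumW-+ n k (F ∘ (x ∷_)) (G ∘ (x ∷_)))
    (∑-distrib-+ (λ x → sumW n k (F ∘ (x ∷_))) (λ x → sumW n k (G ∘ (x ∷_))))

  sumW-zero : ∀ n k → sumW n k (λ _ → 0) ≡ 0
  sumW-zero n zero    = refl
  sumW-zero n (suc k) = trans (sum-cong-≗ {n} λ x → sumW-zero n k) (sum-replicate-zero n)

  sumW-indicator-* : ∀ n k b (F : Vec (Fin n) k → ℕ) →
    sumW n k (λ w → indicator b * F w) ≡ indicator b * sumW n k F
  sumW-indicator-* n k true  F = trans (sumW-cong n k λ w → ℕ.+-identityʳ (F w)) (sym (ℕ.+-identityʳ _))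
  sumW-indicator-* n k false F = sumW-zero n k

  sumW-∷ʳ : ∀ n k (F : Vec (Fin n) (suc k) → ℕ) →
    sumW n (suc k) F ≡ sum λ x → sumW n k λ w → F (w ∷ʳ x)
  sumW-∷ʳ n zero    F = refl
  sumW-∷ʳ n (suc k) F = trans (sum-cong-≗ λ y → sumW-∷ʳ n k (F ∘ (y ∷_)))
    (∑-comm λ y x → sumW n k λ w → F (y ∷ (w ∷ʳ x)))

  sum-cartesianProductWith : ∀ {A B C : Set} (f : A → B → C) (F : C → ℕ) xs ys →
    ListAction.sum (List.map F (List.cartesianProductWith f xs ys)) ≡
    ListAction.sum (List.map (λ x → ListAction.sum (List.map (F ∘ f x) ys)) xs)
  sum-cartesianProductWith f F List.[]       ys = refl
  sum-cartesianProductWith f F (x List.∷ xs) ys =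
    trans (trans (cong ListAction.sum (List.map-++ F (List.map (f x) ys) (List.cartesianProductWith f xs ys))) (ListAction.sum-++ (List.map F (List.map (f x) ys)) (List.map F (List.cartesianProductWith f xs ys))))
      (cong₂ _+_ (cong ListAction.sum (sym (List.map-∘ ys))) (sum-cartesianProductWith f F xs ys))

  sum-tabulate : ∀ {A : Set} n (g : Fin n → A) (F : A → ℕ) →
    ListAction.sum (List.map F (List.tabulate g)) ≡ sum (F ∘ g)
  sum-tabulate zero    g F = refl
  sum-tabulate (suc n) g F = cong (F (g zero) +_) (sum-tabulate n (g ∘ suc) F)

  sum-words : ∀ n k (F : Vec (Fin n) k → ℕ) → ListAction.sum (List.map F (words n k)) ≡ sumW n k F
  sum-words n zero    F = ℕ.+-identityʳ _
  sum-words n (suc k) F = begin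
    ListAction.sum (List.map F (List.cartesianProductWith _∷_ (List.allFin n) (words n k)))
      ≡⟨ sum-cartesianProductWith _∷_ F (List.allFin n) (words n k) ⟩
    ListAction.sum (List.map (λ x → ListAction.sum (List.map (F ∘ (x ∷_)) (words n k))) (List.allFin n))
      ≡⟨ sum-tabulate n id (λ x → ListAction.sum (List.map (F ∘ (x ∷_)) (words n k))) ⟩
    sum (λ x → ListAction.sum (List.map (F ∘ (x ∷_)) (words n k)))
      ≡⟨ sum-cong-≗ (λ x → sum-words n k (F ∘ (x ∷_))) ⟩
    sumW n (suc k) F ∎

  sum-filter : ∀ {A : Set} {P : Pred A 0ℓ} (P? : Decidable P) (F : A → ℕ) xs →
    ListAction.sum (List.map F (List.filter P? xs)) ≡ ListAction.sum (List.map (λ x → indicator (does (P? x)) * F x) xs)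
  sum-filter P? F List.[]       = refl
  sum-filter P? F (x List.∷ xs) with does (P? x)
  ... | true  = cong₂ _+_ (sym (ℕ.+-identityʳ (F x))) (sum-filter P? F xs)
  ... | false = sum-filter P? F xs

  length-filter : ∀ {A : Set} {P : Pred A 0ℓ} (P? : Decidable P) xs →
    List.length (List.filter P? xs) ≡ ListAction.sum (List.map (indicator ∘ does ∘ P?) xs)
  length-filter P? List.[]       = refl
  length-filter P? (x List.∷ xs) with does (P? x)
  ... | true  = cong suc (length-filter P? xs)
  ... | false = length-filter P? xs

  module _ {n : ℕ} where

    avoids : ∀ {k} → Fin n → Vec (Fin n) k → Bool
    avoids x []      = true
    avoids x (y ∷ w) = not (does (x Fin.≟ y)) ∧ avoids x w

    distinct : ∀ {k} → Vec (Fin n) k → Bool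
    distinct []      = true
    distinct (x ∷ w) = avoids x w ∧ distinct w

    does-≟-sym : ∀ (x y : Fin n) → does (x Fin.≟ y) ≡ does (y Fin.≟ x)
    does-≟-sym x y with y Fin.≟ x
    ... | yes y≡x = dec-true (x Fin.≟ y) (sym y≡x)
    ... | no  y≢x = dec-false (x Fin.≟ y) (y≢x ∘ sym)

    ∧-swap : ∀ x y z → x ∧ (y ∧ z) ≡ y ∧ (x ∧ z)
    ∧-swap x y z = trans (sym (∧-assoc x y z)) (trans (cong (_∧ z) (∧-comm x y)) (∧-assoc y x z))

    avoids-∷ʳ : ∀ {k} x (w : Vec (Fin n) k) y →
      avoids x (w ∷ʳ y) ≡ not (does (y Fin.≟ x)) ∧ avoids x w
    avoids-∷ʳ x []      y = cong (λ b → not b ∧ true) (does-≟-sym x y)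
    avoids-∷ʳ x (z ∷ w) y = trans (cong (not (does (x Fin.≟ z)) ∧_) (avoids-∷ʳ x w y))
      (∧-swap (not (does (x Fin.≟ z))) (not (does (y Fin.≟ x))) (avoids x w))

    distinct-∷ʳ : ∀ {k} (w : Vec (Fin n) k) x → distinct (w ∷ʳ x) ≡ avoids x w ∧ distinct w
    distinct-∷ʳ []      x = refl
    distinct-∷ʳ (y ∷ w) x = begin
      avoids y (w ∷ʳ x) ∧ distinct (w ∷ʳ x)
        ≡⟨ cong₂ _∧_ (avoids-∷ʳ y w x) (distinct-∷ʳ w x) ⟩
      (x≢y ∧ avoids y w) ∧ (avoids x w ∧ distinct w)
        ≡⟨ ∧-assoc x≢y _ _ ⟩
      x≢y ∧ (avoids y w ∧ (avoids x w ∧ distinct w))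
        ≡⟨ cong (x≢y ∧_) (∧-swap (avoids y w) (avoids x w) (distinct w)) ⟩
      x≢y ∧ (avoids x w ∧ (avoids y w ∧ distinct w))
        ≡⟨ ∧-assoc x≢y _ _ ⟨
      (x≢y ∧ avoids x w) ∧ (avoids y w ∧ distinct w) ∎
      where x≢y = not (does (x Fin.≟ y))

    does-all? : ∀ {k} x (w : Vec (Fin n) k) →
      does (All.all? (λ y → ¬? (x Fin.≟ y)) w) ≡ avoids x w
    does-all? x []      = refl
    does-all? x (y ∷ w) = cong (not (does (x Fin.≟ y)) ∧_) (does-all? x w)

    does-unique? : ∀ {k} (w : Vec (Fin n) k) →
      does (AllPairs.allPairs? (λ x y → ¬? (x Fin.≟ y)) w) ≡ distinct w
    does-unique? []      = refl
    does-unique? (x ∷ w) = cong₂ _∧_ (does-all? x w) (does-unique? w)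

  module _ {n : ℕ} (x : Fin (suc n)) where

    does-punchIn : ∀ y z → does (punchIn x y Fin.≟ punchIn x z) ≡ does (y Fin.≟ z)
    does-punchIn y z with y Fin.≟ z
    ... | yes y≡z = dec-true (punchIn x y Fin.≟ punchIn x z) (cong (punchIn x) y≡z)
    ... | no  y≢z = dec-false (punchIn x y Fin.≟ punchIn x z) (y≢z ∘ Fin.punchIn-injective x y z)

    avoids-map-punchIn : ∀ {k} y (w : Vec (Fin n) k) → avoids (punchIn x y) (map (punchIn x) w) ≡ avoids y w
    avoids-map-punchIn y []      = refl
    avoids-map-punchIn y (z ∷ w) = cong₂ _∧_ (cong not (does-punchIn y z)) (avoids-map-punchIn y w)

    distinct-map-punchIn : ∀ {k} (w : Vec (Fin n) k) → distinct (map (punchIn x) w) ≡ distinct w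
    distinct-map-punchIn []      = refl
    distinct-map-punchIn (y ∷ w) = cong₂ _∧_ (avoids-map-punchIn y w) (distinct-map-punchIn w)

    -- The letters other than x are the image of `punchIn x`, so words avoiding x are words over one
    -- letter fewer. This is how the rest is standardised once a last entry x is deleted.
    sumW-avoids : ∀ k (G : Vec (Fin (suc n)) k → Bool) →
      sumW (suc n) k (λ w → indicator (avoids x w ∧ G w)) ≡ sumW n k (λ w → indicator (G (map (punchIn x) w)))
    sumW-avoids zero    G = refl
    sumW-avoids (suc k) G = begin
      sum term
        ≡⟨ sum-remove {n} {x} term ⟩
      term x + sum (term ∘ punchIn x)
        ≡⟨ cong₂ _+_ term-x (sum-cong-≗ term-punchIn) ⟩
      sum (λ y → sumW n k (λ w → indicator (G (punchIn x y ∷ map (punchIn x) w)))) ∎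
      where
      term : Fin (suc n) → ℕ
      term y = sumW (suc n) k (λ w → indicator ((not (does (x Fin.≟ y)) ∧ avoids x w) ∧ G (y ∷ w)))
      term-x : term x ≡ 0
      term-x = trans (sumW-cong (suc n) k λ w →
          cong (λ b → indicator ((not b ∧ avoids x w) ∧ G (x ∷ w))) (dec-true (x Fin.≟ x) refl))
        (sumW-zero (suc n) k)
      term-punchIn : ∀ y → term (punchIn x y) ≡ sumW n k (λ w → indicator (G (punchIn x y ∷ map (punchIn x) w)))
      term-punchIn y = trans (sumW-cong (suc n) k λ w →
          cong (λ b → indicator ((not b ∧ avoids x w) ∧ G (punchIn x y ∷ w)))
            (dec-false (x Fin.≟ punchIn x y) (Fin.punchInᵢ≢i x y ∘ sym)))
        (sumW-avoids k (G ∘ (punchIn x y ∷_)))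

  -- The value beyond the end of the word is junk.
  at : ∀ {n k} → Vec (Fin n) k → ℕ → ℕ
  at []      i       = 0
  at (x ∷ w) zero    = toℕ x
  at (x ∷ w) (suc i) = at w i

  at-lookup : ∀ {n k} (w : Vec (Fin n) k) j → at w (toℕ j) ≡ toℕ (lookup w j)
  at-lookup (x ∷ w) zero    = refl
  at-lookup (x ∷ w) (suc j) = at-lookup w j

  at-∷ʳ-< : ∀ {n k} (w : Vec (Fin n) k) x {i} → i < k → at (w ∷ʳ x) i ≡ at w i
  at-∷ʳ-< (y ∷ w) x {zero}  _         = refl
  at-∷ʳ-< (y ∷ w) x {suc i} (s≤s i<k) = at-∷ʳ-< w x i<k

  at-∷ʳ-last : ∀ {n k} (w : Vec (Fin n) k) x → at (w ∷ʳ x) k ≡ toℕ x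
  at-∷ʳ-last []      x = refl
  at-∷ʳ-last (y ∷ w) x = at-∷ʳ-last w x

  punchInℕ : ℕ → ℕ → ℕ
  punchInℕ zero    a       = suc a
  punchInℕ (suc x) zero    = zero
  punchInℕ (suc x) (suc a) = suc (punchInℕ x a)

  toℕ-punchIn : ∀ {n} (x : Fin (suc n)) y → toℕ (punchIn x y) ≡ punchInℕ (toℕ x) (toℕ y)
  toℕ-punchIn zero    y       = refl
  toℕ-punchIn (suc x) zero    = refl
  toℕ-punchIn (suc x) (suc y) = cong suc (toℕ-punchIn x y)

  at-map-punchIn : ∀ {n k} x (w : Vec (Fin n) k) {i} → i < k →
    at (map (punchIn x) w) i ≡ punchInℕ (toℕ x) (at w i)
  at-map-punchIn x (y ∷ w) {zero}  _         = toℕ-punchIn x y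
  at-map-punchIn x (y ∷ w) {suc i} (s≤s i<k) = at-map-punchIn x w i<k

  punchInℕ-mono : ∀ x a b → (punchInℕ x a <ᵇ punchInℕ x b) ≡ (a <ᵇ b)
  punchInℕ-mono zero    a       b       = refl
  punchInℕ-mono (suc x) zero    zero    = refl
  punchInℕ-mono (suc x) zero    (suc b) = refl
  punchInℕ-mono (suc x) (suc a) zero    = refl
  punchInℕ-mono (suc x) (suc a) (suc b) = punchInℕ-mono x a b

  punchInℕ-< : ∀ x a → (punchInℕ x a <ᵇ x) ≡ (a <ᵇ x)
  punchInℕ-< zero    a       = refl
  punchInℕ-< (suc x) zero    = refl
  punchInℕ-< (suc x) (suc a) = punchInℕ-< x a

  -- No value of `punchInℕ x` equals x, so failing to lie below x already means lying above it.
  punchInℕ-> : ∀ x a → (x <ᵇ punchInℕ x a) ≡ not (a <ᵇ x)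
  punchInℕ-> zero    a       = refl
  punchInℕ-> (suc x) zero    = refl
  punchInℕ-> (suc x) (suc a) = punchInℕ-> x a

  descends : Bool → ℕ → ℕ → Bool
  descends true  a b = b <ᵇ a
  descends false a b = a <ᵇ b

  -- `alt true i` holds for even i, which is the 0-based index of an odd position; there an
  -- alternating descent is an ordinary descent.
  δ : (ℕ → ℕ) → ℕ → Bool
  δ v i = descends (alt true i) (v i) (v (suc i))

  -- `below o x a` says that a `step o` leads from a to the entry x, where a is
  -- the rank of the preceding entry among all entries but x.
  below : Bool → ℕ → ℕ → Bool
  below true  x a = a <ᵇ x
  below false x a = not (a <ᵇ x)

  descends-punchInℕ : ∀ o x a b → descends o (punchInℕ x a) (punchInℕ x b) ≡ descends o a b
  descends-punchInℕ true  x a b = punchInℕ-mono x b a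
  descends-punchInℕ false x a b = punchInℕ-mono x a b

  descends-below : ∀ o x a → descends o (punchInℕ x a) x ≡ below (not o) x a
  descends-below true  x a = punchInℕ-> x a
  descends-below false x a = punchInℕ-< x a

  not-descends-below : ∀ o x a → not (descends o (punchInℕ x a) x) ≡ below o x a
  not-descends-below true  x a = trans (cong not (punchInℕ-> x a)) (not-involutive _)
  not-descends-below false x a = cong not (punchInℕ-< x a)

  countLast : ∀ m → ((ℕ → ℕ) → Bool) → Fin (suc m) → ℕ
  countLast m P x = sumW (suc m) m λ w → indicator (distinct (w ∷ʳ x) ∧ P (at (w ∷ʳ x)))

  -- Delete the last entry x and standardise the others: y is the rank of the entry that is now
  -- last. The hypothesis on `P⁺` says that it depends only on the standardised word and on the
  -- comparison of x with its predecessor.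
  countLast-step : ∀ m {P P⁺ : (ℕ → ℕ) → Bool} {o : Bool} (x : Fin (suc (suc m))) →
    (∀ w y → P⁺ (at (map (punchIn x) (w ∷ʳ y) ∷ʳ x)) ≡ P (at (w ∷ʳ y)) ∧ below o (toℕ x) (toℕ y)) →
    countLast (suc m) P⁺ x ≡ sum λ y → indicator (below o (toℕ x) (toℕ y)) * countLast m P y
  countLast-step m {P} {P⁺} {o} x h = begin
    sumW n (suc m) (λ w → indicator (distinct (w ∷ʳ x) ∧ P⁺ (at (w ∷ʳ x))))
      ≡⟨ sumW-cong n (suc m) (λ w → cong indicator (trans (cong (_∧ P⁺ (at (w ∷ʳ x))) (distinct-∷ʳ w x))
           (∧-assoc (avoids x w) (distinct w) _))) ⟩
    sumW n (suc m) (λ w → indicator (avoids x w ∧ (distinct w ∧ P⁺ (at (w ∷ʳ x)))))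
      ≡⟨ sumW-avoids x (suc m) (λ w → distinct w ∧ P⁺ (at (w ∷ʳ x))) ⟩
    sumW (suc m) (suc m) (λ w → indicator (distinct (map (punchIn x) w) ∧ P⁺ (at (map (punchIn x) w ∷ʳ x))))
      ≡⟨ sumW-∷ʳ (suc m) m (λ w → indicator (distinct (map (punchIn x) w) ∧ P⁺ (at (map (punchIn x) w ∷ʳ x)))) ⟩
    sum (λ y → sumW (suc m) m (λ w → indicator
        (distinct (map (punchIn x) (w ∷ʳ y)) ∧ P⁺ (at (map (punchIn x) (w ∷ʳ y) ∷ʳ x)))))
      ≡⟨ sum-cong-≗ (λ y → trans (sumW-cong (suc m) m (λ w → rearrange w y))
           (sumW-indicator-* (suc m) m (below o (toℕ x) (toℕ y)) _)) ⟩
    sum (λ y → indicator (below o (toℕ x) (toℕ y)) * countLast m P y) ∎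
    where
    n = suc (suc m)
    rearrange : ∀ w y → indicator (distinct (map (punchIn x) (w ∷ʳ y)) ∧ P⁺ (at (map (punchIn x) (w ∷ʳ y) ∷ʳ x)))
      ≡ indicator (below o (toℕ x) (toℕ y)) * indicator (distinct (w ∷ʳ y) ∧ P (at (w ∷ʳ y)))
    rearrange w y = trans (cong indicator (trans
        (cong₂ _∧_ (distinct-map-punchIn x (w ∷ʳ y)) (h w y))
        (trans (sym (∧-assoc (distinct (w ∷ʳ y)) _ _)) (∧-comm _ (below o (toℕ x) (toℕ y))))))
      (indicator-∧ (below o (toℕ x) (toℕ y)) _)

  module _ {m : ℕ} (x : Fin (suc (suc m))) (w : Vec (Fin (suc m)) m) (y : Fin (suc m)) where

    private
      w⁺ = map (punchIn x) (w ∷ʳ y) ∷ʳ x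

      at-w⁺ : ∀ {i} → i ≤ m → at w⁺ i ≡ punchInℕ (toℕ x) (at (w ∷ʳ y) i)
      at-w⁺ i≤m = trans (at-∷ʳ-< (map (punchIn x) (w ∷ʳ y)) x (s≤s i≤m)) (at-map-punchIn x (w ∷ʳ y) (s≤s i≤m))

    δ-prefix : ∀ i → i < m → δ (at w⁺) i ≡ δ (at (w ∷ʳ y)) i
    δ-prefix i i<m = trans (cong₂ (descends (alt true i)) (at-w⁺ (ℕ.<⇒≤ i<m)) (at-w⁺ i<m))
      (descends-punchInℕ (alt true i) (toℕ x) _ _)

    at-ends : ∀ o → descends o (at w⁺ m) (at w⁺ (suc m)) ≡ descends o (punchInℕ (toℕ x) (toℕ y)) (toℕ x)
    at-ends o = cong₂ (descends o)
      (trans (at-w⁺ ℕ.≤-refl) (cong (punchInℕ (toℕ x)) (at-∷ʳ-last w y)))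
      (at-∷ʳ-last (map (punchIn x) (w ∷ʳ y)) x)

  Last1At Last2At ShortAt : ℕ → (ℕ → ℕ) → Bool
  Last1At m v = last1 (δ v) m
  Last2At m v = last2 (δ v) m
  ShortAt m v = last1 (δ v) m ∨ last2 (δ v) m

  count1 count2 : ∀ m → Fin (suc m) → ℕ
  count1 m = countLast m (Last1At m)
  count2 m = countLast m (Last2At m)

  countLast-Short : ∀ m x → countLast m (ShortAt m) x ≡ count1 m x + count2 m x
  countLast-Short m x = trans (sumW-cong (suc m) m λ w → split (distinct (w ∷ʳ x)) (δ (at (w ∷ʳ x))))
    (sumW-+ (suc m) m _ _)
    where
    split : ∀ b δ → indicator (b ∧ (last1 δ m ∨ last2 δ m)) ≡ indicator (b ∧ last1 δ m) + indicator (b ∧ last2 δ m)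
    split true  δ = indicator-∨ (last1 δ m) (last2 δ m) (last1-last2-disjoint δ m)
    split false δ = refl

  count1-suc : ∀ m x → count1 (suc m) x ≡
    sum λ y → indicator (below (not (alt true m)) (toℕ x) (toℕ y)) * (count1 m y + count2 m y)
  count1-suc m x = trans
    (countLast-step m {ShortAt m} {Last1At (suc m)} {not (alt true m)} x λ w y → cong₂ _∧_
      (cong₂ _∨_ (last1-cong m (δ-prefix x w y)) (last2-cong m (δ-prefix x w y)))
      (trans (at-ends x w y (alt true m)) (descends-below (alt true m) (toℕ x) (toℕ y))))
    (sum-cong-≗ λ y → cong (indicator (below (not (alt true m)) (toℕ x) (toℕ y)) *_) (countLast-Short m y))

  count2-suc : ∀ m x → count2 (suc m) x ≡
    sum λ y → indicator (below (alt true m) (toℕ x) (toℕ y)) * count1 m y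
  count2-suc m x = countLast-step m {Last1At m} {Last2At (suc m)} {alt true m} x λ w y → cong₂ _∧_
    (last1-cong m (δ-prefix x w y))
    (trans (cong not (at-ends x w y (alt true m))) (not-descends-below (alt true m) (toℕ x) (toℕ y)))

  alt-odd : ∀ i → 2 ∤ suc i → alt true i ≡ true
  alt-odd zero          _ = refl
  alt-odd (suc zero)    p = contradiction ∣-refl p
  alt-odd (suc (suc i)) p = trans (not-involutive _) (alt-odd i (λ q → p (∣m∣n⇒∣m+n ∣-refl q)))

  alt-even : ∀ i → 2 ∣ suc i → alt true i ≡ false
  alt-even zero          p = contradiction (∣1⇒≡1 p) λ ()
  alt-even (suc zero)    _ = refl
  alt-even (suc (suc i)) p = trans (not-involutive _) (alt-even i (∣m+n∣m⇒∣n p ∣-refl))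

  module _ {m : ℕ} (π : Word (suc m)) where

    private
      <⇒<ᵇ≡true : ∀ {a b} → a < b → (a <ᵇ b) ≡ true
      <⇒<ᵇ≡true = Equivalence.to T-≡ ∘ ℕ.<⇒<ᵇ

      <ᵇ≡true⇒< : ∀ {a b} → (a <ᵇ b) ≡ true → a < b
      <ᵇ≡true⇒< {a} {b} = ℕ.<ᵇ⇒< a b ∘ Equivalence.from T-≡

      at-inject₁ : ∀ i → at π (toℕ i) ≡ toℕ (lookup π (inject₁ i))
      at-inject₁ i = trans (cong (at π) (sym (Fin.toℕ-inject₁ i))) (at-lookup π (inject₁ i))

      at-suc : ∀ (i : Fin m) → at π (suc (toℕ i)) ≡ toℕ (lookup π (suc i))
      at-suc i = at-lookup π (suc i)

      δ-odd : ∀ i → 2 ∤ suc (toℕ i) →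
        δ (at π) (toℕ i) ≡ (toℕ (lookup π (suc i)) <ᵇ toℕ (lookup π (inject₁ i)))
      δ-odd i odd rewrite sym (at-inject₁ i) | sym (at-suc i) | alt-odd (toℕ i) odd = refl

      δ-even : ∀ i → 2 ∣ suc (toℕ i) →
        δ (at π) (toℕ i) ≡ (toℕ (lookup π (inject₁ i)) <ᵇ toℕ (lookup π (suc i)))
      δ-even i even rewrite sym (at-inject₁ i) | sym (at-suc i) | alt-even (toℕ i) even = refl

    descent⇒δ : ∀ i → AltDescent π i → δ (at π) (toℕ i) ≡ true
    descent⇒δ i (inj₁ (odd  , >)) = trans (δ-odd i odd) (<⇒<ᵇ≡true >)
    descent⇒δ i (inj₂ (even , <)) = trans (δ-even i even) (<⇒<ᵇ≡true <)

    δ⇒descent : ∀ i → δ (at π) (toℕ i) ≡ true → AltDescent π i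
    δ⇒descent i p with 2 ∣? suc (toℕ i)
    ... | yes even = inj₂ (even , <ᵇ≡true⇒< (trans (sym (δ-even i even)) p))
    ... | no  odd  = inj₁ (odd , <ᵇ≡true⇒< (trans (sym (δ-odd i odd)) p))

  does-⇔-≡true : ∀ {A : Set} (A? : Dec A) {b} → A ⇔ (b ≡ true) → does A? ≡ b
  does-⇔-≡true (yes a) e = sym (Equivalence.to e a)
  does-⇔-≡true (no ¬a) {true}  e = contradiction (Equivalence.from e refl) ¬a
  does-⇔-≡true (no ¬a) {false} e = refl

  countShortRuns≡ : ∀ m ℓ {P : (ℕ → ℕ) → Bool} →
    (∀ π → (AllAltRunsShort {m} π × LastAltRunHasLength π ℓ) ⇔ (P (at π) ≡ true)) →
    countShortRuns m ℓ ≡ sum (countLast m P)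
  countShortRuns≡ m ℓ {P} e = begin
    List.length (List.filter P? (permutations (suc m)))
      ≡⟨ length-filter P? (permutations (suc m)) ⟩
    ListAction.sum (List.map (indicator ∘ does ∘ P?) (permutations (suc m)))
      ≡⟨ sum-filter _ (indicator ∘ does ∘ P?) (words (suc m) (suc m)) ⟩
    ListAction.sum (List.map _ (words (suc m) (suc m)))
      ≡⟨ sum-words (suc m) (suc m) _ ⟩
    sumW (suc m) (suc m) (λ w → indicator (does (AllPairs.allPairs? (λ x y → ¬? (x Fin.≟ y)) w)) * indicator (does (P? w)))
      ≡⟨ sumW-cong (suc m) (suc m) (λ w → trans
           (cong₂ (λ a b → indicator a * indicator b) (does-unique? w) (does-⇔-≡true (P? w) (e w)))
           (sym (indicator-∧ (distinct w) (P (at w))))) ⟩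
    sumW (suc m) (suc m) (λ w → indicator (distinct w ∧ P (at w)))
      ≡⟨ sumW-∷ʳ (suc m) m (λ w → indicator (distinct w ∧ P (at w))) ⟩
    sum (countLast m P) ∎
    where
    P? : Decidable _
    P? = λ π → allAltRunsShort? π ×-dec lastAltRunHasLength? π ℓ

  countShortRuns-1 : ∀ m → countShortRuns m 1 ≡ sum (count1 m)
  countShortRuns-1 m = countShortRuns≡ m 1 {Last1At m} λ π → last1-⇔ π (δ (at π)) (descent⇒δ π) (δ⇒descent π)

  countShortRuns-2 : ∀ m → countShortRuns m 2 ≡ sum (count2 m)
  countShortRuns-2 m = countShortRuns≡ m 2 {Last2At m} λ π → last2-⇔ π (δ (at π)) (descent⇒δ π) (δ⇒descent π)

-- The counts as vectors over the coefficient ring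

module CountVectors {κ ℓ} (R : CommutativeRing κ ℓ)
  (I : PowerSeries.ReciprocalFactorials R) where

  import Data.Nat.Properties as ℕ
  open import Data.Bool.Base using (Bool; true; false; not)
  open import Data.Fin.Base as Fin using (Fin; toℕ)
  import Data.Fin.Properties as Fin
  open import Data.Integer.Base using (+_)
  open import Data.Product.Base using (_×_; _,_; proj₁; proj₂)
  open import Defs using (countShortRuns)
  open IntegerCoefficients R
  open CommutativeRing R
  open PowerSeries R
  open ReciprocalFactorials I
  open Juxtaposition R I
  open AlternatingRuns R I
  open LastEntryCounts using (indicator; below; count1; count2; count1-suc; count2-suc; countShortRuns-1; countShortRuns-2)
  open import Relation.Binary.PropositionalEquality as ≡ using (_≡_)
  open import Relation.Binary.Reasoning.Setoid setoid
  open import Algebra.Properties.Semiring.Mult semiring using (×-homo-+)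
  open import Algebra.Properties.CommutativeMonoid.Sum ℕ.+-0-commutativeMonoid
    using (sum; sum-cong-≗; ∑-distrib-+; sum-replicate-zero)

  ι-+ : ∀ m n → ι (m ℕ.+ n) ≈ ι m + ι n
  ι-+ = ×-homo-+ 1#

  Σ-head : ∀ F n → Σ F (suc n) ≈ F 0 + Σ (tail F) n
  Σ-head F zero    = +-comm _ _
  Σ-head F (suc n) = trans (+-congʳ (Σ-head F n)) (+-assoc _ _ _)

  ι-sum : ∀ n (f : Fin n → ℕ) {F : Series} → (∀ y → ι (f y) ≈ F (toℕ y)) → ι (sum f) ≈ Σ F n
  ι-sum zero    f     p = refl
  ι-sum (suc n) f {F} p = trans (ι-+ (f Fin.zero) _)
    (trans (+-cong (p Fin.zero) (ι-sum n (λ y → f (Fin.suc y)) {tail F} (λ y → p (Fin.suc y)))) (sym (Σ-head F n)))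

  ι-sum-low : ∀ n (f : Fin n → ℕ) {F : Series} → (∀ y → ι (f y) ≈ F (toℕ y)) → ∀ {x} → x ℕ.≤ n →
    ι (sum λ y → indicator (below true x (toℕ y)) ℕ.* f y) ≈ Σ F x
  ι-sum-low n f p z≤n = reflexive (≡.cong ι (sum-replicate-zero n))
  ι-sum-low (suc n) f {F} p (s≤s {x} x≤n) = trans (ι-+ (f Fin.zero ℕ.+ 0) _)
    (trans (+-cong (trans (reflexive (≡.cong ι (ℕ.+-identityʳ (f Fin.zero)))) (p Fin.zero))
        (ι-sum-low n (λ y → f (Fin.suc y)) {tail F} (λ y → p (Fin.suc y)) x≤n))
      (sym (Σ-head F x)))

  -- The ranks that are not below x are obtained by complement, as in the definition of
  -- `step false`.
  ι-sum-below : ∀ o n (f : Fin n → ℕ) {F : Series} → (∀ y → ι (f y) ≈ F (toℕ y)) → ∀ {x} → x ℕ.≤ n →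
    ι (sum λ y → indicator (below o x (toℕ y)) ℕ.* f y) ≈ step o n F x
  ι-sum-below true  n f p x≤n = ι-sum-low n f p x≤n
  ι-sum-below false n f {F} p {x} x≤n = begin
    ι low                              ≈⟨ solve 2 (λ x y → x := y :+ x :- y) refl (ι low) (Σ F x) ⟩
    Σ F x + ι low - Σ F x              ≈⟨ +-congʳ (+-congʳ (ι-sum-low n f p x≤n)) ⟨
    ι high + ι low - Σ F x             ≈⟨ +-congʳ (ι-+ high low) ⟨
    ι (high ℕ.+ low) - Σ F x           ≡⟨ ≡.cong (λ k → ι k - Σ F x) high+low ⟩
    ι (sum f) - Σ F x                  ≈⟨ +-congʳ (ι-sum n f p) ⟩
    Σ F n - Σ F x                      ∎
    where
    term : Bool → Fin n → ℕ
    term o y = indicator (below o x (toℕ y)) ℕ.* f y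
    high low : ℕ
    high = sum (term true)
    low  = sum (term false)
    complement : ∀ b k → indicator b ℕ.* k ℕ.+ indicator (not b) ℕ.* k ≡ k
    complement true  k = ≡.trans (ℕ.+-identityʳ _) (ℕ.+-identityʳ k)
    complement false k = ℕ.+-identityʳ k
    high+low : high ℕ.+ low ≡ sum f
    high+low = ≡.trans (≡.sym (∑-distrib-+ (term true) (term false)))
      (sum-cong-≗ λ y → complement (toℕ y ℕ.<ᵇ x) (f y))

  module Counts (F : Series) (F*cos : F *ˢ cosˢ ≈ˢ 1ˢ +ˢ sinˢ) where

    open ShortRuns F F*cos

    -- `count1-suc` and `count2-suc` are the recursions of `cv` and `dv` over ℕ; each restricted sum
    -- becomes a `step` by `ι-sum-below`.
    count-vectors : ∀ m x → ι (count1 m x) ≈ cv m (toℕ x) × ι (count2 m x) ≈ dv m (toℕ x)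
    count-vectors zero    Fin.zero = +-identityʳ _ , refl
    count-vectors (suc m) x =
      trans (reflexive (≡.cong ι (count1-suc m x)))
        (ι-sum-below (not (alt true m)) (suc m) (λ y → count1 m y ℕ.+ count2 m y) {cv m +ˢ dv m}
          (λ y → trans (ι-+ (count1 m y) (count2 m y))
            (+-cong (proj₁ (count-vectors m y)) (proj₂ (count-vectors m y)))) x≤) ,
      trans (reflexive (≡.cong ι (count2-suc m x)))
        (ι-sum-below (alt true m) (suc m) (count1 m) {cv m} (λ y → proj₁ (count-vectors m y)) x≤)
      where
      x≤ : toℕ x ℕ.≤ suc m
      x≤ = ℕ.≤-pred (Fin.toℕ<n x)

    ι-countShortRuns-1 : ∀ m → ι (countShortRuns m 1) ≈ Σ (cv m) (suc m)
    ι-countShortRuns-1 m = trans (reflexive (≡.cong ι (countShortRuns-1 m)))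
      (ι-sum (suc m) (count1 m) (λ y → proj₁ (count-vectors m y)))

    ι-countShortRuns-2 : ∀ m → ι (countShortRuns m 2) ≈ Σ (dv m) (suc m)
    ι-countShortRuns-2 m = trans (reflexive (≡.cong ι (countShortRuns-2 m)))
      (ι-sum (suc m) (count2 m) (λ y → proj₂ (count-vectors m y)))

-- The commutative ring ℚ(√3) and its reciprocal factorials

open import Defs
open import Data.Nat.Base using (nonZero)
open import Data.Product.Base using (_×_)

open import Algebra.Structures using (IsCommutativeRing)
open import Data.Bool.Base using (if_then_else_)
open import Data.Fin.Base as Fin using (Fin; toℕ)
open import Data.Fin.Patterns using (0F; 1F; 2F)
open import Data.List.Base using (List; []; _∷_; _++_)
open import Data.Integer.Base as ℤ using (+_)
import Data.Integer.Properties as ℤ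
open import Data.Integer.Solver using () renaming (module +-*-Solver to ℤ-Solver)
open import Data.Nat.Base as ℕ using (ℕ; zero; suc; _∸_; _!)
open import Data.Nat.Divisibility using (_∣?_; ∣m+n∣m⇒∣n; ∣m∣n⇒∣m+n; ∣-refl)
import Data.Nat.Properties as ℕ
open import Data.Product.Base using (_,_)
open import Data.Rational.Base as ℚ using (ℚ; 0ℚ; 1ℚ; toℚᵘ)
import Data.Rational.Properties as ℚ
open import Data.Rational.Solver using () renaming (module +-*-Solver to ℚ-Solver)
open import Data.Rational.Unnormalised.Base as ℚᵘ using (mkℚᵘ; *≡*)
import Data.Rational.Unnormalised.Properties as ℚᵘ
open import Data.Vec.Base using (lookup)
open import Function.Bundles using (mk⇔)
open import Relation.Binary.PropositionalEquality
open import Relation.Nullary.Decidable using (does; does-⇔)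
import Tactic.MonoidSolver as MonoidSolver

private
  3ℚ : ℚ
  3ℚ = + 3 ℚ./ 1

+ᴷ-assoc : ∀ x y z → (x +ᴷ y) +ᴷ z ≡ x +ᴷ (y +ᴷ z)
+ᴷ-assoc x y z = cong₂ _+_√3 (ℚ.+-assoc (K.rat x) _ _) (ℚ.+-assoc (K.irr x) _ _)

+ᴷ-comm : ∀ x y → x +ᴷ y ≡ y +ᴷ x
+ᴷ-comm x y = cong₂ _+_√3 (ℚ.+-comm (K.rat x) _) (ℚ.+-comm (K.irr x) _)

+ᴷ-identityˡ : ∀ x → 0ᴷ +ᴷ x ≡ x
+ᴷ-identityˡ x = cong₂ _+_√3 (ℚ.+-identityˡ _) (ℚ.+-identityˡ _)

-ᴷ-inverseˡ : ∀ x → (-ᴷ x) +ᴷ x ≡ 0ᴷ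
-ᴷ-inverseˡ x = cong₂ _+_√3 (ℚ.+-inverseˡ (K.rat x)) (ℚ.+-inverseˡ (K.irr x))

*ᴷ-comm : ∀ x y → x *ᴷ y ≡ y *ᴷ x
*ᴷ-comm (a + b √3) (c + d √3) = cong₂ _+_√3
  (solve 5 (λ t a b c d → a :* c :+ t :* (b :* d) := c :* a :+ t :* (d :* b)) refl 3ℚ a b c d)
  (solve 4 (λ a b c d → a :* d :+ b :* c := c :* b :+ d :* a) refl a b c d)
  where open ℚ-Solver

*ᴷ-assoc : ∀ x y z → (x *ᴷ y) *ᴷ z ≡ x *ᴷ (y *ᴷ z)
*ᴷ-assoc (a + b √3) (c + d √3) (e + f √3) = cong₂ _+_√3
  (solve 7 (λ t a b c d e f →
    (a :* c :+ t :* (b :* d)) :* e :+ t :* ((a :* d :+ b :* c) :* f)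
    := a :* (c :* e :+ t :* (d :* f)) :+ t :* (b :* (c :* f :+ d :* e))) refl 3ℚ a b c d e f)
  (solve 7 (λ t a b c d e f →
    (a :* c :+ t :* (b :* d)) :* f :+ (a :* d :+ b :* c) :* e
    := a :* (c :* f :+ d :* e) :+ b :* (c :* e :+ t :* (d :* f))) refl 3ℚ a b c d e f)
  where open ℚ-Solver

*ᴷ-identityˡ : ∀ x → 1ᴷ *ᴷ x ≡ x
*ᴷ-identityˡ (a + b √3) = cong₂ _+_√3
  (solve 3 (λ t a b → con 1ℚ :* a :+ t :* (con 0ℚ :* b) := a) refl 3ℚ a b)
  (solve 2 (λ a b → con 1ℚ :* b :+ con 0ℚ :* a := b) refl a b)
  where open ℚ-Solver

*ᴷ-distribʳ : ∀ x y z → (y +ᴷ z) *ᴷ x ≡ (y *ᴷ x) +ᴷ (z *ᴷ x)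
*ᴷ-distribʳ (a + b √3) (c + d √3) (e + f √3) = cong₂ _+_√3
  (solve 7 (λ t a b c d e f → (c :+ e) :* a :+ t :* ((d :+ f) :* b)
    := (c :* a :+ t :* (d :* b)) :+ (e :* a :+ t :* (f :* b))) refl 3ℚ a b c d e f)
  (solve 6 (λ a b c d e f → (c :+ e) :* b :+ (d :+ f) :* a
    := (c :* b :+ d :* a) :+ (e :* b :+ f :* a)) refl a b c d e f)
  where open ℚ-Solver

abstract
  K-isCommutativeRing : IsCommutativeRing _≡_ _+ᴷ_ _*ᴷ_ -ᴷ_ 0ᴷ 1ᴷ
  K-isCommutativeRing = record
    { isRing = record
      { +-isAbelianGroup = record
        { isGroup = record
          { isMonoid = record
            { isSemigroup = record
              { isMagma = record { isEquivalence = isEquivalence ; ∙-cong = cong₂ _+ᴷ_ }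
              ; assoc = +ᴷ-assoc }
            ; identity = +ᴷ-identityˡ , λ x → trans (+ᴷ-comm x 0ᴷ) (+ᴷ-identityˡ x) }
          ; inverse = -ᴷ-inverseˡ , λ x → trans (+ᴷ-comm x (-ᴷ x)) (-ᴷ-inverseˡ x)
          ; ⁻¹-cong = cong -ᴷ_ }
        ; comm = +ᴷ-comm }
      ; *-cong = cong₂ _*ᴷ_
      ; *-assoc = *ᴷ-assoc
      ; *-identity = *ᴷ-identityˡ , λ x → trans (*ᴷ-comm x 1ᴷ) (*ᴷ-identityˡ x)
      ; distrib = (λ x y z → trans (*ᴷ-comm x _) (trans (*ᴷ-distribʳ x y z)
                    (cong₂ _+ᴷ_ (*ᴷ-comm y x) (*ᴷ-comm z x)))) , *ᴷ-distribʳ }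
    ; *-comm = *ᴷ-comm }

K-ring : CommutativeRing _ _
K-ring = record { isCommutativeRing = K-isCommutativeRing }

recip-inverse : ∀ x .{{_ : NonZeroᴷ x}} → x *ᴷ recip x ≡ 1ᴷ
recip-inverse x@(a + b √3) = cong₂ _+_√3
  (trans (solve 4 (λ t a b i → a :* (a :* i) :+ t :* (b :* (:- (b :* i))) := (a :* a :- t :* (b :* b)) :* i)
      refl 3ℚ a b (ℚ.1/ norm x))
    (ℚ.*-inverseʳ (norm x)))
  (solve 3 (λ a b i → a :* (:- (b :* i)) :+ b :* (a :* i) := con 0ℚ) refl a b (ℚ.1/ norm x))
  where open ℚ-Solver

fromℚ-* : ∀ p q → fromℚ p *ᴷ fromℚ q ≡ fromℚ (p ℚ.* q)
fromℚ-* p q = cong₂ _+_√3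
  (solve 3 (λ t p q → p :* q :+ t :* (con 0ℚ :* con 0ℚ) := p :* q) refl 3ℚ p q)
  (solve 2 (λ p q → p :* con 0ℚ :+ con 0ℚ :* q := con 0ℚ) refl p q)
  where open ℚ-Solver

fromℕᴷ-suc : ∀ n → fromℕᴷ (suc n) ≡ 1ᴷ +ᴷ fromℕᴷ n
fromℕᴷ-suc n = cong fromℚ (ℚ.toℚᵘ-injective (begin
  toℚᵘ (+ suc n ℚ./ 1)                  ≈⟨ ℚ.toℚᵘ-fromℚᵘ (mkℚᵘ (+ suc n) 0) ⟩
  mkℚᵘ (+ suc n) 0                      ≈⟨ *≡* (solve 1 (λ n → (con (+ 1) :+ n) :* con (+ 1)
                                             := (con (+ 1) :* con (+ 1) :+ n :* con (+ 1)) :* con (+ 1)) refl (+ n)) ⟩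
  toℚᵘ 1ℚ ℚᵘ.+ mkℚᵘ (+ n) 0             ≈⟨ ℚᵘ.+-congʳ (toℚᵘ 1ℚ) (ℚ.toℚᵘ-fromℚᵘ (mkℚᵘ (+ n) 0)) ⟨
  toℚᵘ 1ℚ ℚᵘ.+ toℚᵘ (+ n ℚ./ 1)         ≈⟨ ℚ.toℚᵘ-homo-+ 1ℚ (+ n ℚ./ 1) ⟨
  toℚᵘ (1ℚ ℚ.+ (+ n ℚ./ 1))             ∎))
  where
  open ℤ-Solver
  open import Relation.Binary.Reasoning.Setoid ℚᵘ.≃-setoid

1/*-cancel : ∀ m d .{{_ : ℕ.NonZero d}} .{{_ : ℕ.NonZero (suc m ℕ.* d)}} →
  (+ 1 ℚ./ (suc m ℕ.* d)) ℚ.* (+ suc m ℚ./ 1) ≡ + 1 ℚ./ d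
1/*-cancel m d@(suc d-1) = ℚ.toℚᵘ-injective (begin
  toℚᵘ ((+ 1 ℚ./ (suc m ℕ.* d)) ℚ.* (+ suc m ℚ./ 1))
    ≈⟨ ℚ.toℚᵘ-homo-* (+ 1 ℚ./ (suc m ℕ.* d)) (+ suc m ℚ./ 1) ⟩
  toℚᵘ (+ 1 ℚ./ (suc m ℕ.* d)) ℚᵘ.* toℚᵘ (+ suc m ℚ./ 1)
    ≈⟨ ℚᵘ.*-cong (ℚ.toℚᵘ-fromℚᵘ (mkℚᵘ (+ 1) (d-1 ℕ.+ m ℕ.* d))) (ℚ.toℚᵘ-fromℚᵘ (mkℚᵘ (+ suc m) 0)) ⟩
  mkℚᵘ (+ 1) (d-1 ℕ.+ m ℕ.* d) ℚᵘ.* mkℚᵘ (+ suc m) 0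
    ≈⟨ *≡* (cong +_ (trans (cong (ℕ._* d) (ℕ.*-identityˡ (suc m)))
         (sym (trans (ℕ.*-identityˡ _) (ℕ.*-identityʳ _))))) ⟩
  mkℚᵘ (+ 1) d-1
    ≈⟨ ℚ.toℚᵘ-fromℚᵘ (mkℚᵘ (+ 1) d-1) ⟨
  toℚᵘ (+ 1 ℚ./ d) ∎)
  where open import Relation.Binary.Reasoning.Setoid ℚᵘ.≃-setoid

φ : ℕ → K
φ n = fromℚ ((+ 1 ℚ./ (n !)) {{n ℕ.!≢0}})

private
  module R = CommutativeRing K-ring
  module Rₛ = IntegerCoefficients K-ring
  module Pₛ = PowerSeries K-ring
open Pₛ using (ι; P; seriesRing; tail) renaming (1ˢ to 𝟏; _*ˢ_ to _⊛_; _+ˢ_ to _⊕_; -ˢ_ to ⊖_)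

private
  module S = CommutativeRing seriesRing
  module Sₛ = IntegerCoefficients seriesRing

fromℕᴷ≡ι : ∀ n → fromℕᴷ n ≡ ι n
fromℕᴷ≡ι zero    = refl
fromℕᴷ≡ι (suc n) = trans (fromℕᴷ-suc n) (cong (1ᴷ +ᴷ_) (fromℕᴷ≡ι n))

φ-suc : ∀ n → φ (suc n) *ᴷ ι (suc n) ≡ φ n
φ-suc n = trans (cong (φ (suc n) *ᴷ_) (sym (fromℕᴷ≡ι (suc n))))
  (trans (fromℚ-* ((+ 1 ℚ./ (suc n !)) {{suc n ℕ.!≢0}}) (+ suc n ℚ./ 1)) (cong fromℚ (1/*-cancel n (n !) {{n ℕ.!≢0}} {{suc n ℕ.!≢0}})))

K-factorials : Pₛ.ReciprocalFactorials
K-factorials = record { φ = φ ; φ-zero = refl ; φ-suc = φ-suc }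

open Juxtaposition K-ring K-factorials using (ι-!-inverse)
open AlternatingRuns K-ring K-factorials using (egfˢ; geometric; sinˢ; cosˢ; sinhˢ; coshˢ; egfˢ-circular; egfˢ-hyperbolic; module ShortRuns)
open CountVectors K-ring K-factorials using (module Counts)
open ClosedForms K-ring K-factorials using (module ClosedForm; 3ˢ)
open import Algebra.Properties.Monoid.Sum R.+-monoid using (sum-cong-≗)

-- Inverses of series and the elementary functions

lookup-inverseCoeffs : ∀ f .{{_ : NonZeroᴷ (f 0)}} n (i : Fin (suc n)) →
  lookup (inverseCoeffs f n) i ≡ inverse f (n ∸ toℕ i)
lookup-inverseCoeffs f zero    0F          = refl
lookup-inverseCoeffs f (suc n) 0F          = refl
lookup-inverseCoeffs f (suc n) (Fin.suc i) = lookup-inverseCoeffs f n i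

inverse-inverse : ∀ f .{{_ : NonZeroᴷ (f 0)}} → f * inverse f ≈ 𝟏
inverse-inverse f zero    = trans (R.+-identityʳ _) (recip-inverse (f 0))
inverse-inverse f (suc n) = begin
  f 0 *ᴷ (-ᴷ (recip (f 0) *ᴷ s)) +ᴷ (tail f * inverse f) n
    ≡⟨ cong (f 0 *ᴷ (-ᴷ (recip (f 0) *ᴷ s)) +ᴷ_)
         (sum-cong-≗ (λ i → cong (f (suc (toℕ i)) *ᴷ_) (lookup-inverseCoeffs f n i))) ⟨
  f 0 *ᴷ (-ᴷ (recip (f 0) *ᴷ s)) +ᴷ s
    ≡⟨ Rₛ.solve 3 (λ x y s → x Rₛ.:* (Rₛ.:- (y Rₛ.:* s)) Rₛ.:+ s
         Rₛ.:= (Rₛ.con (+ 1) Rₛ.:- x Rₛ.:* y) Rₛ.:* s) refl (f 0) (recip (f 0)) s ⟩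
  (1ᴷ +ᴷ (-ᴷ (f 0 *ᴷ recip (f 0)))) *ᴷ s
    ≡⟨ cong (λ x → (1ᴷ +ᴷ (-ᴷ x)) *ᴷ s) (recip-inverse (f 0)) ⟩
  0ᴷ *ᴷ s
    ≡⟨ R.zeroˡ s ⟩
  0ᴷ ∎
  where
  open ≡-Reasoning
  s = R-sum λ i → f (suc (toℕ i)) *ᴷ lookup (inverseCoeffs f n) i
    where open import Algebra.Definitions.RawSemiring K-rawSemiring using () renaming (sum to R-sum)

inverse-*ˢ : ∀ f .{{_ : NonZeroᴷ (f 0)}} → inverse f * f ≈ 𝟏
inverse-*ˢ f = S.trans {inverse f * f} (S.*-comm (inverse f) f) (inverse-inverse f)

/-unique : ∀ {h f} g .{{_ : NonZeroᴷ (g 0)}} → h * g ≈ f → h ≈ f / g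
/-unique {h} {f} g p = begin
  h                        ≈⟨ S.*-identityʳ h ⟨
  h * 𝟏                    ≈⟨ S.*-congˡ {h} (inverse-inverse g) ⟨
  h * (g * inverse g)      ≈⟨ S.*-assoc h g (inverse g) ⟨
  h * g * inverse g        ≈⟨ Pₛ.*ˢ-cong {g = inverse g} p S.refl ⟩
  f * inverse g            ∎
  where open import Relation.Binary.Reasoning.Setoid S.setoid

-- The coefficient sequences of sin, cos, sinh and cosh are local to their
-- definitions, so they cannot be named here.  They are recovered, up to
-- definitional equality, by running the monoid solver (which collects the
-- atoms of its goal) on a monoid whose equality proofs are lists of atoms.
data Leaves {A : Set} (x y : A) : Set where
  leaves : List A → Leaves x y

leafMonoid : {A : Set} → (A → A → A) → A → Monoid _ _
leafMonoid {A} _∙_ ε = record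
  { Carrier = A ; _≈_ = Leaves ; _∙_ = _∙_ ; ε = ε
  ; isMonoid = record
    { isSemigroup = record
      { isMagma = record
        { isEquivalence = record
          { refl  = leaves []
          ; sym   = λ _ → leaves []
          ; trans = λ { (leaves l) (leaves m) → leaves (l ++ m) } }
        ; ∙-cong = λ { (leaves l) (leaves m) → leaves (l ++ m) } }
      ; assoc = λ _ _ _ → leaves [] }
    ; identity = (λ _ → leaves []) , λ x → leaves (x ∷ []) } }

+-leaves *-leaves : Monoid _ _
+-leaves = leafMonoid ℚ._+_ 0ℚ
*-leaves = leafMonoid ℚ._*_ 1ℚ

leaf : ∀ {x : ℚ} → ℕ → Leaves x x → ℚ
leaf k (leaves l) = go k l
  where
  go : ℕ → List ℚ → ℚ
  go _       []      = 0ℚ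
  go zero    (x ∷ _) = x
  go (suc k) (_ ∷ l) = go k l

Summands : K → Set
Summands x = Leaves (K.rat x ℚ.+ K.irr x) (K.rat x ℚ.+ K.irr x)

-- If x is definitionally y *ᴷ fromℚ p, where y = a + b √3, then the summands
-- are a p, 3 (b 0), a 0 and b p.
Factors : ∀ x → Summands x → Set
Factors x l = Leaves (leaf 0 l ℚ.* leaf 3 l) (leaf 0 l ℚ.* leaf 3 l)

leftFactor : ∀ x l → Factors x l → K
leftFactor x l m = record { rat = leaf 0 m ; irr = leaf 2 m }

sin-summands : ∀ n → Summands (sin n)
sin-summands n = MonoidSolver.solve +-leaves

sin-factors : ∀ n → Factors (sin n) (sin-summands n)
sin-factors n = MonoidSolver.solve *-leaves

cos-summands : ∀ n → Summands (cos n)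
cos-summands n = MonoidSolver.solve +-leaves

cos-factors : ∀ n → Factors (cos n) (cos-summands n)
cos-factors n = MonoidSolver.solve *-leaves

sinh-summands : ∀ n → Summands (sinh n)
sinh-summands n = MonoidSolver.solve +-leaves

sinh-factors : ∀ n → Factors (sinh n) (sinh-summands n)
sinh-factors n = MonoidSolver.solve *-leaves

cosh-summands : ∀ n → Summands (cosh n)
cosh-summands n = MonoidSolver.solve +-leaves

cosh-factors : ∀ n → Factors (cosh n) (cosh-summands n)
cosh-factors n = MonoidSolver.solve *-leaves

egf-circular : ∀ {f} (s : ℕ → K) → f ≈ egf s → (∀ n → s (suc (suc n)) ≡ -ᴷ s n) →
  f ≈ egfˢ (geometric (-ᴷ 1ᴷ) (s 0) (s 1))
egf-circular s p h n = trans (p n) (egfˢ-circular s h n)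

egf-hyperbolic : ∀ {f} (s : ℕ → K) → f ≈ egf s → (∀ n → s (suc (suc n)) ≡ s n) →
  f ≈ egfˢ (geometric 1ᴷ (s 0) (s 1))
egf-hyperbolic s p h n = trans (p n) (egfˢ-hyperbolic s h n)

-- The first `refl` checks that the recovered sequence is the one in the definition, the second is
-- its recurrence. The same holds for the other three functions.
sin≈ : sin ≈ sinˢ
sin≈ = egf-circular (λ n → leftFactor (sin n) (sin-summands n) (sin-factors n)) (λ _ → refl) (λ _ → refl)

cos≈ : cos ≈ cosˢ
cos≈ = egf-circular (λ n → leftFactor (cos n) (cos-summands n) (cos-factors n)) (λ _ → refl) (λ _ → refl)

sinh≈ : sinh ≈ sinhˢ
sinh≈ = egf-hyperbolic (λ n → leftFactor (sinh n) (sinh-summands n) (sinh-factors n)) (λ _ → refl) (λ _ → refl)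

cosh≈ : cosh ≈ coshˢ
cosh≈ = egf-hyperbolic (λ n → leftFactor (cosh n) (cosh-summands n) (cosh-factors n)) (λ _ → refl) (λ _ → refl)

1ˢ≈ : 1ˢ ≈ 𝟏
1ˢ≈ zero    = refl
1ˢ≈ (suc n) = refl

-- The generating functions of c and d as quotients

F : Series
F = sec + tan

F*cos : F * cosˢ ≈ 𝟏 + sinˢ
F*cos = begin
  (1ˢ / cos + sin / cos) * cosˢ
    ≈⟨ S.*-congˡ {F} cos≈ ⟨
  (1ˢ / cos + sin / cos) * cos
    ≈⟨ Sₛ.solve 4 (λ o s i c → (o Sₛ.:* i Sₛ.:+ s Sₛ.:* i) Sₛ.:* c Sₛ.:= (o Sₛ.:+ s) Sₛ.:* (i Sₛ.:* c))
         (λ _ → refl) 1ˢ sin (inverse cos) cos ⟩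
  (1ˢ + sin) * (inverse cos * cos)
    ≈⟨ S.*-cong (S.+-cong {1ˢ} 1ˢ≈ sin≈) (inverse-*ˢ cos) ⟩
  (𝟏 + sinˢ) * 𝟏
    ≈⟨ S.*-identityʳ (𝟏 + sinˢ) ⟩
  𝟏 + sinˢ ∎
  where open import Relation.Binary.Reasoning.Setoid S.setoid

egf-E : egf E ≈ F
egf-E n = begin
  fromℕᴷ (n !) *ᴷ F n *ᴷ φ n     ≡⟨ cong (λ x → x *ᴷ F n *ᴷ φ n) (fromℕᴷ≡ι (n !)) ⟩
  ι (n !) *ᴷ F n *ᴷ φ n          ≡⟨ Rₛ.solve 3 (λ x y z → x Rₛ.:* y Rₛ.:* z Rₛ.:= z Rₛ.:* x Rₛ.:* y) refl (ι (n !)) (F n) (φ n) ⟩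
  φ n *ᴷ ι (n !) *ᴷ F n          ≡⟨ cong (_*ᴷ F n) (ι-!-inverse n) ⟩
  1ᴷ *ᴷ F n                      ≡⟨ R.*-identityˡ (F n) ⟩
  F n                            ∎
  where open ≡-Reasoning

-- Both sides are compatible with a shift by three, which leaves three initial cases.
every-third : ∀ n (f : Series) → (if does (3 ∣? n) then f n else 0ᴷ) ≡ P 0F f n
every-third 0 f = refl
every-third 1 f = refl
every-third 2 f = refl
every-third (suc (suc (suc n))) f =
  trans (cong (if_then f (3 ℕ.+ n) else 0ᴷ)
      (does-⇔ (mk⇔ (λ p → ∣m+n∣m⇒∣n p ∣-refl) (∣m∣n⇒∣m+n ∣-refl)) (3 ∣? (3 ℕ.+ n)) (3 ∣? n)))
    (every-third n (tail (tail (tail f))))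

every3rd-0 : ∀ f → every3rd 0 f ≈ P 0F f
every3rd-0 f n = every-third n f

every3rd-1 : ∀ f → every3rd 1 f ≈ P 1F f
every3rd-1 f zero    = refl
every3rd-1 f (suc n) = every-third n (tail f)

every3rd-2 : ∀ f → every3rd 2 f ≈ P 2F f
every3rd-2 f 0             = refl
every3rd-2 f 1             = refl
every3rd-2 f (suc (suc n)) = every-third n (tail (tail f))

every3rd-3 : ∀ f → f 0 ≡ 1ᴷ → every3rd 3 f ≈ P 0F f - 𝟏
every3rd-3 f p 0 = sym (trans (cong (_+ᴷ (-ᴷ 1ᴷ)) p) refl)
every3rd-3 f p 1 = refl
every3rd-3 f p 2 = refl
every3rd-3 f p (suc (suc (suc n))) = trans (every-third n (tail (tail (tail f)))) (sym (R.+-identityʳ _))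

open ShortRuns F F*cos using (C; D; A*[P₁-P₂]; A*[P₂-P₃]; A*[P₀-P₁]; F₀≈1) renaming (A to A′)
open Counts F F*cos

egfᴺ-c : egfᴺ c ≈ C
egfᴺ-c zero    = refl
egfᴺ-c (suc m) = trans (R.*-comm _ (φ (suc m)))
  (cong (φ (suc m) *ᴷ_) (trans (fromℕᴷ≡ι (countShortRuns m 1)) (ι-countShortRuns-1 m)))

egfᴺ-d : egfᴺ d ≈ D
egfᴺ-d zero    = refl
egfᴺ-d (suc m) = trans (R.*-comm _ (φ (suc m)))
  (cong (φ (suc m) *ᴷ_) (trans (fromℕᴷ≡ι (countShortRuns m 2)) (ι-countShortRuns-2 m)))

P-E : ∀ r → P r (egf E) ≈ P r F
P-E r = Pₛ.P-cong r egf-E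

Q≈ : Q ≈ P 0F F - P 1F F
Q≈ = S.+-cong {every3rd 0 (egf E)} (S.trans {every3rd 0 (egf E)} (every3rd-0 (egf E)) (P-E 0F))
  (S.-‿cong (S.trans {every3rd 1 (egf E)} (every3rd-1 (egf E)) (P-E 1F)))

A-divides : ∀ {f g h} → A′ * f ≈ g → h ≈ f → g * Q ≈ h
A-divides {f} {g} {h} p q = begin
  g * Q
    ≈⟨ S.*-cong (S.sym {A′ * f} p) Q≈ ⟩
  A′ * f * (P 0F F - P 1F F)
    ≈⟨ Sₛ.solve 3 (λ a f q → a Sₛ.:* f Sₛ.:* q Sₛ.:= a Sₛ.:* q Sₛ.:* f) (λ _ → refl) A′ f (P 0F F - P 1F F) ⟩
  A′ * (P 0F F - P 1F F) * f
    ≈⟨ S.*-cong A*[P₀-P₁] (S.sym {h} q) ⟩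
  𝟏 * h
    ≈⟨ S.*-identityˡ h ⟩
  h ∎
  where open import Relation.Binary.Reasoning.Setoid S.setoid

c*Q : egfᴺ c * Q ≈ every3rd 1 (egf E) - every3rd 2 (egf E)
c*Q = S.trans {egfᴺ c * Q} (Pₛ.*ˢ-cong {g = Q} egfᴺ-c S.refl)
  (A-divides A*[P₁-P₂]
    (S.+-cong {every3rd 1 (egf E)} (S.trans {every3rd 1 (egf E)} (every3rd-1 (egf E)) (P-E 1F))
      (S.-‿cong (S.trans {every3rd 2 (egf E)} (every3rd-2 (egf E)) (P-E 2F)))))

d*Q : egfᴺ d * Q ≈ every3rd 2 (egf E) - every3rd 3 (egf E)
d*Q = S.trans {egfᴺ d * Q} (Pₛ.*ˢ-cong {g = Q} egfᴺ-d S.refl)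
  (A-divides A*[P₂-P₃]
    (S.+-cong {every3rd 2 (egf E)} (S.trans {every3rd 2 (egf E)} (every3rd-2 (egf E)) (P-E 2F))
      (S.-‿cong (S.trans {every3rd 3 (egf E)}
        (every3rd-3 (egf E) (trans (egf-E 0) F₀≈1)) (S.+-congʳ { ⊖ 𝟏} (P-E 0F))))))

-- The two `refl` are √3 · √3 = 3 and ½ + ½ = 1, by evaluation in ℚ(√3). The series `N` inverted
-- next has constant term 3.
open ClosedForm F F*cos √3 ½ᴷ refl refl using (r; s; sh; ch; N; module Quotients) renaming (c to c′)
open Quotients (inverse N) (inverse-*ˢ N) using (V; C*Den; D*Den)

·-const : ∀ a f → a · f ≈ (a · 𝟏) * f
·-const = RiccatiSystem.·-const K-ring K-factorials

3·≈ : ∀ {f g} → f ≈ g → fromℕᴷ 3 · f ≈ 3ˢ * g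
3·≈ {f} {g} p n = trans (cong (fromℕᴷ 3 *ᴷ_) (p n))
  (trans (Rₛ.solve 1 (λ x → Rₛ.con (+ 3) Rₛ.:* x Rₛ.:= x Rₛ.:+ x Rₛ.:+ x) refl (g n))
    (Sₛ.solve 1 (λ x → x Sₛ.:+ x Sₛ.:+ x Sₛ.:= Sₛ.con (+ 3) Sₛ.:* x) (λ _ → refl) g n))

⟨x⟩≈ : ∀ a {f g} → f ≈ g → f ⟨ a x⟩ ≈ g ⟨ a x⟩
⟨x⟩≈ a p n = cong ((a ^ n) *ᴷ_) (p n)
  where open import Algebra.Definitions.RawSemiring K-rawSemiring using (_^_)

√3·≈ : √3 · sinh ⟨ ½√3 x⟩ ≈ r * sh
√3·≈ n = trans (cong (√3 *ᴷ_) (⟨x⟩≈ ½√3 sinh≈ n)) (·-const √3 sh n)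

Den : Series
Den = fromℕᴷ 3 · cos ⟨ ½ᴷ x⟩ - √3 · sinh ⟨ ½√3 x⟩

Den≈ : Den ≈ 3ˢ * c′ - r * sh
Den≈ = S.+-cong {fromℕᴷ 3 · cos ⟨ ½ᴷ x⟩} (3·≈ (⟨x⟩≈ ½ᴷ cos≈)) (S.-‿cong √3·≈)

c*Den : egfᴺ c * Den ≈ (fromℕᴷ 2 *ᴷ √3) · sinh ⟨ ½√3 x⟩
c*Den = begin
  egfᴺ c * Den
    ≈⟨ S.*-cong egfᴺ-c Den≈ ⟩
  C * (3ˢ * c′ - r * sh)
    ≈⟨ C*Den ⟩
  V
    ≈⟨ Sₛ.solve 1 (λ x → Sₛ.con (+ 2) Sₛ.:* x Sₛ.:= x Sₛ.:+ x) (λ _ → refl) (r * sh) ⟩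
  r * sh + r * sh
    ≈⟨ S.+-cong {√3 · sinh ⟨ ½√3 x⟩} √3·≈ √3·≈ ⟨
  √3 · sinh ⟨ ½√3 x⟩ + √3 · sinh ⟨ ½√3 x⟩
    ≈⟨ (λ n → Rₛ.solve 2 (λ t x → t Rₛ.:* x Rₛ.:+ t Rₛ.:* x Rₛ.:= Rₛ.con (+ 2) Rₛ.:* t Rₛ.:* x)
         refl √3 ((sinh ⟨ ½√3 x⟩) n)) ⟩
  (fromℕᴷ 2 *ᴷ √3) · sinh ⟨ ½√3 x⟩ ∎
  where open import Relation.Binary.Reasoning.Setoid S.setoid

d*Den : egfᴺ d * Den ≈
  fromℕᴷ 3 · sin ⟨ ½ᴷ x⟩ - fromℕᴷ 3 · cos ⟨ ½ᴷ x⟩ + fromℕᴷ 3 · cosh ⟨ ½√3 x⟩ - √3 · sinh ⟨ ½√3 x⟩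
d*Den = begin
  egfᴺ d * Den
    ≈⟨ S.*-cong egfᴺ-d Den≈ ⟩
  D * (3ˢ * c′ - r * sh)
    ≈⟨ D*Den ⟩
  3ˢ * s - 3ˢ * c′ + 3ˢ * ch - r * sh
    ≈⟨ (λ n → cong₂ _+ᴷ_ (cong₂ _+ᴷ_ (cong₂ (λ x y → x +ᴷ (-ᴷ y)) (3·≈ (⟨x⟩≈ ½ᴷ sin≈) n) (3·≈ (⟨x⟩≈ ½ᴷ cos≈) n))
         (3·≈ (⟨x⟩≈ ½√3 cosh≈) n)) (cong -ᴷ_ (√3·≈ n))) ⟨
  fromℕᴷ 3 · sin ⟨ ½ᴷ x⟩ - fromℕᴷ 3 · cos ⟨ ½ᴷ x⟩ + fromℕᴷ 3 · cosh ⟨ ½√3 x⟩ - √3 · sinh ⟨ ½√3 x⟩ ∎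
  where open import Relation.Binary.Reasoning.Setoid S.setoid

theorem14 : (egfᴺ c ≈ (every3rd 1 (egf E) - every3rd 2 (egf E)) / Q)
    × (egfᴺ d ≈ (every3rd 2 (egf E) - every3rd 3 (egf E)) / Q)
    × (egfᴺ c ≈
    ((fromℕᴷ 2 *ᴷ √3) · sinh ⟨ ½√3 x⟩)
    / (fromℕᴷ 3 · cos ⟨ ½ᴷ x⟩ - √3 · sinh ⟨ ½√3 x⟩))
    × (egfᴺ d ≈
    (fromℕᴷ 3 · sin ⟨ ½ᴷ x⟩ - fromℕᴷ 3 · cos ⟨ ½ᴷ x⟩
    + fromℕᴷ 3 · cosh ⟨ ½√3 x⟩ - √3 · sinh ⟨ ½√3 x⟩)
    / (fromℕᴷ 3 · cos ⟨ ½ᴷ x⟩ - √3 · sinh ⟨ ½√3 x⟩))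
theorem14 = /-unique Q c*Q , /-unique Q d*Q , /-unique Den c*Den , /-unique Den d*Den
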